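{- \textsf{SpecRel} $\vdash$ the following sentence: for all bodies $o,o'$ and all $\bar x,\bar x',\bar y,\bar y'\in Q^4$, if $\mathsf{IOb}(o)$, $\mathsf{IOb}(o')$, $\forall b\,(\mathsf{W}(o,b,\bar x)\leftrightarrow\mathsf{W}(o',b,\bar x'))$ and $\forall b\,(\mathsf{W}(o,b,\bar y)\leftrightarrow\mathsf{W}(o',b,\bar y'))$, then $\mu(\bar x,\bar y)=\mu(\bar x',\bar y')$, where $\mu(\bar x,\bar y):=(x_1-y_1)^2+(x_2-y_2)^2+(x_3-y_3)^2-(x_4-y_4)^2$. Here $\vdash$ denotes derivability in a standard proof system of first-order logic.
   Context: Two-sorted first-order language $\{B,\mathsf{IB},\mathsf{Ph},Q,+,\cdot,<,\mathsf{W}\}$: sorts $B$ (bodies) and $Q$ (quantities); $\mathsf{IB},\mathsf{Ph}$ unary relations on $B$ (inertial bodies, photons); $+,\cdot$ binary functions and $<$ binary relation on $Q$; $\mathsf{W}$ a 6-ary relation of sort $B\,B\,Q\,Q\,Q\,Q$ ($\mathsf{W}(o,b,x,y,z,t)$: observer $o$ coordinatizes body $b$ at $\langle x,y,z,t\rangle$). Bars denote 4-tuples of $Q$-variables. Defined: $\mathsf{Ob}(o):\iff\exists b\,\bar x\ \mathsf{W}(o,b,\bar x)$; $\mathsf{IOb}(o):\iff \mathsf{IB}(o)\wedge\mathsf{Ob}(o)$. \textsf{SpecRel} consists of the axioms: AxField: $\langle Q;+,\cdot,<\rangle$ is a linearly ordered field (with zero $0$). AxSelf: $\forall o\,x y z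 t\ \mathsf{IOb}(o)\to(\mathsf{W}(o,o,x,y,z,t)\leftrightarrow x=y=z=0)$. AxPh: $\forall o\,\bar x\,\bar x'\ \mathsf{IOb}(o)\to\big(\exists p(\mathsf{Ph}(p)\wedge\mathsf{W}(o,p,\bar x)\wedge\mathsf{W}(o,p,\bar x'))\leftrightarrow (x_1-x'_1)^2+(x_2-x'_2)^2+(x_3-x'_3)^2=(x_4-x'_4)^2\big)$. AxEv: $\forall o\,o'\,\bar x\ \mathsf{IOb}(o)\wedge\mathsf{IOb}(o')\to\exists\bar x'\,\forall b\ (\mathsf{W}(o,b,\bar x)\leftrightarrow\mathsf{W}(o',b,\bar x'))$. AxSymd: for all $o,o',\bar x,\bar x',\bar y,\bar y'$: if $\mathsf{IOb}(o)$, $\mathsf{IOb}(o')$, $x_4=y_4$, $x'_4=y'_4$, $\forall b(\mathsf{W}(o,b,\bar x)\leftrightarrow\mathsf{W}(o',b,\bar x'))$ and $\forall b(\mathsf{W}(o,b,\bar y)\leftrightarrow\mathsf{W}(o',b,\bar y'))$, then $(x_1-y_1)^2+(x_2-y_2)^2+(x_3-y_3)^2=(x'_1-y'_1)^2+(x'_2-y'_2)^2+(x'_3-y'_3)^2$. -}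

module Defs where

open import Data.Nat using (ℕ; zero; suc; _+_; _*_)
open import Data.Fin using (Fin; zero; suc; #_; _↑ʳ_)
open import Data.List using (List; []; _∷_; _++_; map)
open import Data.List.Membership.Propositional using (_∈_)
open import Data.Vec as Vec using (Vec; []; _∷_)
open import Function using (_∘_; id)

private
  variable
    m m′ n n′ : ℕ

infixl 8 _⊗_
infixl 7 _⊕_
infix  6 _≈_ _≈ᵇ_ _≺_ _≐_-_
infixr 6 ~_ ∀ᵇ_ ∃ᵇ_ ∀ᑫ_ ∃ᑫ_ ∀⁴_ ∃⁴_
infixr 4 _∧_
infixr 3 _∨_
infixr 2 _⇒_
infix  1 _⇔_
infix  0 _⊢_

-- Well-scoped de Bruijn syntax with a separate variable scope for each sort:
-- m counts the free variables of sort B, n those of sort Q.  The only terms of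
-- sort B are variables, so they are represented directly by Fin m.

data Term (n : ℕ) : Set where
  var     : Fin n → Term n
  _⊕_ _⊗_ : Term n → Term n → Term n

Point : ℕ → Set
Point n = Vec (Term n) 4

data Formula : ℕ → ℕ → Set where
  _≈ᵇ_        : Fin m → Fin m → Formula m n
  _≈_ _≺_     : Term n → Term n → Formula m n
  IB Ph       : Fin m → Formula m n
  W           : Fin m → Fin m → Point n → Formula m n
  ⊥           : Formula m n
  _∧_ _∨_ _⇒_ : Formula m n → Formula m n → Formula m n
  ∀ᵇ_ ∃ᵇ_     : Formula (suc m) n → Formula m n
  ∀ᑫ_ ∃ᑫ_     : Formula m (suc n) → Formula m n

Sentence : Set
Sentence = Formula 0 0

~_ : Formula m n → Formula m n
~ φ = φ ⇒ ⊥

_⇔_ : Formula m n → Formula m n → Formula m n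
φ ⇔ ψ = (φ ⇒ ψ) ∧ (ψ ⇒ φ)

-- Simultaneous capture-avoiding substitution.

subᵗ : (Fin n → Term n′) → Term n → Term n′
subᵗ σ (var i) = σ i
subᵗ σ (s ⊕ t) = subᵗ σ s ⊕ subᵗ σ t
subᵗ σ (s ⊗ t) = subᵗ σ s ⊗ subᵗ σ t

↑ : ∀ k → Term n → Term (k + n)
↑ k = subᵗ (var ∘ (k ↑ʳ_))

liftᵇ : (Fin m → Fin m′) → Fin (suc m) → Fin (suc m′)
liftᵇ ρ zero    = zero
liftᵇ ρ (suc i) = suc (ρ i)

liftᑫ : (Fin n → Term n′) → Fin (suc n) → Term (suc n′)
liftᑫ σ zero    = var zero
liftᑫ σ (suc i) = ↑ 1 (σ i)

sub : (Fin m → Fin m′) → (Fin n → Term n′) → Formula m n → Formula m′ n′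
sub ρ σ (a ≈ᵇ b)  = ρ a ≈ᵇ ρ b
sub ρ σ (s ≈ t)   = subᵗ σ s ≈ subᵗ σ t
sub ρ σ (s ≺ t)   = subᵗ σ s ≺ subᵗ σ t
sub ρ σ (IB a)    = IB (ρ a)
sub ρ σ (Ph a)    = Ph (ρ a)
sub ρ σ (W a b x) = W (ρ a) (ρ b) (Vec.map (subᵗ σ) x)
sub ρ σ ⊥         = ⊥
sub ρ σ (φ ∧ ψ)   = sub ρ σ φ ∧ sub ρ σ ψ
sub ρ σ (φ ∨ ψ)   = sub ρ σ φ ∨ sub ρ σ ψ
sub ρ σ (φ ⇒ ψ)   = sub ρ σ φ ⇒ sub ρ σ ψ
sub ρ σ (∀ᵇ φ)    = ∀ᵇ sub (liftᵇ ρ) σ φ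
sub ρ σ (∃ᵇ φ)    = ∃ᵇ sub (liftᵇ ρ) σ φ
sub ρ σ (∀ᑫ φ)    = ∀ᑫ sub ρ (liftᑫ σ) φ
sub ρ σ (∃ᑫ φ)    = ∃ᑫ sub ρ (liftᑫ σ) φ

wkᵇ : Formula m n → Formula (suc m) n
wkᵇ = sub suc var

wkᑫ : Formula m n → Formula m (suc n)
wkᑫ = sub id (var ∘ suc)

instᵇ : Fin m → Fin (suc m) → Fin m
instᵇ a zero    = a
instᵇ a (suc i) = i

instᑫ : Term n → Fin (suc n) → Term n
instᑫ t zero    = t
instᑫ t (suc i) = var i

_[_]ᵇ : Formula (suc m) n → Fin m → Formula m n
φ [ a ]ᵇ = sub (instᵇ a) var φ

_[_]ᑫ : Formula m (suc n) → Term n → Formula m n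
φ [ t ]ᑫ = sub id (instᑫ t) φ

-- Classical two-sorted natural deduction with equality.

data _⊢_ {m n : ℕ} (Γ : List (Formula m n)) : Formula m n → Set where
  hyp : ∀ {φ} → φ ∈ Γ → Γ ⊢ φ

  raa : ∀ {φ} → ~ φ ∷ Γ ⊢ ⊥ → Γ ⊢ φ

  ∧-intro : ∀ {φ ψ} → Γ ⊢ φ → Γ ⊢ ψ → Γ ⊢ φ ∧ ψ
  ∧-elim₁ : ∀ {φ ψ} → Γ ⊢ φ ∧ ψ → Γ ⊢ φ
  ∧-elim₂ : ∀ {φ ψ} → Γ ⊢ φ ∧ ψ → Γ ⊢ ψ

  ∨-intro₁ : ∀ {φ ψ} → Γ ⊢ φ → Γ ⊢ φ ∨ ψ
  ∨-intro₂ : ∀ {φ ψ} → Γ ⊢ ψ → Γ ⊢ φ ∨ ψ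
  ∨-elim   : ∀ {φ ψ χ} → Γ ⊢ φ ∨ ψ → φ ∷ Γ ⊢ χ → ψ ∷ Γ ⊢ χ → Γ ⊢ χ

  ⇒-intro : ∀ {φ ψ} → φ ∷ Γ ⊢ ψ → Γ ⊢ φ ⇒ ψ
  ⇒-elim  : ∀ {φ ψ} → Γ ⊢ φ ⇒ ψ → Γ ⊢ φ → Γ ⊢ ψ

  ∀ᵇ-intro : ∀ {φ} → map wkᵇ Γ ⊢ φ → Γ ⊢ ∀ᵇ φ
  ∀ᵇ-elim  : ∀ {φ} → Γ ⊢ ∀ᵇ φ → ∀ a → Γ ⊢ φ [ a ]ᵇ
  ∃ᵇ-intro : ∀ {φ} a → Γ ⊢ φ [ a ]ᵇ → Γ ⊢ ∃ᵇ φ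
  ∃ᵇ-elim  : ∀ {φ ψ} → Γ ⊢ ∃ᵇ φ → φ ∷ map wkᵇ Γ ⊢ wkᵇ ψ → Γ ⊢ ψ

  ∀ᑫ-intro : ∀ {φ} → map wkᑫ Γ ⊢ φ → Γ ⊢ ∀ᑫ φ
  ∀ᑫ-elim  : ∀ {φ} → Γ ⊢ ∀ᑫ φ → ∀ t → Γ ⊢ φ [ t ]ᑫ
  ∃ᑫ-intro : ∀ {φ} t → Γ ⊢ φ [ t ]ᑫ → Γ ⊢ ∃ᑫ φ
  ∃ᑫ-elim  : ∀ {φ ψ} → Γ ⊢ ∃ᑫ φ → φ ∷ map wkᑫ Γ ⊢ wkᑫ ψ → Γ ⊢ ψ

  ≈ᵇ-refl  : ∀ a → Γ ⊢ a ≈ᵇ a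
  ≈ᵇ-subst : ∀ φ {a b} → Γ ⊢ a ≈ᵇ b → Γ ⊢ φ [ a ]ᵇ → Γ ⊢ φ [ b ]ᵇ
  ≈-refl   : ∀ t → Γ ⊢ t ≈ t
  ≈-subst  : ∀ φ {s t} → Γ ⊢ s ≈ t → Γ ⊢ φ [ s ]ᑫ → Γ ⊢ φ [ t ]ᑫ

  -- Both sorts are nonempty.  With scoped variables this does not follow from
  -- the quantifier rules, since the scope may have no variable to instantiate.
  inhabitedᵇ : Γ ⊢ ∃ᵇ (zero ≈ᵇ zero)
  inhabitedᑫ : Γ ⊢ ∃ᑫ (var zero ≈ var zero)

∀⁴_ ∃⁴_ : Formula m (4 + n) → Formula m n
∀⁴ φ = ∀ᑫ ∀ᑫ ∀ᑫ ∀ᑫ φ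
∃⁴ φ = ∃ᑫ ∃ᑫ ∃ᑫ ∃ᑫ φ

↑ᵖ : ∀ k → Point n → Point (k + n)
↑ᵖ k = Vec.map (↑ k)

-- tuple k is the 4-tuple bound by the ∀⁴ or ∃⁴ lying k such quantifiers out.
-- The outermost of the four quantifiers binds the first coordinate.
tuple : ∀ k → Point (suc k * 4 + n)
tuple zero    = var (# 3) ∷ var (# 2) ∷ var (# 1) ∷ var (# 0) ∷ []
tuple (suc k) = ↑ᵖ 4 (tuple k)

Ob : Fin m → Formula m n
Ob o = ∃ᵇ ∃⁴ W (suc o) zero (tuple 0)

IOb : Fin m → Formula m n
IOb o = IB o ∧ Ob o

SameEvent : Fin m → Point n → Fin m → Point n → Formula m n
SameEvent o x o′ x′ = ∀ᵇ (W (suc o) zero x ⇔ W (suc o′) zero x′)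

-- The language has no symbols for 0, 1 and subtraction.  They are eliminated in
-- the usual way, by the formulas that define them over an ordered field:
-- u is 0 iff v + u = v for all v, and d = s - t iff d + t = s.

IsZero IsOne Positive : Term n → Formula m n
IsZero   t = ∀ᑫ (var (# 0) ⊕ ↑ 1 t ≈ var (# 0))
IsOne    t = ∀ᑫ (var (# 0) ⊗ ↑ 1 t ≈ var (# 0))
Positive t = ∃ᑫ (IsZero (var (# 0)) ∧ var (# 0) ≺ ↑ 1 t)

_≐_-_ : Term n → Term n → Term n → Formula m n
d ≐ s - t = d ⊕ t ≈ s

-- r = (x₁ - y₁)² + (x₂ - y₂)² + (x₃ - y₃)²
SpaceSq : Point n → Point n → Term n → Formula m n
SpaceSq (x₁ ∷ x₂ ∷ x₃ ∷ x₄ ∷ []) (y₁ ∷ y₂ ∷ y₃ ∷ y₄ ∷ []) r =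
  ∃ᑫ ∃ᑫ ∃ᑫ (d₁ ≐ ↑ 3 x₁ - ↑ 3 y₁ ∧ d₂ ≐ ↑ 3 x₂ - ↑ 3 y₂ ∧ d₃ ≐ ↑ 3 x₃ - ↑ 3 y₃
            ∧ ↑ 3 r ≈ d₁ ⊗ d₁ ⊕ d₂ ⊗ d₂ ⊕ d₃ ⊗ d₃)
  where
  d₁ = var (# 2)
  d₂ = var (# 1)
  d₃ = var (# 0)

-- r = (x₄ - y₄)²
TimeSq : Point n → Point n → Term n → Formula m n
TimeSq (x₁ ∷ x₂ ∷ x₃ ∷ x₄ ∷ []) (y₁ ∷ y₂ ∷ y₃ ∷ y₄ ∷ []) r =
  ∃ᑫ (d ≐ ↑ 1 x₄ - ↑ 1 y₄ ∧ ↑ 1 r ≈ d ⊗ d)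
  where d = var (# 0)

-- r = μ(x, y)
Mu : Point n → Point n → Term n → Formula m n
Mu x y r =
  ∃ᑫ ∃ᑫ (SpaceSq (↑ᵖ 2 x) (↑ᵖ 2 y) s ∧ TimeSq (↑ᵖ 2 x) (↑ᵖ 2 y) t ∧ ↑ 2 r ≐ s - t)
  where
  s = var (# 1)
  t = var (# 0)

-- (x₁ - y₁)² + (x₂ - y₂)² + (x₃ - y₃)² = (x₄ - y₄)²
Lightlike : Point n → Point n → Formula m n
Lightlike x y = ∃ᑫ (SpaceSq (↑ᵖ 1 x) (↑ᵖ 1 y) (var (# 0)) ∧ TimeSq (↑ᵖ 1 x) (↑ᵖ 1 y) (var (# 0)))

EqualSpaceSq : Point n → Point n → Point n → Point n → Formula m n
EqualSpaceSq x y x′ y′ =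
  ∃ᑫ (SpaceSq (↑ᵖ 1 x) (↑ᵖ 1 y) (var (# 0)) ∧ SpaceSq (↑ᵖ 1 x′) (↑ᵖ 1 y′) (var (# 0)))

EqualMu : Point n → Point n → Point n → Point n → Formula m n
EqualMu x y x′ y′ =
  ∃ᑫ (Mu (↑ᵖ 1 x) (↑ᵖ 1 y) (var (# 0)) ∧ Mu (↑ᵖ 1 x′) (↑ᵖ 1 y′) (var (# 0)))

Simultaneous : Point n → Point n → Formula m n
Simultaneous (x₁ ∷ x₂ ∷ x₃ ∷ x₄ ∷ []) (y₁ ∷ y₂ ∷ y₃ ∷ y₄ ∷ []) = x₄ ≈ y₄

AxField : List Sentence
AxField =
    ∀ᑫ ∀ᑫ ∀ᑫ ((x ⊕ y) ⊕ z ≈ x ⊕ (y ⊕ z))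
  ∷ ∀ᑫ ∀ᑫ (a ⊕ b ≈ b ⊕ a)
  ∷ ∃ᑫ IsZero (var (# 0))
  ∷ ∀ᑫ ∃ᑫ IsZero (a ⊕ b)
  ∷ ∀ᑫ ∀ᑫ ∀ᑫ ((x ⊗ y) ⊗ z ≈ x ⊗ (y ⊗ z))
  ∷ ∀ᑫ ∀ᑫ (a ⊗ b ≈ b ⊗ a)
  ∷ ∃ᑫ IsOne (var (# 0))
  ∷ ∀ᑫ (~ IsZero (var (# 0)) ⇒ ∃ᑫ IsOne (a ⊗ b))
  ∷ ∀ᑫ (~ (IsZero (var (# 0)) ∧ IsOne (var (# 0))))
  ∷ ∀ᑫ ∀ᑫ ∀ᑫ (x ⊗ (y ⊕ z) ≈ x ⊗ y ⊕ x ⊗ z)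
  ∷ ∀ᑫ (~ (var (# 0) ≺ var (# 0)))
  ∷ ∀ᑫ ∀ᑫ ∀ᑫ (x ≺ y ∧ y ≺ z ⇒ x ≺ z)
  ∷ ∀ᑫ ∀ᑫ (a ≺ b ∨ a ≈ b ∨ b ≺ a)
  ∷ ∀ᑫ ∀ᑫ ∀ᑫ (x ≺ y ⇒ x ⊕ z ≺ y ⊕ z)
  ∷ ∀ᑫ ∀ᑫ (Positive a ∧ Positive b ⇒ Positive (a ⊗ b))
  ∷ []
  where
  x y z : Term 3
  x = var (# 2)
  y = var (# 1)
  z = var (# 0)
  a b : Term 2
  a = var (# 1)
  b = var (# 0)

AxSelf : Sentence
AxSelf = ∀ᵇ ∀ᑫ ∀ᑫ ∀ᑫ ∀ᑫ
  (IOb o ⇒ (W o o (x ∷ y ∷ z ∷ t ∷ []) ⇔ x ≈ y ∧ y ≈ z ∧ IsZero z))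
  where
  o = # 0
  x = var (# 3)
  y = var (# 2)
  z = var (# 1)
  t = var (# 0)

AxPh : Sentence
AxPh = ∀ᵇ ∀⁴ ∀⁴
  (IOb o ⇒ ((∃ᵇ (Ph (# 0) ∧ W (suc o) (# 0) x ∧ W (suc o) (# 0) x′)) ⇔ Lightlike x x′))
  where
  o  = # 0
  x  = tuple 1
  x′ = tuple 0

AxEv : Sentence
AxEv = ∀ᵇ ∀ᵇ ∀⁴ (IOb o ∧ IOb o′ ⇒ ∃⁴ SameEvent o (tuple 1) o′ (tuple 0))
  where
  o  = # 1
  o′ = # 0

AxSymd : Sentence
AxSymd = ∀ᵇ ∀ᵇ ∀⁴ ∀⁴ ∀⁴ ∀⁴
  (IOb o ∧ IOb o′ ∧ Simultaneous x y ∧ Simultaneous x′ y′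
    ∧ SameEvent o x o′ x′ ∧ SameEvent o y o′ y′
   ⇒ EqualSpaceSq x y x′ y′)
  where
  o  = # 1
  o′ = # 0
  x  = tuple 3
  x′ = tuple 2
  y  = tuple 1
  y′ = tuple 0

SpecRel : List Sentence
SpecRel = AxField ++ AxSelf ∷ AxPh ∷ AxEv ∷ AxSymd ∷ []

IntervalInvariance : Sentence
IntervalInvariance = ∀ᵇ ∀ᵇ ∀⁴ ∀⁴ ∀⁴ ∀⁴
  (IOb o ∧ IOb o′ ∧ SameEvent o x o′ x′ ∧ SameEvent o y o′ y′ ⇒ EqualMu x y x′ y′)
  where
  o  = # 1
  o′ = # 0
  x  = tuple 3
  x′ = tuple 2
  y  = tuple 1
  y′ = tuple 0

{-# OPTIONS --safe #-}
module Submission where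

-- The photon axiom makes the worldview transformation w between two inertial
-- observers a bijection of Q⁴ preserving lightlike separation both ways.  Such a w
-- maps light lines to light lines and null hyperplanes to null hyperplanes, hence
-- parallel light lines to parallel ones; parallelograms of light lines then show that
-- T x = w x - w 0 is additive.  Images of integral null vectors show that the vectors
-- T eᵢ are orthogonal with squares ±κ, light lines give T (a eᵢ) = θ a · T eᵢ, and the
-- null vectors (1 - s², 2s, 0, 1 + s²) make θ a field automorphism, so that
-- μ (T x) = κ θ (μ x).  Some vector u with μ u ≠ 0 is simultaneous for both observers,
-- and AxSymd on the multiples of u forces θ = id and κ = 1.
--
-- Derivability is obtained from this semantic argument by a constructive Henkin
-- completeness theorem: in the models used, ⊥ is interpreted by an arbitrary
-- proposition, which is finally taken to be the derivability of ⊥.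

open import Defs hiding (_≈_)
open import Algebra.Bundles using (CommutativeRing; RawRing)
import Algebra.Properties.AbelianGroup as AbelianGroupProperties
import Algebra.Properties.Ring as RingProperties
import Algebra.Properties.Semiring.Mult.TCOptimised as Mult
import Algebra.Solver.Ring as RingSolver
open import Algebra.Solver.Ring.AlmostCommutativeRing
  using (fromCommutativeRing; _-Raw-AlmostCommutative⟶_; Induced-equivalence)
open import Data.Empty using (⊥-elim)
open import Data.Fin using (Fin; zero; suc; toℕ; #_)
open import Data.Fin.Patterns using (0F; 1F; 2F; 3F)
open import Data.List using
  (List; []; _∷_; _++_; map; concatMap; upTo; allFin; cartesianProductWith; lookup)
open import Data.List.Membership.Propositional using (_∈_; lose)
open import Data.List.Membership.Propositional.Properties
  using (∈-map⁺; ∈-++⁺ˡ; ∈-++⁺ʳ; ∈-allFin; ∈-cartesianProductWith⁺; ∈-concatMap⁺; ∈-upTo⁺; ∈-lookup)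
open import Data.List.Properties using (map-∘)
open import Data.List.Relation.Binary.Subset.Propositional using (_⊆_)
open import Data.List.Relation.Binary.Subset.Propositional.Properties using (∷⁺ʳ; map⁺; ++⁺; ⊆-refl)
open import Data.List.Relation.Unary.All as All using (All; []; _∷_; tabulate)
open import Data.List.Relation.Unary.Any using (here; there)
open import Data.Maybe using (just; nothing)
open import Data.Nat as ℕ using (ℕ; zero; suc; _∸_; _⊔_; _≤_; s≤s; z≤n; _≤?_)
import Data.Nat.Properties as ℕₚ
open import Data.Product using (_×_; _,_; proj₁; proj₂; ∃-syntax)
open import Data.Sum using (_⊎_; inj₁; inj₂)
open import Data.Vec as Vec using (Vec; []; _∷_)
open import Data.Vec.Functional using () renaming (_∷_ to _◂_)
import Data.Vec.Properties as Vecₚ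
open import Function using (_∘_; id; _$_)
open import Level using (0ℓ)
open import Relation.Binary.Definitions using (WeaklyDecidable)
open import Relation.Binary.PropositionalEquality as ≡ using (_≡_; _≢_; _≗_)
import Relation.Binary.Reasoning.Setoid as SetoidReasoning
open import Relation.Nullary using (yes; no)

-- The field is an arbitrary ordered field, without square roots or continuity. Vectors cannot be
-- normalised, so every construction is rational, and the order enters through one consequence: a² +
-- b² + c² = 0 forces a = b = c = 0. Light signals alone cannot determine the transformation: a
-- dilation, or a field automorphism applied to every coordinate (such as the conjugation of ℚ(√2)),
-- also preserves lightlike separation. So κ and θ remain unknown until `AxSymd` is used, and the
-- vector to which it is applied has to be found while θ is still arbitrary; this is where
-- surjectivity of θ is needed. Likewise orthogonality of the T eᵢ is tested with integral
-- coefficients because T is only known to be additive at that point. The argument is constructive,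
-- with `Absurd` in the role of falsity. Equations are stable under double negation into `Absurd`,
-- so a case distinction is available whenever the goal is an equation, and division whenever the
-- divisor is refutably 0.

private
  variable
    m m′ m″ n n′ n″ : ℕ

-- Ring solver with integer coefficients

module IntegerCoefficients (K : CommutativeRing 0ℓ 0ℓ) where
  open CommutativeRing K
  open Mult semiring renaming (_×_ to _×′_)
  open RingProperties ring using (-‿distribˡ-*; -‿distribʳ-*; -0#≈0#)
  open AbelianGroupProperties +-abelianGroup using (⁻¹-∙-comm; ⁻¹-involutive)
  open SetoidReasoning setoid

  -- Truncated subtraction removes the common part, so one component is always 0 and coefficients
  -- stay small.
  reduce : ℕ → ℕ → ℕ × ℕ
  reduce p q = p ℕ.∸ q , q ℕ.∸ p

  -- (p , q) stands for the integer p - q.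
  differences : RawRing 0ℓ 0ℓ
  differences = record
    { Carrier = ℕ × ℕ
    ; _≈_     = _≡_
    ; _+_     = λ { (p , q) (r , s) → reduce (p ℕ.+ r) (q ℕ.+ s) }
    ; _*_     = λ { (p , q) (r , s) → reduce (p ℕ.* r ℕ.+ q ℕ.* s) (p ℕ.* s ℕ.+ q ℕ.* r) }
    ; -_      = λ { (p , q) → q , p }
    ; 0#      = 0 , 0
    ; 1#      = 1 , 0
    }

  ι : ℕ → Carrier
  ι n = n ×′ 1#

  -- The case q = 0 is separate so that literals are interpreted without "- 0#".
  embed : ℕ × ℕ → Carrier
  embed (p , zero)  = ι p
  embed (p , suc q) = ι p - ι (suc q)

  embed≈ : ∀ p q → embed (p , q) ≈ ι p - ι q
  embed≈ p zero    = sym (trans (+-congˡ -0#≈0#) (+-identityʳ (ι p)))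
  embed≈ p (suc q) = refl

  ι-+ : ∀ m n → ι (m ℕ.+ n) ≈ ι m + ι n
  ι-+ = ×-homo-+ 1#

  swap-middle : ∀ a b c d → (a + b) + (c + d) ≈ (a + c) + (b + d)
  swap-middle a b c d = begin
    (a + b) + (c + d) ≈⟨ +-assoc a b (c + d) ⟩
    a + (b + (c + d)) ≈⟨ +-congˡ (trans (sym (+-assoc b c d)) (+-congʳ (+-comm b c))) ⟩
    a + ((c + b) + d) ≈⟨ +-congˡ (+-assoc c b d) ⟩
    a + (c + (b + d)) ≈⟨ +-assoc a c (b + d) ⟨
    (a + c) + (b + d) ∎

  difference-+ : ∀ a b c d → (a + c) - (b + d) ≈ (a - b) + (c - d)
  difference-+ a b c d = trans (+-congˡ (sym (⁻¹-∙-comm b d))) (swap-middle a c (- b) (- d))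

  difference-* : ∀ a b c d → (a * c + b * d) - (a * d + b * c) ≈ (a - b) * (c - d)
  difference-* a b c d = sym (begin
    (a - b) * (c - d)                              ≈⟨ distribʳ (c - d) a (- b) ⟩
    a * (c - d) + - b * (c - d)                    ≈⟨ +-cong (distribˡ a c (- d)) (distribˡ (- b) c (- d)) ⟩
    (a * c + a * - d) + (- b * c + - b * - d)      ≈⟨ +-cong (+-congˡ (sym (-‿distribʳ-* a d)))
                                                        (trans (+-cong (sym (-‿distribˡ-* b c)) minus²)
                                                               (+-comm _ _)) ⟩
    (a * c - a * d) + (b * d - b * c)              ≈⟨ swap-middle _ _ _ _ ⟩
    (a * c + b * d) + (- (a * d) + - (b * c))      ≈⟨ +-congˡ (⁻¹-∙-comm _ _) ⟩
    (a * c + b * d) - (a * d + b * c)              ∎)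
    where
    minus² : - b * - d ≈ b * d
    minus² = trans (sym (-‿distribˡ-* b (- d)))
               (trans (-‿cong (sym (-‿distribʳ-* b d))) (⁻¹-involutive (b * d)))

  insert : ∀ a b c → a - b ≈ (c + a) - (c + b)
  insert a b c = sym (trans (difference-+ c c a b)
                       (trans (+-congʳ (-‿inverseʳ c)) (+-identityˡ (a - b))))

  embed-reduce : ∀ p q → embed (reduce p q) ≈ ι p - ι q
  embed-reduce zero    zero    = embed≈ 0 0
  embed-reduce zero    (suc q) = refl
  embed-reduce (suc p) zero    = embed≈ (suc p) 0
  embed-reduce (suc p) (suc q) = begin
    embed (reduce p q)            ≈⟨ embed-reduce p q ⟩
    ι p - ι q                     ≈⟨ insert (ι p) (ι q) 1# ⟩
    (1# + ι p) - (1# + ι q)       ≈⟨ +-cong (1+× p 1#) (-‿cong (1+× q 1#)) ⟨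
    ι (suc p) - ι (suc q)         ∎

  homomorphism : differences -Raw-AlmostCommutative⟶ fromCommutativeRing K
  homomorphism = record
    { ⟦_⟧    = embed
    ; +-homo = λ { (p , q) (r , s) → begin
        embed (reduce (p ℕ.+ r) (q ℕ.+ s))    ≈⟨ embed-reduce (p ℕ.+ r) (q ℕ.+ s) ⟩
        ι (p ℕ.+ r) - ι (q ℕ.+ s)             ≈⟨ +-cong (ι-+ p r) (-‿cong (ι-+ q s)) ⟩
        (ι p + ι r) - (ι q + ι s)             ≈⟨ difference-+ _ _ _ _ ⟩
        (ι p - ι q) + (ι r - ι s)             ≈⟨ +-cong (embed≈ p q) (embed≈ r s) ⟨
        embed (p , q) + embed (r , s)         ∎ }
    ; *-homo = λ { (p , q) (r , s) → begin
        embed (reduce (p ℕ.* r ℕ.+ q ℕ.* s) (p ℕ.* s ℕ.+ q ℕ.* r))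
          ≈⟨ embed-reduce (p ℕ.* r ℕ.+ q ℕ.* s) (p ℕ.* s ℕ.+ q ℕ.* r) ⟩
        ι (p ℕ.* r ℕ.+ q ℕ.* s) - ι (p ℕ.* s ℕ.+ q ℕ.* r)
          ≈⟨ +-cong (ι-+* p r q s) (-‿cong (ι-+* p s q r)) ⟩
        (ι p * ι r + ι q * ι s) - (ι p * ι s + ι q * ι r)
          ≈⟨ difference-* _ _ _ _ ⟩
        (ι p - ι q) * (ι r - ι s)
          ≈⟨ *-cong (embed≈ p q) (embed≈ r s) ⟨
        embed (p , q) * embed (r , s) ∎ }
    ; -‿homo = λ { (p , q) → begin
        embed (q , p)     ≈⟨ embed≈ q p ⟩
        ι q - ι p         ≈⟨ +-comm _ _ ⟩
        - ι p + ι q       ≈⟨ +-congˡ (⁻¹-involutive (ι q)) ⟨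
        - ι p - - ι q     ≈⟨ ⁻¹-∙-comm (ι p) (- ι q) ⟩
        - (ι p - ι q)     ≈⟨ -‿cong (embed≈ p q) ⟨
        - embed (p , q)   ∎ }
    ; 0-homo = refl
    ; 1-homo = refl
    }
    where
    ι-+* : ∀ p r q s → ι (p ℕ.* r ℕ.+ q ℕ.* s) ≈ ι p * ι r + ι q * ι s
    ι-+* p r q s = trans (ι-+ (p ℕ.* r) (q ℕ.* s)) (+-cong (×1-homo-* p r) (×1-homo-* q s))

  equal? : WeaklyDecidable (Induced-equivalence homomorphism)
  equal? (p , q) (r , s) with p ℕ.+ s ℕ.≟ r ℕ.+ q
  ... | no _     = nothing
  ... | yes p+s≡r+q = just (begin
    embed (p , q)             ≈⟨ embed≈ p q ⟩
    ι p - ι q                 ≈⟨ insert (ι p) (ι q) (ι s) ⟩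
    (ι s + ι p) - (ι s + ι q) ≈⟨ +-congʳ (trans (ι-+ p s) (+-comm (ι p) (ι s))) ⟨
    ι (p ℕ.+ s) - (ι s + ι q) ≡⟨ ≡.cong (λ n → ι n - (ι s + ι q)) p+s≡r+q ⟩
    ι (r ℕ.+ q) - (ι s + ι q) ≈⟨ +-cong (trans (ι-+ r q) (+-comm (ι r) (ι q))) (-‿cong (+-comm (ι s) (ι q))) ⟩
    (ι q + ι r) - (ι q + ι s) ≈⟨ insert (ι r) (ι s) (ι q) ⟨
    ι r - ι s                 ≈⟨ embed≈ r s ⟨
    embed (r , s)             ∎)
  open RingSolver differences (fromCommutativeRing K) homomorphism equal? public
    using (solve; _:=_; _:+_; _:*_; _:-_; :-_; con; Polynomial)

  lit : ∀ {n} → ℕ → Polynomial n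
  lit k = con (k , 0)

-- Ordered rings and formal reality

record OrderedRing : Set₁ where
  infix 4 _<_
  field
    ring   : CommutativeRing 0ℓ 0ℓ
    Absurd : Set
  open CommutativeRing ring public hiding (ring)
  field
    ≈-stable   : ∀ {a b} → ((a ≈ b → Absurd) → Absurd) → a ≈ b
    _<_        : Carrier → Carrier → Set
    <-respˡ    : ∀ {a a′ b} → a ≈ a′ → a < b → a′ < b
    <-respʳ    : ∀ {a b b′} → b ≈ b′ → a < b → a < b′
    <-irrefl   : ∀ a → a < a → Absurd
    <-trans    : ∀ a b c → a < b × b < c → a < c
    <-tri      : ∀ a b → (a < b → Absurd) → (a ≈ b → Absurd) → (b < a → Absurd) → Absurd
    +-monoˡ-<  : ∀ a b c → a < b → a + c < b + c
    *-positive : ∀ a b → 0# < a → 0# < b → 0# < a * b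

module SumsOfSquares (K : OrderedRing) where
  open OrderedRing K
  open IntegerCoefficients ring

  +-positive : ∀ {a b} → 0# < a → 0# < b → 0# < (a + b)
  +-positive {a} {b} 0<a 0<b =
    <-trans 0# b (a + b) (0<b , <-respˡ (+-identityˡ b) (+-monoˡ-< 0# a b 0<a))

  square-positive : ∀ a → (0# < (a * a) → Absurd) → (a ≈ 0# → Absurd) → Absurd
  square-positive a pos zer = <-tri a 0#
    (λ a<0 → let 0<-a = <-respˡ (-‿inverseʳ a) (<-respʳ (+-identityˡ (- a)) (+-monoˡ-< a 0# (- a) a<0)) in
      pos (<-respʳ (solve 1 (λ a → (:- a) :* (:- a) := a :* a) refl a) (*-positive (- a) (- a) 0<-a 0<-a)))
    zer
    (λ 0<a → pos (*-positive a a 0<a 0<a))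

  +-square-positive : ∀ {a} b → 0# < a → (0# < (a + b * b) → Absurd) → Absurd
  +-square-positive {a} b 0<a k = square-positive b
    (λ 0<bb → k (+-positive 0<a 0<bb))
    (λ b≈0 → k (<-respʳ (sym (trans (+-congˡ (trans (*-congʳ b≈0) (zeroˡ b))) (+-identityʳ a))) 0<a))

  -- If `a` were nonzero, a² would be positive and would stay positive after adding further squares.
  real : ∀ a b c → a * a + b * b + c * c ≈ 0# → a ≈ 0#
  real a b c e = ≈-stable λ a≉0 → square-positive a
    (λ 0<aa → +-square-positive b 0<aa λ l → +-square-positive c l λ l′ → <-irrefl 0# (<-respʳ e l′))
    a≉0

-- Three squares match the three space dimensions: they make a null vector without time component
-- vanish.
record RealField : Set₁ where
  field
    ring   : CommutativeRing 0ℓ 0ℓ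
    Absurd : Set
  open CommutativeRing ring public hiding (ring; _≉_)
  field
    ≈-stable : ∀ {a b} → ((a ≈ b → Absurd) → Absurd) → a ≈ b
    1≉0      : 1# ≈ 0# → Absurd
    inverse  : ∀ {a} → (a ≈ 0# → Absurd) → ∃[ b ] a * b ≈ 1#
    real     : ∀ {a b c} → a * a + b * b + c * c ≈ 0# → a ≈ 0#

-- Minkowski space over a formally real field

module Geometry (K : RealField) where
  open RealField K
  open IntegerCoefficients ring

  V : Set
  V = Fin 4 → Carrier

  infix  4 _≋_ _≉_
  infixl 6 _⊞_ _⊟_
  infixl 7 _·_

  _≉_ : Carrier → Carrier → Set
  a ≉ b = a ≈ b → Absurd

  record _≋_ (u v : V) : Set where
    constructor pointwise
    field at : ∀ i → u i ≈ v i

  open _≋_ public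

  _⊞_ _⊟_ : V → V → V
  (u ⊞ v) i = u i + v i
  (u ⊟ v) i = u i - v i

  _·_ : Carrier → V → V
  (s · v) i = s * v i

  𝟎 : V
  𝟎 _ = 0#

  opaque
    B : V → V → Carrier
    B u v = u 0F * v 0F + u 1F * v 1F + u 2F * v 2F - u 3F * v 3F

  Null Nonzero : V → Set
  Null v = B v v ≈ 0#
  Nonzero v = v ≋ 𝟎 → Absurd

  -- Excluded middle for an arbitrary `P`, paid for by the stability of the equation in the goal.
  by-cases : ∀ {P : Set} {a b} → (P → a ≈ b) → ((P → Absurd) → a ≈ b) → a ≈ b
  by-cases f g = ≈-stable λ k → k (g λ p → k (f p))

  scale≈0 : ∀ c {x} → x ≈ 0# → c * x ≈ 0#
  scale≈0 c p = trans (*-congˡ p) (zeroʳ c)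

  sum≈0 : ∀ {x y} → x ≈ 0# → y ≈ 0# → x + y ≈ 0#
  sum≈0 p q = trans (+-cong p q) (+-identityˡ 0#)

  neg≈0 : ∀ {x} → x ≈ 0# → - x ≈ 0#
  neg≈0 {x} p = trans (-‿cong p) (solve 0 (:- lit 0 := lit 0) refl)

  ≈⇒-≈0 : ∀ {x y} → x ≈ y → x - y ≈ 0#
  ≈⇒-≈0 {x} {y} p = trans (+-congʳ p) (-‿inverseʳ y)

  -≈0⇒≈ : ∀ {x y} → x - y ≈ 0# → x ≈ y
  -≈0⇒≈ {x} {y} p = trans (solve 2 (λ x y → x := (x :- y) :+ y) refl x y)
                      (trans (+-congʳ p) (+-identityˡ y))

  cancel : ∀ {a x} → a ≉ 0# → a * x ≈ 0# → x ≈ 0#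
  cancel {a} {x} a≉0 p = let b , ab≈1 = inverse a≉0 in
    trans (sym (*-identityˡ x)) (trans (*-congʳ (sym ab≈1))
      (trans (solve 3 (λ a b x → a :* b :* x := b :* (a :* x)) refl a b x) (scale≈0 b p)))

  -- Formal reality excludes characteristic 2, since x (x + x) is the sum of squares x² + x² + 0²;
  -- three squares exclude 3 in the same way.
  double≈0 : ∀ {x} → x + x ≈ 0# → x ≈ 0#
  double≈0 {x} p = real (trans
    (solve 1 (λ x → x :* x :+ x :* x :+ lit 0 :* lit 0 := x :* (x :+ x)) refl x) (scale≈0 x p))

  triple≈0 : ∀ {x} → x + x + x ≈ 0# → x ≈ 0#
  triple≈0 {x} p = real (trans
    (solve 1 (λ x → x :* x :+ x :* x :+ x :* x := x :* (x :+ x :+ x)) refl x) (scale≈0 x p))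

  real₂ : ∀ {a b c} → a * a + b * b + c * c ≈ 0# → b ≈ 0#
  real₂ {a} {b} {c} p = real (trans (+-congʳ (+-comm (b * b) (a * a))) p)

  real₃ : ∀ {a b c} → a * a + b * b + c * c ≈ 0# → c ≈ 0#
  real₃ {a} {b} {c} p = real (trans
    (solve 3 (λ x y z → z :+ y :+ x := x :+ y :+ z) refl (a * a) (b * b) (c * c)) p)

  half : Carrier
  half = proj₁ (inverse {1# + 1#} (1≉0 ∘ double≈0))

  half-double : (1# + 1#) * half ≈ 1#
  half-double = proj₂ (inverse {1# + 1#} (1≉0 ∘ double≈0))

  ≋-refl : ∀ {u} → u ≋ u
  ≋-refl = pointwise λ i → refl

  ≋-sym : ∀ {u v} → u ≋ v → v ≋ u
  ≋-sym p = pointwise λ i → sym (at p i)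

  ≋-trans : ∀ {u v w} → u ≋ v → v ≋ w → u ≋ w
  ≋-trans p q = pointwise λ i → trans (at p i) (at q i)

  ⊞-cong : ∀ {u u′ v v′} → u ≋ u′ → v ≋ v′ → u ⊞ v ≋ u′ ⊞ v′
  ⊞-cong p q = pointwise λ i → +-cong (at p i) (at q i)

  ⊟-cong : ∀ {u u′ v v′} → u ≋ u′ → v ≋ v′ → u ⊟ v ≋ u′ ⊟ v′
  ⊟-cong p q = pointwise λ i → +-cong (at p i) (-‿cong (at q i))

  ·-cong : ∀ {s s′ v v′} → s ≈ s′ → v ≋ v′ → s · v ≋ s′ · v′
  ·-cong p q = pointwise λ i → *-cong p (at q i)

  ⊞-⊟ : ∀ a v → (a ⊞ v) ⊟ a ≋ v
  ⊞-⊟ a v = pointwise λ i → solve 2 (λ a v → a :+ v :- a := v) refl (a i) (v i)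

  ⊟-⊞ : ∀ a v → a ⊞ (v ⊟ a) ≋ v
  ⊟-⊞ a v = pointwise λ i → solve 2 (λ a v → a :+ (v :- a) := v) refl (a i) (v i)

  opaque
    unfolding B

    B-expand : ∀ u v → B u v ≈ u 0F * v 0F + u 1F * v 1F + u 2F * v 2F - u 3F * v 3F
    B-expand u v = refl

    B-cong : ∀ {u u′ v v′} → u ≋ u′ → v ≋ v′ → B u v ≈ B u′ v′
    B-cong p q = +-cong (+-cong (+-cong (*-cong (at p 0F) (at q 0F)) (*-cong (at p 1F) (at q 1F)))
                        (*-cong (at p 2F) (at q 2F))) (-‿cong (*-cong (at p 3F) (at q 3F)))

    B-sym : ∀ u v → B u v ≈ B v u
    B-sym u v = +-cong (+-cong (+-cong (*-comm _ _) (*-comm _ _)) (*-comm _ _)) (-‿cong (*-comm _ _))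

  null-cong : ∀ {u v} → u ≋ v → Null u → Null v
  null-cong p n = trans (B-cong (≋-sym p) (≋-sym p)) n

  -- Without a time component the three space squares would sum to 0.
  time≉0 : ∀ {v} → Null v → Nonzero v → v 3F ≉ 0#
  time≉0 {v} nv v≉𝟎 t≈0 = v≉𝟎 $ pointwise λ where
      0F → real squares
      1F → real₂ squares
      2F → real₃ squares
      3F → t≈0
    where
    squares : v 0F * v 0F + v 1F * v 1F + v 2F * v 2F ≈ 0#
    squares = trans (-≈0⇒≈ (trans (sym (B-expand v v)) nv)) (scale≈0 (v 3F) t≈0)

  -- Write t, d for the time components of `v`, `u`. The minors t uᵢ - d vᵢ have sum of squares t²
  -- B(u,u) - 2td B(u,v) + d² B(v,v) = 0, so each vanishes, and t is invertible.
  null-proportional : ∀ {u v} → Null u → Null v → Nonzero v → B u v ≈ 0# → ∃[ r ] u ≋ r · v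
  null-proportional {u} {v} nu nv v≉𝟎 ortho =
    let t⁻¹ , eq = inverse (time≉0 nv v≉𝟎)
        det = minors
    in t⁻¹ * u 3F , pointwise λ i → trans (sym (*-identityˡ (u i))) (trans (*-congʳ (sym eq))
         (trans (solve 3 (λ t s x → t :* s :* x := s :* (t :* x)) refl (v 3F) t⁻¹ (u i))
           (trans (*-congˡ (-≈0⇒≈ (det i))) (sym (*-assoc t⁻¹ (u 3F) (v i))))))
    where
    minor : Fin 4 → Carrier
    minor i = v 3F * u i - u 3F * v i

    squares : minor 0F * minor 0F + minor 1F * minor 1F + minor 2F * minor 2F ≈ 0#
    squares = trans (trans
      (solve 8 (λ a b c d x y z t →
        (t :* a :- d :* x) :* (t :* a :- d :* x) :+ (t :* b :- d :* y) :* (t :* b :- d :* y)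
          :+ (t :* c :- d :* z) :* (t :* c :- d :* z)
        := t :* t :* (a :* a :+ b :* b :+ c :* c :- d :* d)
          :+ (:- (lit 2 :* t :* d)) :* (a :* x :+ b :* y :+ c :* z :- d :* t)
          :+ d :* d :* (x :* x :+ y :* y :+ z :* z :- t :* t)) refl
        (u 0F) (u 1F) (u 2F) (u 3F) (v 0F) (v 1F) (v 2F) (v 3F))
      (+-cong (+-cong (*-congˡ (sym (B-expand u u))) (*-congˡ (sym (B-expand u v))))
              (*-congˡ (sym (B-expand v v)))))
      (sum≈0 (sum≈0 (scale≈0 _ nu) (scale≈0 _ ortho)) (scale≈0 _ nv))

    minors : ∀ i → minor i ≈ 0#
    minors 0F = real squares
    minors 1F = real₂ squares
    minors 2F = real₃ squares
    minors 3F = ≈⇒-≈0 (*-comm _ _)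

  opaque
    unfolding B

    B-⊞ˡ : ∀ u v w → B (u ⊞ v) w ≈ B u w + B v w
    B-⊞ˡ u v w = solve 12
      (λ a b c d a′ b′ c′ d′ x y z t →
        (a :+ a′) :* x :+ (b :+ b′) :* y :+ (c :+ c′) :* z :- (d :+ d′) :* t
        := (a :* x :+ b :* y :+ c :* z :- d :* t) :+ (a′ :* x :+ b′ :* y :+ c′ :* z :- d′ :* t)) refl
      (u 0F) (u 1F) (u 2F) (u 3F) (v 0F) (v 1F) (v 2F) (v 3F) (w 0F) (w 1F) (w 2F) (w 3F)

    B-·ˡ : ∀ s u w → B (s · u) w ≈ s * B u w
    B-·ˡ s u w = solve 9
      (λ s a b c d x y z t →
        s :* a :* x :+ s :* b :* y :+ s :* c :* z :- s :* d :* t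
        := s :* (a :* x :+ b :* y :+ c :* z :- d :* t)) refl
      s (u 0F) (u 1F) (u 2F) (u 3F) (w 0F) (w 1F) (w 2F) (w 3F)

  B-⊞ʳ : ∀ w u v → B w (u ⊞ v) ≈ B w u + B w v
  B-⊞ʳ w u v = trans (B-sym w (u ⊞ v)) (trans (B-⊞ˡ u v w) (+-cong (B-sym u w) (B-sym v w)))

  B-·ʳ : ∀ s w u → B w (s · u) ≈ s * B w u
  B-·ʳ s w u = trans (B-sym w (s · u)) (trans (B-·ˡ s u w) (*-congˡ (B-sym u w)))

  null-scale : ∀ s {v} → Null v → Null (s · v)
  null-scale s {v} n = trans (B-·ˡ s v (s · v)) (scale≈0 s (trans (B-·ʳ s v v) (scale≈0 s n)))

  ⊟-as-⊞ : ∀ u v → u ⊟ v ≋ u ⊞ (- 1#) · v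
  ⊟-as-⊞ u v = pointwise λ i → solve 2 (λ u v → u :- v := u :+ (:- lit 1) :* v) refl (u i) (v i)

  B-line : ∀ u s v w → B (u ⊞ s · v) w ≈ B u w + s * B v w
  B-line u s v w = trans (B-⊞ˡ u (s · v) w) (+-congˡ (B-·ˡ s v w))

  μ-line : ∀ u s v → B (u ⊞ s · v) (u ⊞ s · v) ≈ B u u + (s * B u v + s * B u v) + s * s * B v v
  μ-line u s v = trans (B-line u s v (u ⊞ s · v))
    (trans (+-cong (trans (B-⊞ʳ u u (s · v)) (+-congˡ (B-·ʳ s u v)))
                   (*-congˡ (trans (B-⊞ʳ v u (s · v)) (+-cong (B-sym v u) (B-·ʳ s v v)))))
      (solve 4 (λ s x y z → x :+ s :* y :+ s :* (y :+ s :* z) := x :+ (s :* y :+ s :* y) :+ s :* s :* z)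
        refl s (B u u) (B u v) (B v v)))

  B-⊟ˡ : ∀ u v w → B (u ⊟ v) w ≈ B u w - B v w
  B-⊟ˡ u v w = trans (B-cong (⊟-as-⊞ u v) ≋-refl) (trans (B-line u (- 1#) v w)
    (solve 2 (λ x y → x :+ (:- lit 1) :* y := x :- y) refl (B u w) (B v w)))

  μ-⊟ : ∀ u v → B (u ⊟ v) (u ⊟ v) ≈ B u u - (B u v + B u v) + B v v
  μ-⊟ u v = trans (B-cong (⊟-as-⊞ u v) (⊟-as-⊞ u v)) (trans (μ-line u (- 1#) v)
    (solve 3 (λ x y z → x :+ ((:- lit 1) :* y :+ (:- lit 1) :* y) :+ (:- lit 1) :* (:- lit 1) :* z
                        := x :- (y :+ y) :+ z) refl (B u u) (B u v) (B v v)))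

  -- Polarisation: three mutually lightlike points have orthogonal differences, and by
  -- `null-proportional` they lie on one light line.
  null-⊟-orthogonal : ∀ {u v} → Null u → Null v → Null (u ⊟ v) → B u v ≈ 0#
  null-⊟-orthogonal {u} {v} nu nv n = double≈0 (trans
    (solve 3 (λ x y z → y :+ y := x :+ z :- (x :- (y :+ y) :+ z)) refl (B u u) (B u v) (B v v))
    (sum≈0 (sum≈0 nu nv) (neg≈0 (trans (sym (μ-⊟ u v)) n))))

  -- Coordinate vectors and light rays

  vec : Carrier → Carrier → Carrier → Carrier → V
  vec a b c d 0F = a
  vec a b c d 1F = b
  vec a b c d 2F = c
  vec a b c d 3F = d

  axis : Fin 3 → Carrier → V
  axis 0F a = vec a 0# 0# 0#
  axis 1F a = vec 0# a 0# 0#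
  axis 2F a = vec 0# 0# a 0#

  time : Carrier → V
  time a = vec 0# 0# 0# a

  ray⁺ ray⁻ : Fin 3 → Carrier → V
  ray⁺ i a = time a ⊞ axis i a
  ray⁻ i a = time a ⊟ axis i a

  space : Fin 3 → Fin 4
  space 0F = 0F
  space 1F = 1F
  space 2F = 2F

  opaque
    unfolding B

    B-time : ∀ u a → B u (time a) ≈ - (u 3F * a)
    B-time u a = solve 5 (λ x y z t a → let o = lit 0 in
      x :* o :+ y :* o :+ z :* o :- t :* a := :- (t :* a)) refl (u 0F) (u 1F) (u 2F) (u 3F) a

    B-axis : ∀ u i a → B u (axis i a) ≈ u (space i) * a
    B-axis u 0F a = solve 5 (λ x y z t a → let o = lit 0 in
      x :* a :+ y :* o :+ z :* o :- t :* o := x :* a) refl (u 0F) (u 1F) (u 2F) (u 3F) a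
    B-axis u 1F a = solve 5 (λ x y z t a → let o = lit 0 in
      x :* o :+ y :* a :+ z :* o :- t :* o := y :* a) refl (u 0F) (u 1F) (u 2F) (u 3F) a
    B-axis u 2F a = solve 5 (λ x y z t a → let o = lit 0 in
      x :* o :+ y :* o :+ z :* a :- t :* o := z :* a) refl (u 0F) (u 1F) (u 2F) (u 3F) a

  B-ray⁺ : ∀ u i a → B u (ray⁺ i a) ≈ (u (space i) - u 3F) * a
  B-ray⁺ u i a = trans (B-⊞ʳ u (time a) (axis i a)) (trans (+-cong (B-time u a) (B-axis u i a))
    (solve 3 (λ x t a → :- (t :* a) :+ x :* a := (x :- t) :* a) refl (u (space i)) (u 3F) a))

  B-ray⁻ : ∀ u i a → B u (ray⁻ i a) ≈ - ((u (space i) + u 3F) * a)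
  B-ray⁻ u i a = trans (B-sym u (ray⁻ i a)) (trans (B-⊟ˡ (time a) (axis i a) u)
    (trans (+-cong (trans (B-sym _ u) (B-time u a)) (-‿cong (trans (B-sym _ u) (B-axis u i a))))
    (solve 3 (λ x t a → :- (t :* a) :- x :* a := :- ((x :+ t) :* a)) refl (u (space i)) (u 3F) a)))

  null-ray⁺ : ∀ i a → Null (ray⁺ i a)
  null-ray⁺ i a = trans (B-ray⁺ (ray⁺ i a) i a) (vanish i)
    where
    identity : (0# + a - (a + 0#)) * a ≈ 0#
    identity = solve 1 (λ a → (lit 0 :+ a :- (a :+ lit 0)) :* a := lit 0) refl a

    vanish : ∀ i → (ray⁺ i a (space i) - ray⁺ i a 3F) * a ≈ 0#
    vanish 0F = identity
    vanish 1F = identity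
    vanish 2F = identity

  null-ray⁻ : ∀ i a → Null (ray⁻ i a)
  null-ray⁻ i a = trans (B-ray⁻ (ray⁻ i a) i a) (vanish i)
    where
    identity : - ((0# - a + (a - 0#)) * a) ≈ 0#
    identity = solve 1 (λ a → :- ((lit 0 :- a :+ (a :- lit 0)) :* a) := lit 0) refl a

    vanish : ∀ i → - ((ray⁻ i a (space i) + ray⁻ i a 3F) * a) ≈ 0#
    vanish 0F = identity
    vanish 1F = identity
    vanish 2F = identity

  components≈0 : ∀ {v} → (∀ i → v (space i) ≈ 0#) → v 3F ≈ 0# → v ≋ 𝟎
  components≈0 p q = pointwise λ where
    0F → p 0F
    1F → p 1F
    2F → p 2F
    3F → q

  -- A point is determined by its light cone. With z = x, d = y - x is null; with z = x + v,
  -- polarisation makes d orthogonal to every null v. The rays e₄ ± eᵢ then annihilate all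
  -- coordinates of d.
  cone-injective : ∀ {x y} → (∀ z → Null (x ⊟ z) → Null (y ⊟ z)) → x ≋ y
  cone-injective {x} {y} h = pointwise λ i → sym (-≈0⇒≈ (at d≋𝟎 i))
    where
    d = y ⊟ x

    μd : Null d
    μd = h x (trans (B-cong x⊟x x⊟x)
              (trans (B-expand 𝟎 𝟎)
                (solve 0 (lit 0 :* lit 0 :+ lit 0 :* lit 0 :+ lit 0 :* lit 0 :- lit 0 :* lit 0 := lit 0) refl)))
      where
      x⊟x : x ⊟ x ≋ 𝟎
      x⊟x = pointwise λ i → -‿inverseʳ (x i)

    ortho : ∀ {v} → Null v → B d v ≈ 0#
    ortho {v} nv = null-⊟-orthogonal μd nv (null-cong
      (pointwise λ i → solve 3 (λ x y v → y :- (x :+ v) := y :- x :- v) refl (x i) (y i) (v i))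
      (h (x ⊞ v) (null-cong
        (pointwise λ i → solve 2 (λ x v → (:- lit 1) :* v := x :- (x :+ v)) refl (x i) (v i))
        (null-scale (- 1#) nv))))

    plus : ∀ i → d (space i) - d 3F ≈ 0#
    plus i = trans (sym (*-identityʳ _)) (trans (sym (B-ray⁺ d i 1#)) (ortho (null-ray⁺ i 1#)))

    minus : ∀ i → - (d (space i) + d 3F) ≈ 0#
    minus i = trans (-‿cong (sym (*-identityʳ _))) (trans (sym (B-ray⁻ d i 1#)) (ortho (null-ray⁻ i 1#)))

    d≋𝟎 : d ≋ 𝟎
    d≋𝟎 = components≈0
      (λ i → double≈0 (trans (solve 2 (λ x t → x :+ x := x :- t :- (:- (x :+ t))) refl (d (space i)) (d 3F))
                             (sum≈0 (plus i) (neg≈0 (minus i)))))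
      (double≈0 (trans (solve 2 (λ x t → t :+ t := :- (x :- t) :- (:- (x :+ t))) refl (d 0F) (d 3F))
                       (sum≈0 (neg≈0 (plus 0F)) (neg≈0 (minus 0F)))))

  by-cases≋ : ∀ {P : Set} {u v} → (P → u ≋ v) → ((P → Absurd) → u ≋ v) → u ≋ v
  by-cases≋ f g = pointwise λ i → by-cases (λ p → at (f p) i) (λ ¬p → at (g ¬p) i)

  B-𝟎ˡ : ∀ {u} w → u ≋ 𝟎 → B u w ≈ 0#
  B-𝟎ˡ w p = trans (B-cong (≋-trans p (pointwise λ i → sym (zeroˡ (w i)))) ≋-refl)
                   (trans (B-·ˡ 0# w w) (zeroˡ _))

  axis-scale : ∀ i a → axis i a ≋ a · axis i 1#
  axis-scale 0F a = pointwise λ where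
    0F → sym (*-identityʳ a)
    1F → sym (zeroʳ a)
    2F → sym (zeroʳ a)
    3F → sym (zeroʳ a)
  axis-scale 1F a = pointwise λ where
    0F → sym (zeroʳ a)
    1F → sym (*-identityʳ a)
    2F → sym (zeroʳ a)
    3F → sym (zeroʳ a)
  axis-scale 2F a = pointwise λ where
    0F → sym (zeroʳ a)
    1F → sym (zeroʳ a)
    2F → sym (*-identityʳ a)
    3F → sym (zeroʳ a)

  time-scale : ∀ a → time a ≋ a · time 1#
  time-scale a = pointwise λ where
    0F → sym (zeroʳ a)
    1F → sym (zeroʳ a)
    2F → sym (zeroʳ a)
    3F → sym (*-identityʳ a)

  ray⁺-scale : ∀ i a → ray⁺ i a ≋ a · ray⁺ i 1#
  ray⁺-scale i a = ≋-trans (⊞-cong (time-scale a) (axis-scale i a))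
    (pointwise λ k → sym (distribˡ a (time 1# k) (axis i 1# k)))

  ray⁻-scale : ∀ i a → ray⁻ i a ≋ a · ray⁻ i 1#
  ray⁻-scale i a = ≋-trans (⊟-cong (time-scale a) (axis-scale i a))
    (pointwise λ k → solve 3 (λ a t x → a :* t :- a :* x := a :* (t :- x)) refl a (time 1# k) (axis i 1# k))

  -- Induction over the four coordinate summands; it carries properties closed under addition from
  -- the axes to all vectors.
  axes-generate : (P : V → Set) → (∀ {x y} → x ≋ y → P x → P y) → (∀ x y → P x → P y → P (x ⊞ y)) →
                  (∀ i a → P (axis i a)) → (∀ a → P (time a)) → ∀ x → P x
  axes-generate P resp sum p q x = resp
    (pointwise λ where
      0F → solve 1 (λ a → a :+ lit 0 :+ lit 0 :+ lit 0 := a) refl (x 0F)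
      1F → solve 1 (λ a → lit 0 :+ a :+ lit 0 :+ lit 0 := a) refl (x 1F)
      2F → solve 1 (λ a → lit 0 :+ lit 0 :+ a :+ lit 0 := a) refl (x 2F)
      3F → solve 1 (λ a → lit 0 :+ lit 0 :+ lit 0 :+ a := a) refl (x 3F))
    (sum _ _ (sum _ _ (sum _ _ (p 0F (x 0F)) (p 1F (x 1F))) (p 2F (x 2F))) (q (x 3F)))

  halving : ∀ a x → half * a * x + half * a * x ≈ a * x
  halving a x = trans
    (solve 3 (λ h a x → h :* a :* x :+ h :* a :* x := (lit 1 :+ lit 1) :* h :* (a :* x)) refl half a x)
    (trans (*-congʳ half-double) (*-identityˡ (a * x)))

  time-from-rays : ∀ i a → ray⁺ i (half * a) ⊞ ray⁻ i (half * a) ≋ time a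
  time-from-rays i a = ≋-trans
    (⊞-cong (ray⁺-scale i (half * a)) (ray⁻-scale i (half * a)))
    (≋-trans
      (pointwise λ k → trans
        (solve 3 (λ s t x → s :* (t :+ x) :+ s :* (t :- x) := s :* t :+ s :* t) refl
          (half * a) (time 1# k) (axis i 1# k))
        (halving a (time 1# k)))
      (≋-sym (time-scale a)))

  axis-from-rays : ∀ i a → ray⁺ i (half * a) ⊞ (- 1#) · ray⁻ i (half * a) ≋ axis i a
  axis-from-rays i a = ≋-trans
    (⊞-cong (ray⁺-scale i (half * a)) (·-cong refl (ray⁻-scale i (half * a))))
    (≋-trans
      (pointwise λ k → trans
        (solve 3 (λ s t x → s :* (t :+ x) :+ (:- lit 1) :* (s :* (t :- x)) := s :* x :+ s :* x) refl
          (half * a) (time 1# k) (axis i 1# k))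
        (halving a (axis i 1# k)))
      (≋-sym (axis-scale i a)))

  difference : ∀ a b → a - b + b ≈ a
  difference = solve 2 (λ a b → a :- b :+ b := a) refl

  -- The hypotheses have the shape of the formula `d ≐ s - t`, which expresses subtraction as d + t
  -- = s.
  μ-coordinates : ∀ {x y a b c d} →
                  a + y 0F ≈ x 0F → b + y 1F ≈ x 1F → c + y 2F ≈ x 2F → d + y 3F ≈ x 3F →
                  B (x ⊟ y) (x ⊟ y) ≈ a * a + b * b + c * c - d * d
  μ-coordinates p q r s = trans (B-expand _ _)
    (+-cong (+-cong (+-cong (square p) (square q)) (square r)) (-‿cong (square s)))
    where
    square : ∀ {a x y} → a + y ≈ x → (x - y) * (x - y) ≈ a * a
    square {a} {x} {y} e = *-cong d d
      where
      d : x - y ≈ a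
      d = trans (+-congʳ (sym e)) (solve 2 (λ a y → a :+ y :- y := a) refl a y)

-- Bijections preserving lightlike separation

module LightBijections (K : RealField) where
  open RealField K
  open IntegerCoefficients ring
  open Geometry K

  record LightBijection : Set where
    field
      to from   : V → V
      to-from   : ∀ y → to (from y) ≋ y
      from-to   : ∀ x → from (to x) ≋ x
      to-null   : ∀ x y → Null (x ⊟ y) → Null (to x ⊟ to y)
      from-null : ∀ x y → Null (x ⊟ y) → Null (from x ⊟ from y)

  flip : LightBijection → LightBijection
  flip f = record
    { to = from ; from = to ; to-from = from-to ; from-to = to-from
    ; to-null = from-null ; from-null = to-null }
    where open LightBijection f

  -- Light lines, null hyperplanes and parallelism

  module Lines (f : LightBijection) where
    open LightBijection f

    -- The image of the displacement `v` attached at `a`. Additivity amounts to independence of the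
    -- base point.
    step : V → V → V
    step a v = to (a ⊞ v) ⊟ to a

    to-null⁻ : ∀ x y → Null (to x ⊟ to y) → Null (x ⊟ y)
    to-null⁻ x y n = null-cong (⊟-cong (from-to x) (from-to y)) (from-null (to x) (to y) n)

    -- Equal points have the same light cone, cones are mapped to cones, and a cone determines its
    -- apex.
    to-cong : ∀ {x y} → x ≋ y → to x ≋ to y
    to-cong {x} {y} x≋y = cone-injective λ z n →
      null-cong (⊟-cong ≋-refl (to-from z))
        (to-null y (from z) (null-cong (⊟-cong x≋y ≋-refl)
          (to-null⁻ x (from z) (null-cong (⊟-cong ≋-refl (≋-sym (to-from z))) n))))

    step-cong : ∀ {a b u v} → a ≋ b → u ≋ v → step a u ≋ step b v
    step-cong p q = ⊟-cong (to-cong (⊞-cong p q)) (to-cong p)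

    step-null : ∀ a {v} → Null v → Null (step a v)
    step-null a {v} n = to-null (a ⊞ v) a (null-cong (≋-sym (⊞-⊟ a v)) n)

    step-⊞ : ∀ a v → to (a ⊞ v) ≋ to a ⊞ step a v
    step-⊞ a v = ≋-sym (⊟-⊞ (to a) (to (a ⊞ v)))

    -- The points a, a + v, a + sv are mutually lightlike, hence so are their images, which are
    -- therefore collinear.
    line-image : ∀ a v → Null v → Nonzero (step a v) →
                 ∀ s → ∃[ r ] step a (s · v) ≋ r · step a v
    line-image a v n nz s =
      null-proportional (step-null a (null-scale s n)) (step-null a n) nz
        (null-⊟-orthogonal (step-null a (null-scale s n)) (step-null a n)
          (null-cong (pointwise λ i → solve 3 (λ x y z → x :- y := x :- z :- (y :- z)) refl
                       (to (a ⊞ s · v) i) (to (a ⊞ v) i) (to a i))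
            (to-null (a ⊞ s · v) (a ⊞ v)
              (null-cong (pointwise λ i → solve 3 (λ s a v → (s :- lit 1) :* v := a :+ s :* v :- (a :+ v)) refl
                           s (a i) (v i))
                (null-scale (s - 1#) n)))))

  module Rays (f : LightBijection) where
    open LightBijection f
    open Lines f
    private module Inv = Lines (flip f)

    inverse-step : ∀ a v → Inv.step (to a) (step a v) ≋ v
    inverse-step a v = ≋-trans
      (⊟-cong (≋-trans (Inv.to-cong (≋-sym (step-⊞ a v))) (from-to (a ⊞ v))) (from-to a))
      (⊞-⊟ a v)

    step-nonzero : ∀ a {v} → Nonzero v → Nonzero (step a v)
    step-nonzero a {v} nz s≋𝟎 = nz (≋-trans (≋-sym (inverse-step a v))
      (≋-trans (Inv.step-cong {u = step a v} {v = 𝟎} ≋-refl s≋𝟎)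
        (≋-trans (⊟-cong (Inv.to-cong (pointwise λ i → +-identityʳ (to a i))) ≋-refl)
          (pointwise λ i → -‿inverseʳ (from (to a) i)))))

    -- `line-image` for the inverse transformation: the image of a light line fills the whole target
    -- line.
    line-preimage : ∀ a v → Null v → Nonzero v →
                    ∀ r → ∃[ s ] step a (s · v) ≋ r · step a v
    line-preimage a v n nz r =
      let nz′ = λ z → nz (≋-trans (≋-sym (inverse-step a v)) z)
          s , eq = Inv.line-image (to a) (step a v) (step-null a n) nz′ r
          eq′ : from (to a ⊞ r · step a v) ≋ a ⊞ s · v
          eq′ = ≋-trans (Inv.step-⊞ (to a) (r · step a v))
                  (⊞-cong (from-to a) (≋-trans eq (·-cong refl (inverse-step a v))))
      in s , ≋-trans (⊟-cong (≋-trans (≋-sym (to-cong eq′)) (to-from (to a ⊞ r · step a v))) ≋-refl)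
                     (⊞-⊟ (to a) (r · step a v))

    -- The null hyperplane a + v^⊥ consists of the light line a + Kv and the points
    -- with no light signal to that line, so it is mapped to a null hyperplane.
    hyperplane : ∀ a b v → Null v → Nonzero v →
                 B (b ⊟ a) v ≈ 0# → B (to b ⊟ to a) (step a v) ≈ 0#
    hyperplane a b v n nz ortho = by-cases id λ β≉0 →
      let D       = to b ⊟ to a
          v′      = step a v
          β       = B D v′
          n′      = step-null a n
          c , ββc = inverse (λ 2β≈0 → β≉0 (double≈0 2β≈0))
          -- As `v′` is null, the square of D - r v′ is B(D,D) - 2rβ, linear in r; this is its root,
          -- since c inverts 2β. So `to b` is lightlike to a point of the image line.
          r       = c * B D D
          s , eq  = line-preimage a v n nz r
          hit : Null (D ⊞ (- r) · v′)
          hit = trans (μ-line D (- r) v′) (trans (+-cong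
                  (trans (solve 3 (λ m c b → m :+ ((:- (c :* m)) :* b :+ (:- (c :* m)) :* b)
                                              := m :- (b :+ b) :* c :* m)
                           refl (B D D) c β)
                    (≈⇒-≈0 (sym (trans (*-congʳ ββc) (*-identityˡ _)))))
                  (scale≈0 _ n′)) (+-identityˡ 0#))
          p       = a ⊞ s · v
          near : Null (b ⊟ p)
          near = to-null⁻ b p (null-cong
            (pointwise λ i → trans
              (solve 4 (λ b a r v → b :- a :+ (:- r) :* v := b :- (a :+ r :* v)) refl
                (to b i) (to a i) r (v′ i))
              (+-congˡ (-‿cong (trans (+-congˡ (sym (at eq i))) (sym (at (step-⊞ a (s · v)) i)))))) hit)
          -- Pulled back, b - a - sv is null. Its square equals that of b - a, because v is null and
          -- orthogonal to b - a.
          on-cone : Null (b ⊟ a)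
          on-cone = trans (trans (solve 4 (λ m s x y →
                        m := m :+ ((:- s) :* x :+ (:- s) :* x) :+ (:- s) :* (:- s) :* y
                               :+ (s :+ s) :* x :- s :* s :* y) refl
                        (B (b ⊟ a) (b ⊟ a)) s (B (b ⊟ a) v) (B v v))
                      (+-congʳ (+-congʳ (sym (μ-line (b ⊟ a) (- s) v)))))
                    (sum≈0 (sum≈0 (null-cong (pointwise λ i →
                        solve 4 (λ b a s v → b :- (a :+ s :* v) := b :- a :+ (:- s) :* v) refl
                          (b i) (a i) s (v i)) near)
                      (scale≈0 _ ortho)) (neg≈0 (scale≈0 _ n)))
          -- Hence `b` itself lies on the line through `a`, so `D` is a multiple of the null vector
          -- `v′`.
          t , on-line = null-proportional on-cone n nz ortho
          r′ , eq′    = line-image a v n (step-nonzero a nz) t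
          D≋ : D ≋ r′ · v′
          D≋ = ≋-trans (⊟-cong (to-cong (≋-trans (≋-sym (⊟-⊞ a b)) (⊞-cong ≋-refl on-line))) ≋-refl) eq′
      in trans (B-cong D≋ ≋-refl) (trans (B-·ˡ r′ v′ v′) (scale≈0 r′ n′))

  module Parallels (f : LightBijection) where
    open LightBijection f
    open Lines f
    open Rays f
    private module Inv = Rays (flip f)

    hyperplane⁻ : ∀ a b v → Null v → Nonzero v →
                  B (to b ⊟ to a) (step a v) ≈ 0# → B (b ⊟ a) v ≈ 0#
    hyperplane⁻ a b v n nz ortho = trans
      (B-cong (≋-sym (⊟-cong (from-to b) (from-to a))) (≋-sym (inverse-step a v)))
      (Inv.hyperplane (to a) (to b) (step a v) (step-null a n) (step-nonzero a nz) ortho)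

    -- Nonparallel image lines would span intersecting null hyperplanes.
    steps-orthogonal : ∀ a b v → Null v → Nonzero v → B (step a v) (step b v) ≈ 0#
    steps-orthogonal a b v n nz = by-cases id λ β≉0 →
      let v′ = step a v
          d  = step b v
          β  = B v′ d
          γ  = B (to a ⊟ to b) d
          c , βc≈1 = inverse β≉0
          -- The root of γ + rβ, which places the image of `p` in the null hyperplane of the image
          -- line through `to b`.
          r  = - (c * γ)
          s , eq = line-preimage a v n nz r
          p  = a ⊞ s · v
          p∈ : B (p ⊟ b) v ≈ 0#
          p∈ = hyperplane⁻ b p v n nz (trans
            (B-cong (pointwise λ i → trans
                (+-congʳ (trans (at (step-⊞ a (s · v)) i) (+-congˡ (at eq i))))
                (solve 4 (λ x y r z → x :+ r :* z :- y := x :- y :+ r :* z) refl (to a i) (to b i) r (v′ i)))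
              ≋-refl)
            (trans (B-line (to a ⊟ to b) r v′ d)
              (trans (solve 3 (λ g c b → g :+ (:- (c :* g)) :* b := g :- b :* c :* g) refl γ c β)
                (≈⇒-≈0 (sym (trans (*-congʳ βc≈1) (*-identityˡ γ)))))))
          -- Since `v` is null, the pairing with `v` is constant along a + Kv. So with `p` also a
          -- and a + v lie in b + v^⊥, their images lie in the image hyperplane, and the difference
          -- of these images is `v′`.
          a∈ : B (a ⊟ b) v ≈ 0#
          a∈ = trans (solve 3 (λ x s y → x := x :+ s :* y :- s :* y) refl (B (a ⊟ b) v) s (B v v))
            (sum≈0 (trans (sym (B-line (a ⊟ b) s v v)) (trans (B-cong (pointwise λ i →
                solve 4 (λ a b s v → a :- b :+ s :* v := a :+ s :* v :- b) refl
                  (a i) (b i) s (v i)) ≋-refl) p∈))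
              (neg≈0 (scale≈0 s n)))
          a+v∈ : B ((a ⊞ v) ⊟ b) v ≈ 0#
          a+v∈ = trans (B-cong (pointwise λ i →
                solve 3 (λ a b v → a :+ v :- b := a :- b :+ v) refl (a i) (b i) (v i)) ≋-refl)
              (trans (B-⊞ˡ (a ⊟ b) v v) (sum≈0 a∈ n))
      in trans (B-cong (pointwise λ i →
             solve 3 (λ x y z → x :- y := x :- z :- (y :- z)) refl (to (a ⊞ v) i) (to a i) (to b i)) ≋-refl)
           (trans (B-⊟ˡ (to (a ⊞ v) ⊟ to b) (to a ⊟ to b) d)
             (sum≈0 (hyperplane b (a ⊞ v) v n nz a+v∈) (neg≈0 (hyperplane b a v n nz a∈))))

    parallel : ∀ a b v → Null v → Nonzero v → ∃[ r ] step b v ≋ r · step a v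
    parallel a b v n nz = null-proportional (step-null b n) (step-null a n) (step-nonzero a nz)
      (steps-orthogonal b a v n nz)

    -- Opposite sides have parallel images, so the diagonal gives P + rQ = Q + r′P. Pairing with the
    -- null vector `P` leaves (r - 1) B(Q,P) = 0, and B(Q,P) is nonzero because null hyperplanes are
    -- also reflected.
    parallelogram : ∀ a u v → Null u → Null v → (B u v ≈ 0# → Absurd) →
                    step (a ⊞ u) v ≋ step a v
    parallelogram a u v nu nv uv≉0 =
      let P = step a u
          Q = step a v
          r , e₁  = parallel a (a ⊞ u) v nv v≉𝟎
          r′ , e₂ = parallel a (a ⊞ v) u nu u≉𝟎
          QP≉0 : B Q P ≈ 0# → Absurd
          QP≉0 z = uv≉0 (trans (B-cong (≋-sym (⊞-⊟ a u)) ≋-refl)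
            (hyperplane⁻ a (a ⊞ u) v nv v≉𝟎 (trans (B-sym P Q) z)))
          sums : P ⊞ r · Q ≋ Q ⊞ r′ · P
          sums = ≋-trans (⊞-cong ≋-refl (≋-sym e₁)) (≋-trans
            (pointwise λ i → trans
              (solve 4 (λ x y z t → y :- x :+ (t :- y) := z :- x :+ (t :- z)) refl
                (to a i) (to (a ⊞ u) i) (to (a ⊞ v) i) (to (a ⊞ u ⊞ v) i))
              (+-congˡ (+-congʳ (at (to-cong (pointwise λ k →
                solve 3 (λ a u v → a :+ u :+ v := a :+ v :+ u) refl (a k) (u k) (v k))) i))))
            (⊞-cong ≋-refl e₂))
          r-1≈0 : r - 1# ≈ 0#
          r-1≈0 = cancel QP≉0 (trans
            (solve 4 (λ r s x y → x :* (r :- lit 1) := y :+ r :* x :- (x :+ s :* y) :+ s :* y :- y) refl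
              r r′ (B Q P) (B P P))
            (sum≈0 (sum≈0 (≈⇒-≈0 (trans (sym (B-line P r Q P)) (trans (B-cong sums ≋-refl) (B-line Q r′ P P))))
                          (scale≈0 r′ (step-null a nu)))
                   (neg≈0 (step-null a nu))))
      in ≋-trans e₁ (≋-trans (·-cong (-≈0⇒≈ r-1≈0) ≋-refl) (pointwise λ i → *-identityˡ (Q i)))
      where
      u≉𝟎 : Nonzero u
      u≉𝟎 z = uv≉0 (B-𝟎ˡ v z)
      v≉𝟎 : Nonzero v
      v≉𝟎 z = uv≉0 (trans (B-sym u v) (B-𝟎ˡ u z))

  -- Additivity of the transformation

  module Additivity (f : LightBijection) where
    open LightBijection f
    open Lines f
    open Parallels f

    -- The translations `x` that leave the image of the displacement `v` unchanged. They are closed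
    -- under addition, and the parallelogram lemma supplies the null ones not orthogonal to `v`.
    Unmoved : V → V → Set
    Unmoved v x = ∀ a → step (a ⊞ x) v ≋ step a v

    module _ {v : V} where

      unmoved-resp : ∀ {x y} → x ≋ y → Unmoved v x → Unmoved v y
      unmoved-resp p h a = ≋-trans (step-cong (⊞-cong ≋-refl (≋-sym p)) ≋-refl) (h a)

      unmoved-⊞ : ∀ x y → Unmoved v x → Unmoved v y → Unmoved v (x ⊞ y)
      unmoved-⊞ x y p q a = ≋-trans
        (step-cong (pointwise λ i → sym (+-assoc (a i) (x i) (y i))) ≋-refl) (≋-trans (q (a ⊞ x)) (p a))

      unmoved-𝟎 : ∀ {x} → x ≋ 𝟎 → Unmoved v x
      unmoved-𝟎 p a = step-cong (pointwise λ i → trans (+-congˡ (at p i)) (+-identityʳ (a i))) ≋-refl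

      module _ (nv : Null v) (nz : Nonzero v) where

        unmoved-scale : ∀ {u} → Null u → (B v u ≉ 0#) → ∀ s → Unmoved v (s · u)
        unmoved-scale {u} nu vu≉0 s a = by-cases≋
          (λ s≈0 → unmoved-𝟎 (pointwise λ i → trans (*-congʳ s≈0) (zeroˡ (u i))) a)
          (λ s≉0 → parallelogram a (s · u) v (null-scale s nu) nv λ z →
            vu≉0 (trans (B-sym v u) (cancel s≉0 (trans (sym (B-·ˡ s u v)) z))))

        unmoved-ray⁺ : ∀ i → v (space i) - v 3F ≉ 0# → ∀ a → Unmoved v (ray⁺ i a)
        unmoved-ray⁺ i h a = unmoved-resp (≋-sym (ray⁺-scale i a)) (unmoved-scale (null-ray⁺ i 1#)
          (λ z → h (trans (sym (*-identityʳ _)) (trans (sym (B-ray⁺ v i 1#)) z))) a)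

        unmoved-ray⁻ : ∀ i → v (space i) + v 3F ≉ 0# → ∀ a → Unmoved v (ray⁻ i a)
        unmoved-ray⁻ i h a = unmoved-resp (≋-sym (ray⁻-scale i a)) (unmoved-scale (null-ray⁻ i 1#)
          (λ z → h (trans (solve 1 (λ x → x := :- (:- (x :* lit 1))) refl _)
            (neg≈0 (trans (sym (B-ray⁻ v i 1#)) z)))) a)

        unmoved-time′ : ∀ i → v (space i) - v 3F ≉ 0# → v (space i) + v 3F ≉ 0# → ∀ a → Unmoved v (time a)
        unmoved-time′ i h₁ h₂ a = unmoved-resp
          (time-from-rays i a)
          (unmoved-⊞ (ray⁺ i (half * a)) (ray⁻ i (half * a)) (unmoved-ray⁺ i h₁ _) (unmoved-ray⁻ i h₂ _))

        -- v is lightlike, so at most one of its space components is ± its time component.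
        unmoved-time : ∀ a → Unmoved v (time a)
        unmoved-time a b = by-cases≋ {P = (v 0F - v 3F) * (v 0F + v 3F) ≈ 0#}
          -- If the product vanishes, nullity leaves the squares of `v 1F` and `v 2F` with sum 0. So
          -- `v 1F` is 0, differs from ± `v 3F`, and direction `1F` serves.
          (λ z → let v₁≈0 : v 1F ≈ 0#
                     v₁≈0 = real (trans (solve 4 (λ x y z t →
                         y :* y :+ z :* z :+ lit 0 :* lit 0
                         := x :* x :+ y :* y :+ z :* z :- t :* t :- (x :- t) :* (x :+ t)) refl
                         (v 0F) (v 1F) (v 2F) (v 3F))
                       (sum≈0 (trans (sym (B-expand v v)) nv) (neg≈0 z)))
                 in unmoved-time′ 1F
                      (λ h → time≉0 nv nz (trans (solve 2 (λ y t → t := y :- (y :- t)) refl (v 1F) (v 3F))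
                                                 (sum≈0 v₁≈0 (neg≈0 h))))
                      (λ h → time≉0 nv nz (trans (solve 2 (λ y t → t := y :+ t :- y) refl (v 1F) (v 3F))
                                                 (sum≈0 h (neg≈0 v₁≈0)))) a b)
          (λ h → unmoved-time′ 0F (λ z → h (trans (*-congʳ z) (zeroˡ _))) (λ z → h (scale≈0 _ z)) a b)

        -- `v (space i)` cannot equal both `v 3F` and its negative, as `v 3F` is nonzero. So one of
        -- the two rays is available, and the axis vector is a difference of it and the time vector.
        unmoved-axis : ∀ i a → Unmoved v (axis i a)
        unmoved-axis i a b = by-cases≋ {P = v (space i) - v 3F ≈ 0#}
          (λ z → unmoved-resp
            (pointwise λ k → solve 2 (λ t x → t :- (t :- x) := x) refl (time a k) (axis i a k))
            (unmoved-⊟ (unmoved-time a) (unmoved-ray⁻ i (λ z′ → time≉0 nv nz (double≈0 (trans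
               (solve 2 (λ x t → t :+ t := x :+ t :- (x :- t)) refl (v (space i)) (v 3F))
               (sum≈0 z′ (neg≈0 z))))) a)) b)
          (λ h → unmoved-resp
            (pointwise λ k → solve 2 (λ t x → t :+ x :- t := x) refl (time a k) (axis i a k))
            (unmoved-⊟ (unmoved-ray⁺ i h a) (unmoved-time a)) b)
          where
          unmoved-⊟ : ∀ {x y} → Unmoved v x → Unmoved v y → Unmoved v (x ⊟ y)
          unmoved-⊟ {x} {y} p q a = ≋-trans (≋-sym (q (a ⊞ (x ⊟ y)))) (≋-trans
            (step-cong (pointwise λ i →
              solve 3 (λ a x y → a :+ (x :- y) :+ y := a :+ x) refl (a i) (x i) (y i)) ≋-refl)
            (p a))

    unmoved : ∀ {v} → Null v → ∀ x → Unmoved v x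
    unmoved {v} nv x a = by-cases≋
      (λ z → ≋-trans (step-𝟎 (a ⊞ x) z) (≋-sym (step-𝟎 a z)))
      (λ nz → axes-generate (Unmoved v) unmoved-resp unmoved-⊞ (unmoved-axis nv nz) (unmoved-time nv nz) x a)
      where
      step-𝟎 : ∀ a → v ≋ 𝟎 → step a v ≋ 𝟎
      step-𝟎 a z = ≋-trans
        (⊟-cong (to-cong (pointwise λ i → trans (+-congˡ (at z i)) (+-identityʳ (a i)))) ≋-refl)
        (pointwise λ i → -‿inverseʳ (to a i))

    T : V → V
    T = step 𝟎

    T-cong : ∀ {x y} → x ≋ y → T x ≋ T y
    T-cong = step-cong ≋-refl

    to≋T : ∀ x → to x ≋ to 𝟎 ⊞ T x
    to≋T x = ≋-trans (to-cong (pointwise λ i → sym (+-identityˡ (x i)))) (step-⊞ 𝟎 x)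

    T-⊞-null : ∀ x v → Null v → T (x ⊞ v) ≋ T x ⊞ T v
    T-⊞-null x v nv = pointwise λ i → trans
      (+-congʳ (at (to-cong (pointwise λ k → sym (+-assoc 0# (x k) (v k)))) i))
      (trans (solve 3 (λ p q r → r :- p := q :- p :+ (r :- q)) refl (to 𝟎 i) (to (𝟎 ⊞ x) i) (to (𝟎 ⊞ x ⊞ v) i))
        (+-congˡ (at (unmoved nv x 𝟎) i)))

    Additive : V → Set
    Additive y = ∀ x → T (x ⊞ y) ≋ T x ⊞ T y

    additive-⊞ : ∀ y z → Additive y → Additive z → Additive (y ⊞ z)
    additive-⊞ y z p q x = ≋-trans (T-cong (pointwise λ i → sym (+-assoc (x i) (y i) (z i))))
      (≋-trans (q (x ⊞ y)) (≋-trans (⊞-cong (p x) ≋-refl)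
        (≋-trans (pointwise λ i → +-assoc (T x i) (T y i) (T z i)) (⊞-cong ≋-refl (≋-sym (q y))))))

    additive-resp : ∀ {x y} → x ≋ y → Additive x → Additive y
    additive-resp p h x = ≋-trans (T-cong (⊞-cong ≋-refl (≋-sym p))) (≋-trans (h x) (⊞-cong ≋-refl (T-cong p)))

    -- Independence of the base point gives additivity in null arguments, and halved rays sum to
    -- every axis and time vector.
    additive : ∀ y → Additive y
    additive = axes-generate Additive additive-resp additive-⊞
      (λ i a → additive-resp (axis-from-rays i a) (additive-⊞ _ _
        (λ x → T-⊞-null x _ (null-ray⁺ i (half * a)))
        (λ x → T-⊞-null x _ (null-scale (- 1#) (null-ray⁻ i (half * a))))))
      (λ a → additive-resp (time-from-rays 0F a) (additive-⊞ _ _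
        (λ x → T-⊞-null x _ (null-ray⁺ 0F (half * a)))
        (λ x → T-⊞-null x _ (null-ray⁻ 0F (half * a)))))

    T-𝟎 : T 𝟎 ≋ 𝟎
    T-𝟎 = pointwise λ i → trans
      (+-congʳ (at (to-cong {𝟎 ⊞ 𝟎} {𝟎} (pointwise λ _ → +-identityˡ 0#)) i)) (-‿inverseʳ _)

    T-⊟ : ∀ x y → T (x ⊟ y) ≋ T x ⊟ T y
    T-⊟ x y = pointwise λ i → trans
      (solve 2 (λ a b → a := a :+ b :- b) refl (T (x ⊟ y) i) (T y i))
      (+-congʳ (at (≋-trans (≋-sym (additive y (x ⊟ y)))
        (T-cong (pointwise λ k → solve 2 (λ x y → x :- y :+ y := x) refl (x k) (y k)))) i))

    -- Additivity yields homogeneity for natural multiples only, which is what the Pythagorean test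
    -- vector needs.
    T-ι : ∀ n x → T (ι n · x) ≋ ι n · T x
    T-ι ℕ.zero    x = ≋-trans (T-cong (pointwise λ i → zeroˡ (x i)))
                        (≋-trans T-𝟎 (pointwise λ i → sym (zeroˡ (T x i))))
    T-ι (ℕ.suc n) x = ≋-trans (T-cong (split x)) (≋-trans (additive (ι n · x) x)
                        (≋-trans (⊞-cong ≋-refl (T-ι n x)) (≋-sym (split (T x)))))
      where
      split : ∀ y → ι (ℕ.suc n) · y ≋ y ⊞ ι n · y
      split y = pointwise λ i → trans (*-congʳ (ι-+ 1 n))
        (trans (distribʳ (y i) 1# (ι n)) (+-congʳ (*-identityˡ (y i))))

    to-⊟ : ∀ x y → to x ⊟ to y ≋ T (x ⊟ y)
    to-⊟ x y = ≋-trans (⊟-cong (to≋T x) (to≋T y)) (≋-trans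
      (pointwise λ i → solve 3 (λ o a b → o :+ a :- (o :+ b) := a :- b) refl (to 𝟎 i) (T x i) (T y i))
      (≋-sym (T-⊟ x y)))

-- Semilinearity and isometry

module Isometry (K : RealField) where
  open RealField K
  open IntegerCoefficients ring
  open Geometry K
  open LightBijections K

  B-axis-axis : ∀ {i j} → i ≢ j → ∀ a b → B (axis i a) (axis j b) ≈ 0#
  B-axis-axis {i} {j} i≢j a b = trans (B-axis (axis i a) j b) (trans (*-congʳ (off i j i≢j)) (zeroˡ b))
    where
    off : ∀ i j → i ≢ j → axis i a (space j) ≈ 0#
    off 0F 0F p = ⊥-elim (p ≡.refl)
    off 0F 1F p = refl
    off 0F 2F p = refl
    off 1F 0F p = refl
    off 1F 1F p = ⊥-elim (p ≡.refl)
    off 1F 2F p = refl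
    off 2F 0F p = refl
    off 2F 1F p = refl
    off 2F 2F p = ⊥-elim (p ≡.refl)

  B-axis-time : ∀ i a b → B (axis i a) (time b) ≈ 0#
  B-axis-time i a b = trans (B-time (axis i a) b) (neg≈0 (trans (*-congʳ (off i)) (zeroˡ b)))
    where
    off : ∀ i → axis i a 3F ≈ 0#
    off 0F = refl
    off 1F = refl
    off 2F = refl

  μ-axis : ∀ i a → B (axis i a) (axis i a) ≈ a * a
  μ-axis 0F a = B-axis (axis 0F a) 0F a
  μ-axis 1F a = B-axis (axis 1F a) 1F a
  μ-axis 2F a = B-axis (axis 2F a) 2F a

  μ-time : ∀ a → B (time a) (time a) ≈ - (a * a)
  μ-time a = B-time (time a) a

  other : Fin 3 → Fin 3
  other 0F = 1F
  other 1F = 0F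
  other 2F = 0F

  other≢ : ∀ i → other i ≢ i
  other≢ 0F ()
  other≢ 1F ()
  other≢ 2F ()

  -- The Pythagorean triple 3² + 4² = 5² tests orthogonality of u and v.
  μ-345 : ∀ {u v w} → B u w ≈ 0# → B v w ≈ 0# → B u u + B w w ≈ 0# → B v v + B w w ≈ 0# →
          B (ι 3 · u ⊞ ι 4 · v ⊞ ι 5 · w) (ι 3 · u ⊞ ι 4 · v ⊞ ι 5 · w) ≈ ι 24 * B u v
  μ-345 {u} {v} {w} uw vw uu vv = trans (μ-line (ι 3 · u ⊞ ι 4 · v) (ι 5) w)
    (trans (+-cong (+-cong
        (trans (μ-line (ι 3 · u) (ι 4) v) (+-congʳ (+-cong
          (trans (B-·ˡ (ι 3) u (ι 3 · u)) (*-congˡ (B-·ʳ (ι 3) u u)))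
          (+-cong (*-congˡ (B-·ˡ (ι 3) u v)) (*-congˡ (B-·ˡ (ι 3) u v))))))
        (+-cong (scale≈0 (ι 5) ortho) (scale≈0 (ι 5) ortho))) refl)
      (trans (solve 4 (λ p q m r → lit 3 :* (lit 3 :* p) :+ (lit 4 :* (lit 3 :* m) :+ lit 4 :* (lit 3 :* m))
                  :+ lit 4 :* lit 4 :* q :+ (lit 0 :+ lit 0) :+ lit 5 :* lit 5 :* r
                := lit 9 :* (p :+ r) :+ lit 16 :* (q :+ r) :+ lit 24 :* m) refl (B u u) (B v v) (B u v) (B w w))
        (trans (+-congʳ (sum≈0 (scale≈0 _ uu) (scale≈0 _ vv))) (+-identityˡ _))))
    where
    ortho : B (ι 3 · u ⊞ ι 4 · v) w ≈ 0#
    ortho = trans (B-line (ι 3 · u) (ι 4) v w)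
      (sum≈0 (trans (B-·ˡ (ι 3) u w) (scale≈0 _ uw)) (scale≈0 _ vw))

  -- 24 = 2·3·4 is the coefficient of the cross term of 3u + 4v; it is cancelled as 2·2·2·3.
  24≈0 : ∀ {x} → ι 24 * x ≈ 0# → x ≈ 0#
  24≈0 {x} p = triple≈0 (double≈0 (double≈0 (double≈0 (trans
    (solve 1 (λ x → let y = x :+ x :+ x ; z = y :+ y ; t = z :+ z in t :+ t := lit 24 :* x) refl x) p))))

  comb : (Fin 3 → V) → V → V → V
  comb E G c = c 0F · E 0F ⊞ c 1F · E 1F ⊞ c 2F · E 2F ⊞ c 3F · G

  B-comb : ∀ E G c w → B (comb E G c) w ≈
           c 0F * B (E 0F) w + c 1F * B (E 1F) w + c 2F * B (E 2F) w + c 3F * B G w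
  B-comb E G c w = trans (B-line _ (c 3F) G w) (+-congʳ (trans (B-line _ (c 2F) (E 2F) w)
    (+-congʳ (trans (B-line _ (c 1F) (E 1F) w) (+-congʳ (B-·ˡ (c 0F) (E 0F) w))))))

  module Semilinear (f : LightBijection) where
    open LightBijection f
    open Lines f
    open Rays f
    open Additivity f

    T-null : ∀ {x} → Null x → Null (T x)
    T-null = step-null 𝟎

    T-null⁻ : ∀ {x} → Null (T x) → Null x
    T-null⁻ {x} n = null-cong (⊞-⊟ 𝟎 x) (to-null⁻ (𝟎 ⊞ x) 𝟎 n)

    module Gram (a : Carrier) where

      G : V
      G = T (time a)

      E : Fin 3 → V
      E i = T (axis i a)

      ray⁺-null : ∀ i → B G G + (1# * B G (E i) + 1# * B G (E i)) + 1# * 1# * B (E i) (E i) ≈ 0#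
      ray⁺-null i = trans (sym (μ-line G 1# (E i))) (null-cong
        (≋-trans (additive (axis i a) (time a)) (⊞-cong ≋-refl (pointwise λ k → sym (*-identityˡ (E i k)))))
        (T-null (null-ray⁺ i a)))

      ray⁻-null : ∀ i → B G G - (B G (E i) + B G (E i)) + B (E i) (E i) ≈ 0#
      ray⁻-null i = trans (sym (μ-⊟ G (E i))) (null-cong (T-⊟ (time a) (axis i a)) (T-null (null-ray⁻ i a)))

      -- Adding the null conditions of the images of both rays cancels the mixed terms; subtracting
      -- them, as in `B-E-G`, leaves only those.
      μ-E : ∀ i → B (E i) (E i) + B G G ≈ 0#
      μ-E i = double≈0 (trans
        (solve 3 (λ g m e → e :+ g :+ (e :+ g)
            := g :+ (lit 1 :* m :+ lit 1 :* m) :+ lit 1 :* lit 1 :* e :+ (g :- (m :+ m) :+ e)) refl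
          (B G G) (B G (E i)) (B (E i) (E i)))
        (sum≈0 (ray⁺-null i) (ray⁻-null i)))

      B-E-G : ∀ i → B (E i) G ≈ 0#
      B-E-G i = trans (B-sym (E i) G) (double≈0 (double≈0 (trans
        (solve 3 (λ g m e → m :+ m :+ (m :+ m)
            := g :+ (lit 1 :* m :+ lit 1 :* m) :+ lit 1 :* lit 1 :* e :- (g :- (m :+ m) :+ e)) refl
          (B G G) (B G (E i)) (B (E i) (E i)))
        (sum≈0 (ray⁺-null i) (neg≈0 (ray⁻-null i))))))

      -- 3eᵢ + 4eⱼ + 5e₄, scaled by `a`, is null. So is its image, whose square is 24 B(Eᵢ,Eⱼ).
      B-E-E : ∀ {i j} → i ≢ j → B (E i) (E j) ≈ 0#
      B-E-E {i} {j} i≢j = 24≈0 (trans (sym (μ-345 (B-E-G i) (B-E-G j) (μ-E i) (μ-E j)))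
        (null-cong
          (≋-trans (additive (ι 5 · time a) _) (⊞-cong
            (≋-trans (additive (ι 4 · axis j a) _) (⊞-cong (T-ι 3 (axis i a)) (T-ι 4 (axis j a))))
            (T-ι 5 (time a))))
          (T-null (trans (μ-345 (B-axis-time i a a) (B-axis-time j a a) (μ i) (μ j))
            (scale≈0 _ (B-axis-axis i≢j a a))))))
        where
        μ : ∀ i → B (axis i a) (axis i a) + B (time a) (time a) ≈ 0#
        μ i = trans (+-cong (μ-axis i a) (μ-time a)) (-‿inverseʳ (a * a))

    open Gram 1# public using (E; G; B-E-G; B-E-E)

    κ : Carrier
    κ = - B G G

    μ-G : B G G ≈ - κ
    μ-G = solve 1 (λ x → x := :- (:- x)) refl (B G G)

    μ-E : ∀ i → B (E i) (E i) ≈ κ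
    μ-E i = -≈0⇒≈ (trans (solve 2 (λ x y → x :- (:- y) := x :+ y) refl (B (E i) (E i)) (B G G)) (Gram.μ-E 1# i))

    -- Otherwise T e₄ would be null, and since T reflects nullity, so would be e₄, whose square is
    -- -1.
    κ≉0 : κ ≉ 0#
    κ≉0 z = 1≉0 (trans (solve 0 (lit 1 := :- (:- (lit 1 :* lit 1))) refl)
      (neg≈0 (trans (sym (μ-time 1#)) (T-null⁻ (trans μ-G (neg≈0 z))))))

    κ⁻¹ : Carrier
    κ⁻¹ = proj₁ (inverse κ≉0)

    κκ⁻¹ : κ * κ⁻¹ ≈ 1#
    κκ⁻¹ = proj₂ (inverse κ≉0)

    -- The coefficient of T(a e₄) along `G`, read off by pairing with `G`, whose square is -κ. This
    -- formula makes sense before proportionality is known.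
    θ : Carrier → Carrier
    θ a = κ⁻¹ * - B (T (time a)) G

    ray-nonzero : ∀ {v} → v 3F ≈ 1# → Nonzero v
    ray-nonzero p z = 1≉0 (trans (sym p) (at z 3F))

    ray⁺-nonzero : ∀ i → Nonzero (ray⁺ i 1#)
    ray⁺-nonzero 0F = ray-nonzero (+-identityʳ 1#)
    ray⁺-nonzero 1F = ray-nonzero (+-identityʳ 1#)
    ray⁺-nonzero 2F = ray-nonzero (+-identityʳ 1#)

    ray⁻-nonzero : ∀ i → Nonzero (ray⁻ i 1#)
    ray⁻-nonzero 0F = ray-nonzero (solve 0 (lit 1 :- lit 0 := lit 1) refl)
    ray⁻-nonzero 1F = ray-nonzero (solve 0 (lit 1 :- lit 0 := lit 1) refl)
    ray⁻-nonzero 2F = ray-nonzero (solve 0 (lit 1 :- lit 0 := lit 1) refl)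

    module _ (a : Carrier) where

      private
        module A = Gram a

      ray⁺-image : ∀ i → ∃[ r ] A.G ⊞ A.E i ≋ r · (G ⊞ E i)
      ray⁺-image i =
        let r , eq = line-image 𝟎 (ray⁺ i 1#) (null-ray⁺ i 1#) (step-nonzero 𝟎 (ray⁺-nonzero i)) a in
        r , ≋-trans (≋-sym (additive (axis i a) (time a))) (≋-trans (T-cong (ray⁺-scale i a))
              (≋-trans eq (·-cong refl (additive (axis i 1#) (time 1#)))))

      ray⁻-image : ∀ i → ∃[ r ] A.G ⊟ A.E i ≋ r · (G ⊟ E i)
      ray⁻-image i =
        let r , eq = line-image 𝟎 (ray⁻ i 1#) (null-ray⁻ i 1#) (step-nonzero 𝟎 (ray⁻-nonzero i)) a in
        r , ≋-trans (≋-sym (T-⊟ (time a) (axis i a))) (≋-trans (T-cong (ray⁻-scale i a))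
              (≋-trans eq (·-cong refl (T-⊟ (time 1#) (axis i 1#)))))

      p q : Fin 3 → Carrier
      p i = proj₁ (ray⁺-image i)
      q i = proj₁ (ray⁻-image i)

      -- The sum of the images of the two rays in direction `i`. Their multipliers `p i` and `q i`
      -- are not yet known to agree.
      2G : ∀ i → A.G ⊞ A.G ≋ (p i + q i) · G ⊞ (p i - q i) · E i
      2G i = pointwise λ k → trans
        (solve 2 (λ g e → g :+ g := g :+ e :+ (g :- e)) refl (A.G k) (A.E i k))
        (trans (+-cong (at (proj₂ (ray⁺-image i)) k) (at (proj₂ (ray⁻-image i)) k))
          (solve 4 (λ p q g e → p :* (g :+ e) :+ q :* (g :- e) := (p :+ q) :* g :+ (p :- q) :* e) refl
            (p i) (q i) (G k) (E i k)))

      B-2G : ∀ i w → B (A.G ⊞ A.G) w ≈ (p i + q i) * B G w + (p i - q i) * B (E i) w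
      B-2G i w = trans (B-cong (2G i) ≋-refl)
        (trans (B-line _ (p i - q i) (E i) w) (+-congʳ (B-·ˡ (p i + q i) G w)))

      B-G-E : ∀ i → B G (E i) ≈ 0#
      B-G-E i = trans (B-sym G (E i)) (B-E-G i)

      -- Compare the two expressions of 2 T(a e₄) obtained from the light rays in the
      -- directions i and other i.
      p≈q : ∀ i → p i - q i ≈ 0#
      p≈q i = cancel κ≉0 (trans
        (trans (*-comm κ _) (sym (trans
          (+-cong (scale≈0 (p i + q i) (B-G-E i)) (*-congˡ (μ-E i))) (+-identityˡ _))))
        (trans (sym (B-2G i (E i))) (trans (B-2G (other i) (E i))
          (sum≈0 (scale≈0 _ (B-G-E i)) (scale≈0 _ (B-E-E (other≢ i)))))))

      G-image′ : ∀ i → A.G ≋ p i · G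
      G-image′ i = pointwise λ k → -≈0⇒≈ (double≈0 (trans
        (solve 5 (λ x p q g e → x :- p :* g :+ (x :- p :* g)
            := x :+ x :- ((p :+ q) :* g :+ (p :- q) :* e) :+ (p :- q) :* (e :- g)) refl
          (A.G k) (p i) (q i) (G k) (E i k))
        (sum≈0 (≈⇒-≈0 (at (2G i) k)) (trans (*-comm _ _) (scale≈0 _ (p≈q i))))))

      θ≈p : ∀ i → θ a ≈ p i
      θ≈p i = trans
        (*-congˡ (-‿cong (trans (B-cong (G-image′ i) ≋-refl) (trans (B-·ˡ (p i) G G) (*-congˡ μ-G)))))
        (trans (solve 3 (λ c p k → c :* (:- (p :* (:- k))) := k :* c :* p) refl κ⁻¹ (p i) κ)
          (trans (*-congʳ κκ⁻¹) (*-identityˡ (p i))))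

      G-image : T (time a) ≋ θ a · G
      G-image = ≋-trans (G-image′ 0F) (·-cong (sym (θ≈p 0F)) ≋-refl)

      E-image : ∀ i → T (axis i a) ≋ θ a · E i
      E-image i = pointwise λ k → trans
        (solve 2 (λ g e → e := g :+ e :- g) refl (A.G k) (A.E i k))
        (trans (+-cong (trans (at (proj₂ (ray⁺-image i)) k) (*-congʳ (sym (θ≈p i)))) (-‿cong (at G-image k)))
          (solve 3 (λ t g e → t :* (g :+ e) :- t :* g := t :* e) refl (θ a) (G k) (E i k)))

    θᵛ : V → V
    θᵛ x k = θ (x k)

    T-comb : ∀ x → T x ≋ comb E G (θᵛ x)
    T-comb x = ≋-trans (T-cong (pointwise λ where
        0F → solve 1 (λ a → a := a :+ lit 0 :+ lit 0 :+ lit 0) refl (x 0F)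
        1F → solve 1 (λ a → a := lit 0 :+ a :+ lit 0 :+ lit 0) refl (x 1F)
        2F → solve 1 (λ a → a := lit 0 :+ lit 0 :+ a :+ lit 0) refl (x 2F)
        3F → solve 1 (λ a → a := lit 0 :+ lit 0 :+ lit 0 :+ a) refl (x 3F)))
      (≋-trans (additive (time (x 3F)) (axis 0F (x 0F) ⊞ axis 1F (x 1F) ⊞ axis 2F (x 2F)))
        (⊞-cong (≋-trans (additive (axis 2F (x 2F)) (axis 0F (x 0F) ⊞ axis 1F (x 1F)))
          (⊞-cong (≋-trans (additive (axis 1F (x 1F)) (axis 0F (x 0F)))
            (⊞-cong (E-image (x 0F) 0F) (E-image (x 1F) 1F))) (E-image (x 2F) 2F))) (G-image (x 3F))))

    μ-T : ∀ x → B (T x) (T x) ≈ κ * B (θᵛ x) (θᵛ x)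
    μ-T x = trans (B-cong (T-comb x) (T-comb x)) (trans (B-comb E G c (comb E G c))
      (trans (+-cong (+-cong (+-cong (*-congˡ (row 0F)) (*-congˡ (row 1F))) (*-congˡ (row 2F))) (*-congˡ rowG))
        (trans (solve 5 (λ k a b c d → a :* (a :* k) :+ b :* (b :* k) :+ c :* (c :* k) :+ d :* (d :* (:- k))
             := k :* (a :* a :+ b :* b :+ c :* c :- d :* d)) refl κ (c 0F) (c 1F) (c 2F) (c 3F))
          (*-congˡ (sym (B-expand c c))))))
      where
      c = θᵛ x

      rowG : B G (comb E G c) ≈ c 3F * - κ
      rowG = trans (B-sym G _) (trans (B-comb E G c G) (trans
        (+-congʳ (sum≈0 (sum≈0 (scale≈0 _ (B-E-G 0F)) (scale≈0 _ (B-E-G 1F))) (scale≈0 _ (B-E-G 2F))))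
        (trans (+-identityˡ _) (*-congˡ μ-G))))

      row : ∀ i → B (E i) (comb E G c) ≈ c (space i) * κ
      row i = trans (B-sym (E i) _) (trans (B-comb E G c (E i)) (trans
        (+-congˡ (scale≈0 _ (trans (B-sym G (E i)) (B-E-G i)))) (trans (+-identityʳ _) (pick i))))
        where
        cross : ∀ j i → j ≢ i → c (space j) * B (E j) (E i) ≈ 0#
        cross j i j≢i = scale≈0 _ (B-E-E j≢i)

        pick : ∀ i → c 0F * B (E 0F) (E i) + c 1F * B (E 1F) (E i) + c 2F * B (E 2F) (E i) ≈ c (space i) * κ
        pick 0F = trans (+-cong (+-cong (*-congˡ (μ-E 0F)) (cross 1F 0F λ ())) (cross 2F 0F λ ()))
          (trans (+-identityʳ _) (+-identityʳ _))
        pick 1F = trans (+-cong (+-cong (cross 0F 1F λ ()) (*-congˡ (μ-E 1F))) (cross 2F 1F λ ()))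
          (trans (+-identityʳ _) (+-identityˡ _))
        pick 2F = trans (+-cong (sum≈0 (cross 0F 2F λ ()) (cross 1F 2F λ ())) (*-congˡ (μ-E 2F)))
          (+-identityˡ _)

    θ-cong : ∀ {a b} → a ≈ b → θ a ≈ θ b
    θ-cong {a} {b} p = *-congˡ (-‿cong (B-cong (T-cong (pointwise λ where
      0F → refl
      1F → refl
      2F → refl
      3F → p)) ≋-refl))

    θ-+ : ∀ a b → θ (a + b) ≈ θ a + θ b
    θ-+ a b = trans (*-congˡ (-‿cong (trans
        (B-cong (≋-trans (T-cong (pointwise λ where
            0F → sym (+-identityˡ 0#)
            1F → sym (+-identityˡ 0#)
            2F → sym (+-identityˡ 0#)
            3F → refl)) (additive (time b) (time a))) ≋-refl)
        (B-⊞ˡ (T (time a)) (T (time b)) G))))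
      (solve 3 (λ c x y → c :* (:- (x :+ y)) := c :* (:- x) :+ c :* (:- y)) refl κ⁻¹ _ _)

    θ-1 : θ 1# ≈ 1#
    θ-1 = trans (*-comm κ⁻¹ κ) κκ⁻¹

    θ-0 : θ 0# ≈ 0#
    θ-0 = trans (solve 1 (λ x → x := x :+ x :- x) refl (θ 0#))
      (≈⇒-≈0 (trans (sym (θ-+ 0# 0#)) (θ-cong (+-identityˡ 0#))))

    θ-neg : ∀ a → θ (- a) ≈ - θ a
    θ-neg a = trans (solve 2 (λ x y → x := x :+ y :- y) refl (θ (- a)) (θ a))
      (trans (+-congʳ (trans (sym (θ-+ (- a) a)) (trans (θ-cong (-‿inverseˡ a)) θ-0))) (+-identityˡ _))

    -- The rational parametrisation (1 - s²)² + (2s)² = (1 + s²)² survives the map, so (1 - θ(s²))²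
    -- + (2 θ s)² = (1 + θ(s²))², that is 4 θ(s)² = 4 θ(s²).
    θ-square : ∀ s → θ (s * s) ≈ θ s * θ s
    θ-square s = sym (-≈0⇒≈ (double≈0 (double≈0 (trans
      (solve 2 (λ x y → let o = lit 1 ; m = o :+ (:- y) ; d = o :+ y in
          x :* x :- y :+ (x :* x :- y) :+ (x :* x :- y :+ (x :* x :- y))
          := m :* m :+ (x :+ x) :* (x :+ x) :+ lit 0 :* lit 0 :- d :* d) refl (θ s) (θ (s * s)))
      (trans (sym (trans (B-cong θz θz) (B-expand z′ z′))) (cancel κ≉0 (trans (sym (μ-T z)) (T-null nz))))))))
      where
      z z′ : V
      z  = vec (1# + - (s * s)) (s + s) 0# (1# + s * s)
      z′ = vec (1# + - θ (s * s)) (θ s + θ s) 0# (1# + θ (s * s))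

      nz : Null z
      nz = trans (B-expand z z) (solve 1 (λ s → let m = lit 1 :+ (:- (s :* s)) ; d = lit 1 :+ s :* s in
        m :* m :+ (s :+ s) :* (s :+ s) :+ lit 0 :* lit 0 :- d :* d := lit 0) refl s)

      θz : θᵛ z ≋ z′
      θz = pointwise λ where
        0F → trans (θ-+ 1# _) (+-cong θ-1 (θ-neg (s * s)))
        1F → θ-+ s s
        2F → θ-0
        3F → trans (θ-+ 1# _) (+-congʳ θ-1)

    -- Polarisation of `θ-square` at a + b.
    θ-* : ∀ a b → θ (a * b) ≈ θ a * θ b
    θ-* a b = -≈0⇒≈ (double≈0 (trans
      (solve 5 (λ m x y p q → m :- x :* y :+ (m :- x :* y)
          := p :+ (m :+ m) :+ q :- (x :+ y) :* (x :+ y) :+ (x :* x :- p) :+ (y :* y :- q)) refl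
        (θ (a * b)) (θ a) (θ b) (θ (a * a)) (θ (b * b)))
      (sum≈0 (sum≈0 (≈⇒-≈0 expand) (≈⇒-≈0 (sym (θ-square a)))) (≈⇒-≈0 (sym (θ-square b))))))
      where
      expand : θ (a * a) + (θ (a * b) + θ (a * b)) + θ (b * b) ≈ (θ a + θ b) * (θ a + θ b)
      expand = trans (sym (trans
          (θ-cong (solve 2 (λ a b → (a :+ b) :* (a :+ b) := a :* a :+ (a :* b :+ a :* b) :+ b :* b) refl a b))
          (trans (θ-+ _ _) (+-congʳ (trans (θ-+ _ _) (+-congˡ (θ-+ _ _)))))))
        (trans (θ-square (a + b)) (*-cong (θ-+ a b) (θ-+ a b)))

    -- The image of a light ray is a full line, so its point with parameter `c` is the image of the
    -- ray scaled by some `a`. Pairing with `G` identifies θ a with c.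
    θ-surjective : ∀ c → ∃[ a ] θ a ≈ c
    θ-surjective c =
      let a , eq = line-preimage 𝟎 (ray⁺ 0F 1#) (null-ray⁺ 0F 1#) (ray⁺-nonzero 0F) c
          eq′ : θ a · (G ⊞ E 0F) ≋ c · (G ⊞ E 0F)
          eq′ = ≋-trans (pointwise λ k → distribˡ (θ a) (G k) (E 0F k))
                (≋-trans (≋-sym (⊞-cong (G-image a) (E-image a 0F)))
                (≋-trans (≋-sym (additive (axis 0F a) (time a))) (≋-trans (T-cong (ray⁺-scale 0F a))
                (≋-trans eq (·-cong refl (additive (axis 0F 1#) (time 1#)))))))
          B≈ : B (G ⊞ E 0F) G ≈ - κ
          B≈ = trans (B-⊞ˡ G (E 0F) G) (trans (+-cong μ-G (B-E-G 0F)) (+-identityʳ (- κ)))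
      in a , -≈0⇒≈ (cancel κ≉0 (trans
           (solve 3 (λ k t c → k :* (t :- c) := c :* (:- k) :- t :* (:- k)) refl κ (θ a) c)
           (≈⇒-≈0 (trans (sym (trans (B-·ˡ c _ G) (*-congˡ B≈)))
             (trans (B-cong (≋-sym eq′) ≋-refl) (trans (B-·ˡ (θ a) _ G) (*-congˡ B≈)))))))

    θ-μ : ∀ x → B (θᵛ x) (θᵛ x) ≈ θ (B x x)
    θ-μ x = trans (B-expand (θᵛ x) (θᵛ x)) (sym (trans (θ-cong (B-expand x x))
      (trans (θ-+ _ _) (+-cong
        (trans (θ-+ _ _) (+-cong (trans (θ-+ _ _) (+-cong (θ-* _ _) (θ-* _ _))) (θ-* _ _)))
        (trans (θ-neg _) (-‿cong (θ-* _ _)))))))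

    μ-θ : ∀ x → B (T x) (T x) ≈ κ * θ (B x x)
    μ-θ x = trans (μ-T x) (*-congˡ (θ-μ x))

    T-scale : ∀ s x → T (s · x) ≋ θ s · T x
    T-scale s x = ≋-trans (T-comb (s · x)) (≋-trans
      (⊞-cong (⊞-cong (⊞-cong (·-cong (θ-* s _) ≋-refl) (·-cong (θ-* s _) ≋-refl))
                      (·-cong (θ-* s _) ≋-refl)) (·-cong (θ-* s _) ≋-refl))
      (≋-trans (pointwise λ k → trans
          (+-cong (+-cong (+-cong (*-assoc _ _ _) (*-assoc _ _ _)) (*-assoc _ _ _)) (*-assoc _ _ _))
          (solve 5 (λ s a b c d → s :* a :+ s :* b :+ s :* c :+ s :* d := s :* (a :+ b :+ c :+ d)) refl
            (θ s) (θ (x 0F) * E 0F k) (θ (x 1F) * E 1F k) (θ (x 2F) * E 2F k) (θ (x 3F) * G k)))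
        (·-cong refl (≋-sym (T-comb x)))))

    -- `symd` is the content of `AxSymd` for displacements: without time components, the form is the
    -- squared spatial distance.
    module _ (symd : ∀ x → x 3F ≈ 0# → T x 3F ≈ 0# → B (T x) (T x) ≈ B x x) where

      module _ (u : V) (u₃≈0 : u 3F ≈ 0#) (Tu₃≈0 : T u 3F ≈ 0#) (μu≉0 : B u u ≉ 0#) where

        -- T(su) = θ(s) T u, so su is again simultaneous for both observers. Comparing squares gives
        -- θ(s)² B(u,u) = s² B(u,u).
        square-fixed : ∀ s → θ s * θ s ≈ s * s
        square-fixed s = -≈0⇒≈ (cancel μu≉0 (trans
          (solve 3 (λ m t s → m :* (t :* t :- s :* s) := t :* (t :* m) :- s :* (s :* m)) refl (B u u) (θ s) s)
          (≈⇒-≈0 (trans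
            (sym (trans (B-cong (T-scale s u) (T-scale s u)) (trans (B-·ˡ (θ s) _ _)
              (*-congˡ (trans (B-·ʳ (θ s) _ _) (*-congˡ (symd u u₃≈0 Tu₃≈0)))))))
            (trans (symd (s · u) (scale≈0 s u₃≈0) (trans (at (T-scale s u) 3F) (scale≈0 (θ s) Tu₃≈0)))
              (trans (B-·ˡ s u (s · u)) (*-congˡ (B-·ʳ s u u))))))))

        -- Squares leave a sign open. Using s + 1 as well linearises: the difference of the two
        -- equations is 2 θ s = 2 s.
        θ-id : ∀ s → θ s ≈ s
        θ-id s = -≈0⇒≈ (double≈0 (trans
          (solve 2 (λ t s → t :- s :+ (t :- s)
            := (t :+ lit 1) :* (t :+ lit 1) :- (s :+ lit 1) :* (s :+ lit 1) :- (t :* t :- s :* s)) refl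
            (θ s) s)
          (sum≈0 (≈⇒-≈0 (trans (sym (*-cong θs+1 θs+1)) (square-fixed (s + 1#))))
                 (neg≈0 (≈⇒-≈0 (square-fixed s))))))
          where
          θs+1 : θ (s + 1#) ≈ θ s + 1#
          θs+1 = trans (θ-+ s 1#) (+-congˡ θ-1)

        κ-1 : κ ≈ 1#
        κ-1 = -≈0⇒≈ (cancel μu≉0 (trans
          (solve 2 (λ m k → m :* (k :- lit 1) := k :* m :- m) refl (B u u) κ)
          (≈⇒-≈0 (trans (*-congˡ (sym (θ-id (B u u)))) (trans (sym (μ-θ u)) (symd u u₃≈0 Tu₃≈0))))))

        isometry′ : ∀ x → B (T x) (T x) ≈ B x x
        isometry′ x = trans (μ-θ x) (trans (*-cong κ-1 (θ-id (B x x))) (*-identityˡ _))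

      T₃ : ∀ x → T x 3F ≈ θ (x 0F) * E 0F 3F + θ (x 1F) * E 1F 3F + θ (x 2F) * E 2F 3F + θ (x 3F) * G 3F
      T₃ x = at (T-comb x) 3F

      -- A vector simultaneous for both observers: (θ⁻¹ τ₂ , - θ⁻¹ τ₁ , 0 , 0), where τᵢ
      -- is the time component of T eᵢ, or e₁ if this vanishes.
      isometry : ∀ x → B (T x) (T x) ≈ B x x
      isometry x = by-cases
        -- In this case α² + β² = 0, so β = 0 and τ₁ = θ β = 0: the first axis vector is
        -- simultaneous for both observers.
        (λ μu≈0 → isometry′ e refl
          (trans (T₃ e) (sum≈0 (sum≈0 (sum≈0 (scale≈0 _ (τ₁≈0 μu≈0)) (θ0 _)) (θ0 _)) (θ0 _)))
          (λ μe≈0 → 1≉0 (trans (sym (*-identityˡ 1#)) (trans (sym (μ-axis 0F 1#)) μe≈0))) x)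
        (λ μu≉0 → isometry′ u refl
          (trans (T₃ u) (trans
            (+-cong (+-cong (+-cong (*-congʳ ατ) (*-congʳ (trans (θ-neg β) (-‿cong βτ)))) (θ0 _)) (θ0 _))
            (solve 2 (λ x y → y :* x :+ (:- x) :* y :+ lit 0 :+ lit 0 := lit 0) refl τ₁ τ₂)))
          μu≉0 x)
        where
        τ₁ = E 0F 3F
        τ₂ = E 1F 3F
        α  = proj₁ (θ-surjective τ₂)
        ατ = proj₂ (θ-surjective τ₂)
        β  = proj₁ (θ-surjective τ₁)
        βτ = proj₂ (θ-surjective τ₁)

        u e : V
        u = vec α (- β) 0# 0#
        e = axis 0F 1#

        θ0 : ∀ y → θ 0# * y ≈ 0#
        θ0 y = trans (*-congʳ θ-0) (zeroˡ y)

        τ₁≈0 : B u u ≈ 0# → τ₁ ≈ 0#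
        τ₁≈0 p = trans (sym βτ) (trans (θ-cong (real {β} {α} {0#} (trans
          (solve 2 (λ a b → b :* b :+ a :* a :+ lit 0 :* lit 0
             := a :* a :+ (:- b) :* (:- b) :+ lit 0 :* lit 0 :- lit 0 :* lit 0) refl α β)
          (trans (sym (B-expand u u)) p)))) θ-0)

      interval : ∀ x y → B (to x ⊟ to y) (to x ⊟ to y) ≈ B (x ⊟ y) (x ⊟ y)
      interval x y = trans (B-cong (to-⊟ x y) (to-⊟ x y)) (isometry (x ⊟ y))

  -- Worldview transformations

  module _ {Body : Set} (Sees : Body → Body → V → Set) where

    Same : Body → V → Body → V → Set
    Same o x o′ x′ = ∀ b → (Sees o b x → Sees o′ b x′) × (Sees o′ b x′ → Sees o b x)

  Signal : {Body : Set} → (Body → Set) → (Body → Body → V → Set) → Body → V → V → Set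
  Signal Photon Sees o x y = ∃[ b ] Photon b × Sees o b x × Sees o b y

  record Worldviews : Set₁ where
    field
      Body            : Set
      Photon Observer : Body → Set
      Sees            : Body → Body → V → Set
      signal⇒null     : ∀ {o x y} → Observer o → Signal Photon Sees o x y → Null (x ⊟ y)
      null⇒signal     : ∀ {o x y} → Observer o → Null (x ⊟ y) → Signal Photon Sees o x y
      event           : ∀ {o o′} → Observer o → Observer o′ → ∀ x → ∃[ x′ ] Same Sees o x o′ x′
      simultaneous    : ∀ {o o′ x x′ y y′} → Observer o → Observer o′ → x 3F ≈ y 3F → x′ 3F ≈ y′ 3F →
                        Same Sees o x o′ x′ → Same Sees o y o′ y′ →
                        B (x′ ⊟ y′) (x′ ⊟ y′) ≈ B (x ⊟ y) (x ⊟ y)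

  module WorldviewTransformation (𝓦 : Worldviews) where
    open Worldviews 𝓦

    same-sym : ∀ {o x o′ x′} → Same Sees o x o′ x′ → Same Sees o′ x′ o x
    same-sym s b = proj₂ (s b) , proj₁ (s b)

    same-trans : ∀ {o x o′ x′ o″ x″} → Same Sees o x o′ x′ → Same Sees o′ x′ o″ x″ → Same Sees o x o″ x″
    same-trans s t b = (λ p → proj₁ (t b) (proj₁ (s b) p)) , (λ p → proj₂ (s b) (proj₂ (t b) p))

    null-same : ∀ {o o′ x y x′ y′} → Observer o → Observer o′ →
                Same Sees o x o′ x′ → Same Sees o y o′ y′ → Null (x ⊟ y) → Null (x′ ⊟ y′)
    null-same io io′ s t n =
      let b , ph , p , q = null⇒signal io n in signal⇒null io′ (b , ph , proj₁ (s b) p , proj₁ (t b) q)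

    -- Points where one observer sees the same bodies meet the same photons, hence have the same
    -- light cone.
    same-unique : ∀ {o x y} → Observer o → Same Sees o x o y → x ≋ y
    same-unique io s = cone-injective λ z → null-same io io s (λ b → id , id)

    module _ {o o′ : Body} (io : Observer o) (io′ : Observer o′) where

      to from : V → V
      to x   = proj₁ (event io io′ x)
      from x = proj₁ (event io′ io x)

      same-to : ∀ x → Same Sees o x o′ (to x)
      same-to x = proj₂ (event io io′ x)

      same-from : ∀ x → Same Sees o′ x o (from x)
      same-from x = proj₂ (event io′ io x)

      worldview : LightBijection
      worldview = record
        { to = to ; from = from
        ; to-from = λ y → same-unique io′ (same-sym (same-trans (same-from y) (same-to (from y))))
        ; from-to = λ x → same-unique io (same-sym (same-trans (same-to x) (same-from (to x))))
        ; to-null   = λ x y → null-same io io′ (same-to x) (same-to y)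
        ; from-null = λ x y → null-same io′ io (same-from x) (same-from y)
        }

      open Additivity worldview using (T)
      open Semilinear worldview using (interval)

      T-simultaneous : ∀ x → x 3F ≈ 0# → T x 3F ≈ 0# → B (T x) (T x) ≈ B x x
      T-simultaneous x x₃≈0 Tx₃≈0 = trans
        (simultaneous io io′ (trans (+-identityˡ _) x₃≈0) (-≈0⇒≈ Tx₃≈0) (same-to (𝟎 ⊞ x)) (same-to 𝟎))
        (B-cong (⊞-⊟ 𝟎 x) (⊞-⊟ 𝟎 x))

      interval-invariant : ∀ {x y x′ y′} → Same Sees o x o′ x′ → Same Sees o y o′ y′ →
                           B (x′ ⊟ y′) (x′ ⊟ y′) ≈ B (x ⊟ y) (x ⊟ y)
      interval-invariant {x} {y} {x′} {y′} s t =
        trans (B-cong x′⊟y′ x′⊟y′) (interval T-simultaneous x y)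
        where
        -- The given point need not be the one that `event` selected, but both carry the same event
        -- for `o′`.
        to-unique : ∀ {z z′} → Same Sees o z o′ z′ → z′ ≋ to z
        to-unique {z} s = same-unique io′ (same-trans (same-sym s) (same-to z))

        x′⊟y′ : x′ ⊟ y′ ≋ to x ⊟ to y
        x′⊟y′ = ⊟-cong (to-unique s) (to-unique t)

-- Semantics

-- Tarski semantics with an arbitrary proposition Absurd for ⊥ and, accordingly,
-- a disjunction that is only read through its eliminations into Absurd.
record Structure : Set₁ where
  field
    Absurd        : Set
    Body Quantity : Set
    plus times    : Quantity → Quantity → Quantity
    SameBody      : Body → Body → Set
    Equal Less    : Quantity → Quantity → Set
    Inertial      : Body → Set
    Photon        : Body → Set
    Sees          : Body → Body → Vec Quantity 4 → Set

  ⟦_⟧ᵗ : Term n → (Fin n → Quantity) → Quantity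
  ⟦ var i ⟧ᵗ σ = σ i
  ⟦ s ⊕ t ⟧ᵗ σ = plus (⟦ s ⟧ᵗ σ) (⟦ t ⟧ᵗ σ)
  ⟦ s ⊗ t ⟧ᵗ σ = times (⟦ s ⟧ᵗ σ) (⟦ t ⟧ᵗ σ)

  ⟦_⟧ : Formula m n → (Fin m → Body) → (Fin n → Quantity) → Set
  ⟦ a ≈ᵇ b ⟧ ρ σ  = SameBody (ρ a) (ρ b)
  ⟦ s Defs.≈ t ⟧ ρ σ = Equal (⟦ s ⟧ᵗ σ) (⟦ t ⟧ᵗ σ)
  ⟦ s ≺ t ⟧ ρ σ   = Less (⟦ s ⟧ᵗ σ) (⟦ t ⟧ᵗ σ)
  ⟦ IB a ⟧ ρ σ    = Inertial (ρ a)
  ⟦ Ph a ⟧ ρ σ    = Photon (ρ a)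
  ⟦ W a b x ⟧ ρ σ = Sees (ρ a) (ρ b) (Vec.map (λ t → ⟦ t ⟧ᵗ σ) x)
  ⟦ ⊥ ⟧ ρ σ       = Absurd
  ⟦ φ ∧ ψ ⟧ ρ σ   = ⟦ φ ⟧ ρ σ × ⟦ ψ ⟧ ρ σ
  ⟦ φ ∨ ψ ⟧ ρ σ   = (⟦ φ ⟧ ρ σ → Absurd) → (⟦ ψ ⟧ ρ σ → Absurd) → Absurd
  ⟦ φ ⇒ ψ ⟧ ρ σ   = ⟦ φ ⟧ ρ σ → ⟦ ψ ⟧ ρ σ
  ⟦ ∀ᵇ φ ⟧ ρ σ    = ∀ b → ⟦ φ ⟧ (b ◂ ρ) σ
  ⟦ ∃ᵇ φ ⟧ ρ σ    = ∃[ b ] ⟦ φ ⟧ (b ◂ ρ) σ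
  ⟦ ∀ᑫ φ ⟧ ρ σ    = ∀ q → ⟦ φ ⟧ ρ (q ◂ σ)
  ⟦ ∃ᑫ φ ⟧ ρ σ    = ∃[ q ] ⟦ φ ⟧ ρ (q ◂ σ)

  ⟦_⟧ˢ : Sentence → Set
  ⟦ φ ⟧ˢ = ⟦ φ ⟧ (λ ()) (λ ())

-- Stability of all formulas restores classical logic although existential formulas are read as
-- pairs with an actual witness.
record IsClassical (M : Structure) : Set where
  open Structure M
  field
    stable  : (φ : Formula m n) (ρ : Fin m → Body) (σ : Fin n → Quantity) →
              ((⟦ φ ⟧ ρ σ → Absurd) → Absurd) → ⟦ φ ⟧ ρ σ
    reflexive : ∀ q → Equal q q
    leibniz : (φ : Formula m (suc n)) (ρ : Fin m → Body) (σ : Fin n → Quantity) →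
              ∀ {q r} → Equal q r → ⟦ φ ⟧ ρ (q ◂ σ) → ⟦ φ ⟧ ρ (r ◂ σ)

-- Classical models of the axioms

module Models (M : Structure) (classical : IsClassical M)
              (satisfies : All (Structure.⟦_⟧ˢ M) SpecRel) where
  open Structure M
  open IsClassical classical

  Equal-sym : ∀ {p q} → Equal p q → Equal q p
  Equal-sym {p} e = leibniz {0} {1} (var 0F Defs.≈ var 1F) (λ ()) (λ _ → p) e (reflexive p)

  Equal-trans : ∀ {p q r} → Equal p q → Equal q r → Equal p r
  Equal-trans {p} e f = leibniz {0} {1} (var 1F Defs.≈ var 0F) (λ ()) (λ _ → p) f e

  plus-cong : ∀ {p p′ q q′} → Equal p p′ → Equal q q′ → Equal (plus p q) (plus p′ q′)
  plus-cong {p} {p′} {q} {q′} e f = Equal-trans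
    (leibniz {0} {2} (var 1F ⊕ var 2F Defs.≈ var 0F ⊕ var 2F) (λ ()) (p ◂ λ _ → q) e (reflexive _))
    (leibniz {0} {2} (var 1F ⊕ var 2F Defs.≈ var 1F ⊕ var 0F) (λ ()) (p′ ◂ λ _ → q) f (reflexive _))

  times-cong : ∀ {p p′ q q′} → Equal p p′ → Equal q q′ → Equal (times p q) (times p′ q′)
  times-cong {p} {p′} {q} {q′} e f = Equal-trans
    (leibniz {0} {2} (var 1F ⊗ var 2F Defs.≈ var 0F ⊗ var 2F) (λ ()) (p ◂ λ _ → q) e (reflexive _))
    (leibniz {0} {2} (var 1F ⊗ var 2F Defs.≈ var 1F ⊗ var 0F) (λ ()) (p′ ◂ λ _ → q) f (reflexive _))

  Less-respˡ : ∀ {p p′ q} → Equal p p′ → Less p q → Less p′ q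
  Less-respˡ {q = q} e l = leibniz {0} {1} (var 0F ≺ var 1F) (λ ()) (λ _ → q) e l

  Less-respʳ : ∀ {p q q′} → Equal q q′ → Less p q → Less p q′
  Less-respʳ {p} e l = leibniz {0} {1} (var 1F ≺ var 0F) (λ ()) (λ _ → p) e l

  Equal-stable : ∀ {p q} → ((Equal p q → Absurd) → Absurd) → Equal p q
  Equal-stable {p} {q} = stable {0} {2} (var 0F Defs.≈ var 1F) (λ ()) (p ◂ λ _ → q)

  opaque
    -- Positions 0 to 14 are the field axioms in their order; 15 to 18 are `AxSelf`, `AxPh`, `AxEv`
    -- and `AxSymd`.
    axiom : ∀ i → ⟦ lookup SpecRel i ⟧ˢ
    axiom i = All.lookup satisfies (∈-lookup i)

    0ᴷ 1ᴷ : Quantity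
    0ᴷ = proj₁ (axiom (# 2))
    1ᴷ = proj₁ (axiom (# 6))

    minus : Quantity → Quantity
    minus q = proj₁ (axiom (# 3) q)

    plus-identityʳ : ∀ q → Equal (plus q 0ᴷ) q
    plus-identityʳ = proj₂ (axiom (# 2))

    times-identityʳ : ∀ q → Equal (times q 1ᴷ) q
    times-identityʳ = proj₂ (axiom (# 6))

    plus-minus : ∀ p q → Equal (plus p (plus q (minus q))) p
    plus-minus p q = proj₂ (axiom (# 3) q) p

  plus-assoc : ∀ p q r → Equal (plus (plus p q) r) (plus p (plus q r))
  plus-assoc = axiom (# 0)

  plus-comm : ∀ p q → Equal (plus p q) (plus q p)
  plus-comm = axiom (# 1)

  times-assoc : ∀ p q r → Equal (times (times p q) r) (times p (times q r))
  times-assoc = axiom (# 4)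

  times-comm : ∀ p q → Equal (times p q) (times q p)
  times-comm = axiom (# 5)

  plus-zeroˡ : ∀ q → Equal (plus 0ᴷ q) q
  plus-zeroˡ q = Equal-trans (plus-comm 0ᴷ q) (plus-identityʳ q)

  Zero One : Quantity → Set
  Zero q = ∀ p → Equal (plus p q) p
  One q = ∀ p → Equal (times p q) p

  zero-unique : ∀ {q} → Zero q → Equal q 0ᴷ
  zero-unique {q} z = Equal-trans (Equal-sym (plus-identityʳ q)) (Equal-trans (plus-comm q 0ᴷ) (z 0ᴷ))

  one-unique : ∀ {q} → One q → Equal q 1ᴷ
  one-unique {q} z = Equal-trans (Equal-sym (times-identityʳ q)) (Equal-trans (times-comm q 1ᴷ) (z 1ᴷ))

  plus-inverseʳ : ∀ q → Equal (plus q (minus q)) 0ᴷ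
  plus-inverseʳ q = zero-unique (λ p → plus-minus p q)

  plus-inverseˡ : ∀ q → Equal (plus (minus q) q) 0ᴷ
  plus-inverseˡ q = Equal-trans (plus-comm (minus q) q) (plus-inverseʳ q)

  distribˡ : ∀ p q r → Equal (times p (plus q r)) (plus (times p q) (times p r))
  distribˡ = axiom (# 9)

  -- `minus` selects witnesses of an existential axiom and need not respect `Equal` by construction;
  -- uniqueness of inverses makes it do so.
  minus-cong : ∀ {p q} → Equal p q → Equal (minus p) (minus q)
  minus-cong {p} {q} e =
    Equal-trans (Equal-sym (plus-identityʳ (minus p)))
    (Equal-trans (plus-cong (reflexive (minus p)) (Equal-sym (plus-inverseʳ q)))
    (Equal-trans (Equal-sym (plus-assoc (minus p) q (minus q)))
    (Equal-trans (plus-cong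
      (Equal-trans (plus-cong (reflexive (minus p)) (Equal-sym e)) (plus-inverseˡ p))
      (reflexive (minus q)))
    (Equal-trans (plus-comm 0ᴷ (minus q)) (plus-identityʳ (minus q))))))

  commutativeRing : CommutativeRing 0ℓ 0ℓ
  commutativeRing = record
    { Carrier = Quantity ; _≈_ = Equal ; _+_ = plus ; _*_ = times ; -_ = minus ; 0# = 0ᴷ ; 1# = 1ᴷ
    ; isCommutativeRing = record
      { isRing = record
        { +-isAbelianGroup = record
          { isGroup = record
            { isMonoid = record
              { isSemigroup = record
                { isMagma = record
                  { isEquivalence = record
                    { refl = λ {q} → reflexive q ; sym = Equal-sym ; trans = Equal-trans }
                  ; ∙-cong = plus-cong }
                ; assoc = plus-assoc }
              ; identity = (λ q → Equal-trans (plus-comm 0ᴷ q) (plus-identityʳ q)) , plus-identityʳ }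
            ; inverse = plus-inverseˡ , plus-inverseʳ
            ; ⁻¹-cong = minus-cong }
          ; comm = plus-comm }
        ; *-cong = times-cong
        ; *-assoc = times-assoc
        ; *-identity = (λ q → Equal-trans (times-comm 1ᴷ q) (times-identityʳ q)) , times-identityʳ
        ; distrib = distribˡ , λ r p q → Equal-trans (times-comm (plus p q) r)
            (Equal-trans (distribˡ r p q) (plus-cong (times-comm r p) (times-comm r q))) }
      ; *-comm = times-comm } }

  orderedRing : OrderedRing
  orderedRing = record
    { ring       = commutativeRing
    ; Absurd     = Absurd
    ; ≈-stable   = Equal-stable
    ; _<_        = Less
    ; <-respˡ    = Less-respˡ
    ; <-respʳ    = Less-respʳ
    ; <-irrefl   = axiom (# 10)
    ; <-trans    = axiom (# 11)
    ; <-tri      = λ p q f g h → axiom (# 12) p q f λ k → k g h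
    ; +-monoˡ-<  = axiom (# 13)
    ; *-positive = λ p q 0<p 0<q →
        let z , z-zero , z<pq = axiom (# 14) p q ((0ᴷ , plus-identityʳ , 0<p) , (0ᴷ , plus-identityʳ , 0<q))
        in Less-respˡ (zero-unique z-zero) z<pq
    }

  realField : RealField
  realField = record
    { ring     = commutativeRing
    ; Absurd   = Absurd
    ; ≈-stable = Equal-stable
    ; 1≉0      = λ 1≈0 → axiom (# 8) 0ᴷ
        (plus-identityʳ , λ p → Equal-trans (times-cong (reflexive p) (Equal-sym 1≈0)) (times-identityʳ p))
    ; inverse  = λ {a} a≉0 →
        let b , one = axiom (# 7) a (λ z → a≉0 (zero-unique z)) in b , one-unique one
    ; real     = λ {a} {b} {c} → SumsOfSquares.real orderedRing a b c
    }

  open RealField realField using (_≈_; refl; sym; trans; +-congʳ)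
  open Geometry realField
  open Isometry realField using (Same; Signal; Worldviews; module WorldviewTransformation)
  open WorldviewTransformation using (interval-invariant)

  Observer : Body → Set
  Observer o = ⟦ IOb {1} {0} 0F ⟧ (λ _ → o) (λ ())

  Sees′ : Body → Body → V → Set
  Sees′ o b x = Sees o b (x 0F ∷ x 1F ∷ x 2F ∷ x 3F ∷ [])

  signal⇒null : ∀ {o x y} → Observer o → Signal Photon Sees′ o x y → Null (x ⊟ y)
  signal⇒null {o} {x} {y} io signal =
    let r , (_ , _ , _ , e₁ , e₂ , e₃ , space) , (_ , e₄ , time) =
          proj₁ (axiom (# 16) o (x 0F) (x 1F) (x 2F) (x 3F) (y 0F) (y 1F) (y 2F) (y 3F) io) signal
    in trans (μ-coordinates {x} {y} e₁ e₂ e₃ e₄) (≈⇒-≈0 (trans (sym space) time))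

  null⇒signal : ∀ {o x y} → Observer o → Null (x ⊟ y) → Signal Photon Sees′ o x y
  null⇒signal {o} {x} {y} io null =
    proj₂ (axiom (# 16) o (x 0F) (x 1F) (x 2F) (x 3F) (y 0F) (y 1F) (y 2F) (y 3F) io)
      ( _
      , (_ , _ , _ , difference _ _ , difference _ _ , difference _ _ , refl)
      , (_ , difference _ _ , -≈0⇒≈ (trans (sym (B-expand _ _)) null)) )

  event : ∀ {o o′} → Observer o → Observer o′ → ∀ x → ∃[ x′ ] Same Sees′ o x o′ x′
  event {o} {o′} io io′ x =
    let a , b , c , d , s = axiom (# 17) o o′ (x 0F) (x 1F) (x 2F) (x 3F) (io , io′) in
    vec a b c d , s

  simultaneous : ∀ {o o′ x x′ y y′} → Observer o → Observer o′ →
                 x 3F ≈ y 3F → x′ 3F ≈ y′ 3F → Same Sees′ o x o′ x′ → Same Sees′ o y o′ y′ →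
                 B (x′ ⊟ y′) (x′ ⊟ y′) ≈ B (x ⊟ y) (x ⊟ y)
  simultaneous {o} {o′} {x} {x′} {y} {y′} io io′ t≈ t′≈ s s′ =
    let r , (_ , _ , _ , e₁ , e₂ , e₃ , r≈) , (_ , _ , _ , e₁′ , e₂′ , e₃′ , r≈′) =
          axiom (# 18) o o′ (x 0F) (x 1F) (x 2F) (x 3F) (x′ 0F) (x′ 1F) (x′ 2F) (x′ 3F)
            (y 0F) (y 1F) (y 2F) (y 3F) (y′ 0F) (y′ 1F) (y′ 2F) (y′ 3F)
            (io , io′ , t≈ , t′≈ , s , s′)
    -- Simultaneity makes 0 a time difference on both sides, so both forms are a squared distance
    -- minus the same 0 · 0.
    in trans (μ-coordinates {x′} {y′} e₁′ e₂′ e₃′ (trans (plus-zeroˡ _) (sym t′≈)))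
         (trans (+-congʳ (trans (sym r≈′) r≈))
           (sym (μ-coordinates {x} {y} e₁ e₂ e₃ (trans (plus-zeroˡ _) (sym t≈)))))

  worldviews : Worldviews
  worldviews = record
    { Body = Body ; Photon = Photon ; Observer = Observer ; Sees = Sees′
    ; signal⇒null = λ {o} {x} {y} → signal⇒null {o} {x} {y}
    ; null⇒signal = λ {o} {x} {y} → null⇒signal {o} {x} {y}
    ; event = event
    ; simultaneous = λ {o} {o′} {x} {x′} {y} {y′} → simultaneous {o} {o′} {x} {x′} {y} {y′} }

  intervalInvariance : ⟦ IntervalInvariance ⟧ˢ
  intervalInvariance o o′ x₁ x₂ x₃ x₄ x₁′ x₂′ x₃′ x₄′ y₁ y₂ y₃ y₄ y₁′ y₂′ y₃′ y₄′ (io , io′ , s , t) =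
    let x  = vec x₁ x₂ x₃ x₄
        y  = vec y₁ y₂ y₃ y₄
        x′ = vec x₁′ x₂′ x₃′ x₄′
        y′ = vec y₁′ y₂′ y₃′ y₄′
    in B (x ⊟ y) (x ⊟ y) , mu x y refl ,
       mu x′ y′ (sym (interval-invariant worldviews io io′ {x} {y} {x′} {y′} s t))
    where
    -- Interpretation sees only the values of terms, so one statement over nine variables serves
    -- both `Mu` conjuncts of `EqualMu`.
    mu : ∀ x y {r} → r ≈ B (x ⊟ y) (x ⊟ y) →
         ⟦ Mu {n = 9} {m = 0} (var (# 0) ∷ var (# 1) ∷ var (# 2) ∷ var (# 3) ∷ [])
             (var (# 4) ∷ var (# 5) ∷ var (# 6) ∷ var (# 7) ∷ []) (var (# 8)) ⟧
           (λ ()) (x 0F ◂ x 1F ◂ x 2F ◂ x 3F ◂ y 0F ◂ y 1F ◂ y 2F ◂ y 3F ◂ λ (_ : Fin 1) → r)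
    mu x y e = _ , _ ,
      (_ , _ , _ , difference _ _ , difference _ _ , difference _ _ , refl) ,
      (_ , difference _ _ , refl) ,
      trans (+-congʳ (trans e (B-expand (x ⊟ y) (x ⊟ y)))) (difference _ _)

-- Completeness

open Defs using (_≈_)
open ≡ using (refl; sym; trans; cong; cong₂; subst)
open ℕₚ using
  (≤-refl; ≤-trans; <-irrefl; m≤m+n; +-suc; +-assoc; m≤m⊔n; m≤n⊔m; m≤n⇒m<n∨m≡n; n≤1+n;
   m⊔n≤o⇒m≤o; m⊔n≤o⇒n≤o)

-- Substitution and weakening

subᵗ-cong : {σ τ : Fin n → Term n′} → σ ≗ τ → subᵗ σ ≗ subᵗ τ
subᵗ-cong σ≗τ (var i) = σ≗τ i
subᵗ-cong σ≗τ (s ⊕ t) = cong₂ _⊕_ (subᵗ-cong σ≗τ s) (subᵗ-cong σ≗τ t)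
subᵗ-cong σ≗τ (s ⊗ t) = cong₂ _⊗_ (subᵗ-cong σ≗τ s) (subᵗ-cong σ≗τ t)

subᵗ-id : subᵗ var ≗ id {A = Term n}
subᵗ-id (var i) = refl
subᵗ-id (s ⊕ t) = cong₂ _⊕_ (subᵗ-id s) (subᵗ-id t)
subᵗ-id (s ⊗ t) = cong₂ _⊗_ (subᵗ-id s) (subᵗ-id t)

subᵗ-∘ : (τ : Fin n′ → Term n″) (σ : Fin n → Term n′) →
         subᵗ τ ∘ subᵗ σ ≗ subᵗ (subᵗ τ ∘ σ)
subᵗ-∘ τ σ (var i) = refl
subᵗ-∘ τ σ (s ⊕ t) = cong₂ _⊕_ (subᵗ-∘ τ σ s) (subᵗ-∘ τ σ t)
subᵗ-∘ τ σ (s ⊗ t) = cong₂ _⊗_ (subᵗ-∘ τ σ s) (subᵗ-∘ τ σ t)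

liftᵇ-cong : {ρ ϱ : Fin m → Fin m′} → ρ ≗ ϱ → liftᵇ ρ ≗ liftᵇ ϱ
liftᵇ-cong ρ≗ϱ zero    = refl
liftᵇ-cong ρ≗ϱ (suc i) = cong suc (ρ≗ϱ i)

liftᵇ-id : liftᵇ id ≗ id {A = Fin (suc m)}
liftᵇ-id zero    = refl
liftᵇ-id (suc i) = refl

liftᵇ-∘ : (ϱ : Fin m′ → Fin m″) (ρ : Fin m → Fin m′) →
          liftᵇ ϱ ∘ liftᵇ ρ ≗ liftᵇ (ϱ ∘ ρ)
liftᵇ-∘ ϱ ρ zero    = refl
liftᵇ-∘ ϱ ρ (suc i) = refl

liftᑫ-cong : {σ τ : Fin n → Term n′} → σ ≗ τ → liftᑫ σ ≗ liftᑫ τ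
liftᑫ-cong σ≗τ zero    = refl
liftᑫ-cong σ≗τ (suc i) = cong (↑ 1) (σ≗τ i)

liftᑫ-var : liftᑫ var ≗ var {n = suc n}
liftᑫ-var zero    = refl
liftᑫ-var (suc i) = refl

liftᑫ-∘ : (τ : Fin n′ → Term n″) (σ : Fin n → Term n′) →
          subᵗ (liftᑫ τ) ∘ liftᑫ σ ≗ liftᑫ (subᵗ τ ∘ σ)
liftᑫ-∘ τ σ zero    = refl
liftᑫ-∘ τ σ (suc i) =
  trans (subᵗ-∘ (liftᑫ τ) (var ∘ suc) (σ i)) (sym (subᵗ-∘ (var ∘ suc) τ (σ i)))

sub-cong : {ρ ϱ : Fin m → Fin m′} {σ τ : Fin n → Term n′} →
           ρ ≗ ϱ → σ ≗ τ → sub ρ σ ≗ sub ϱ τ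
sub-cong p q (a ≈ᵇ b)  = cong₂ _≈ᵇ_ (p a) (p b)
sub-cong p q (s ≈ t)   = cong₂ _≈_ (subᵗ-cong q s) (subᵗ-cong q t)
sub-cong p q (s ≺ t)   = cong₂ _≺_ (subᵗ-cong q s) (subᵗ-cong q t)
sub-cong p q (IB a)    = cong IB (p a)
sub-cong p q (Ph a)    = cong Ph (p a)
sub-cong p q (W a b x)
  rewrite p a | p b    = cong (W _ _) (Vecₚ.map-cong (subᵗ-cong q) x)
sub-cong p q ⊥         = refl
sub-cong p q (φ ∧ ψ)   = cong₂ _∧_ (sub-cong p q φ) (sub-cong p q ψ)
sub-cong p q (φ ∨ ψ)   = cong₂ _∨_ (sub-cong p q φ) (sub-cong p q ψ)
sub-cong p q (φ ⇒ ψ)   = cong₂ _⇒_ (sub-cong p q φ) (sub-cong p q ψ)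
sub-cong p q (∀ᵇ φ)    = cong ∀ᵇ_ (sub-cong (liftᵇ-cong p) q φ)
sub-cong p q (∃ᵇ φ)    = cong ∃ᵇ_ (sub-cong (liftᵇ-cong p) q φ)
sub-cong p q (∀ᑫ φ)    = cong ∀ᑫ_ (sub-cong p (liftᑫ-cong q) φ)
sub-cong p q (∃ᑫ φ)    = cong ∃ᑫ_ (sub-cong p (liftᑫ-cong q) φ)

sub-id : sub id var ≗ id {A = Formula m n}
sub-id (a ≈ᵇ b)  = refl
sub-id (s ≈ t)   = cong₂ _≈_ (subᵗ-id s) (subᵗ-id t)
sub-id (s ≺ t)   = cong₂ _≺_ (subᵗ-id s) (subᵗ-id t)
sub-id (IB a)    = refl
sub-id (Ph a)    = refl
sub-id (W a b x) = cong (W a b) (trans (Vecₚ.map-cong subᵗ-id x) (Vecₚ.map-id x))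
sub-id ⊥         = refl
sub-id (φ ∧ ψ)   = cong₂ _∧_ (sub-id φ) (sub-id ψ)
sub-id (φ ∨ ψ)   = cong₂ _∨_ (sub-id φ) (sub-id ψ)
sub-id (φ ⇒ ψ)   = cong₂ _⇒_ (sub-id φ) (sub-id ψ)
sub-id (∀ᵇ φ)    = cong ∀ᵇ_ (trans (sub-cong liftᵇ-id (λ _ → refl) φ) (sub-id φ))
sub-id (∃ᵇ φ)    = cong ∃ᵇ_ (trans (sub-cong liftᵇ-id (λ _ → refl) φ) (sub-id φ))
sub-id (∀ᑫ φ)    = cong ∀ᑫ_ (trans (sub-cong (λ _ → refl) liftᑫ-var φ) (sub-id φ))
sub-id (∃ᑫ φ)    = cong ∃ᑫ_ (trans (sub-cong (λ _ → refl) liftᑫ-var φ) (sub-id φ))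

sub-∘ : (ϱ : Fin m′ → Fin m″) (τ : Fin n′ → Term n″)
        (ρ : Fin m → Fin m′) (σ : Fin n → Term n′) →
        sub ϱ τ ∘ sub ρ σ ≗ sub (ϱ ∘ ρ) (subᵗ τ ∘ σ)
sub-∘ ϱ τ ρ σ (a ≈ᵇ b)  = refl
sub-∘ ϱ τ ρ σ (s ≈ t)   = cong₂ _≈_ (subᵗ-∘ τ σ s) (subᵗ-∘ τ σ t)
sub-∘ ϱ τ ρ σ (s ≺ t)   = cong₂ _≺_ (subᵗ-∘ τ σ s) (subᵗ-∘ τ σ t)
sub-∘ ϱ τ ρ σ (IB a)    = refl
sub-∘ ϱ τ ρ σ (Ph a)    = refl
sub-∘ ϱ τ ρ σ (W a b x) =
  cong (W _ _) (trans (sym (Vecₚ.map-∘ (subᵗ τ) (subᵗ σ) x)) (Vecₚ.map-cong (subᵗ-∘ τ σ) x))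
sub-∘ ϱ τ ρ σ ⊥         = refl
sub-∘ ϱ τ ρ σ (φ ∧ ψ)   = cong₂ _∧_ (sub-∘ ϱ τ ρ σ φ) (sub-∘ ϱ τ ρ σ ψ)
sub-∘ ϱ τ ρ σ (φ ∨ ψ)   = cong₂ _∨_ (sub-∘ ϱ τ ρ σ φ) (sub-∘ ϱ τ ρ σ ψ)
sub-∘ ϱ τ ρ σ (φ ⇒ ψ)   = cong₂ _⇒_ (sub-∘ ϱ τ ρ σ φ) (sub-∘ ϱ τ ρ σ ψ)
sub-∘ ϱ τ ρ σ (∀ᵇ φ)    = cong ∀ᵇ_
  (trans (sub-∘ (liftᵇ ϱ) τ (liftᵇ ρ) σ φ) (sub-cong (liftᵇ-∘ ϱ ρ) (λ _ → refl) φ))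
sub-∘ ϱ τ ρ σ (∃ᵇ φ)    = cong ∃ᵇ_
  (trans (sub-∘ (liftᵇ ϱ) τ (liftᵇ ρ) σ φ) (sub-cong (liftᵇ-∘ ϱ ρ) (λ _ → refl) φ))
sub-∘ ϱ τ ρ σ (∀ᑫ φ)    = cong ∀ᑫ_
  (trans (sub-∘ ϱ (liftᑫ τ) ρ (liftᑫ σ) φ) (sub-cong (λ _ → refl) (liftᑫ-∘ τ σ) φ))
sub-∘ ϱ τ ρ σ (∃ᑫ φ)    = cong ∃ᑫ_
  (trans (sub-∘ ϱ (liftᑫ τ) ρ (liftᑫ σ) φ) (sub-cong (λ _ → refl) (liftᑫ-∘ τ σ) φ))

sub-fuse : {ϱ : Fin m′ → Fin m″} {τ : Fin n′ → Term n″}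
           {ρ : Fin m → Fin m′} {σ : Fin n → Term n′}
           {ρ′ : Fin m → Fin m″} {σ′ : Fin n → Term n″} →
           ϱ ∘ ρ ≗ ρ′ → subᵗ τ ∘ σ ≗ σ′ → sub ϱ τ ∘ sub ρ σ ≗ sub ρ′ σ′
sub-fuse p q φ = trans (sub-∘ _ _ _ _ φ) (sub-cong p q φ)

wkᵇ-[]ᵇ : (a : Fin m) (φ : Formula m n) → wkᵇ φ [ a ]ᵇ ≡ φ
wkᵇ-[]ᵇ a φ = trans (sub-fuse (λ _ → refl) (λ _ → refl) φ) (sub-id φ)

wkᑫ-[]ᑫ : (t : Term n) (φ : Formula m n) → wkᑫ φ [ t ]ᑫ ≡ φ
wkᑫ-[]ᑫ t φ = trans (sub-fuse (λ _ → refl) (λ _ → refl) φ) (sub-id φ)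

↑1-instᑫ : (t s : Term n) → subᵗ (instᑫ t) (↑ 1 s) ≡ s
↑1-instᑫ t s = trans (subᵗ-∘ _ _ s) (subᵗ-id s)

weaken : {Γ Δ : List (Formula m n)} {φ : Formula m n} → Γ ⊆ Δ → Γ ⊢ φ → Δ ⊢ φ
weaken i (hyp p)          = hyp (i p)
weaken i (raa d)          = raa (weaken (∷⁺ʳ _ i) d)
weaken i (∧-intro d e)    = ∧-intro (weaken i d) (weaken i e)
weaken i (∧-elim₁ d)      = ∧-elim₁ (weaken i d)
weaken i (∧-elim₂ d)      = ∧-elim₂ (weaken i d)
weaken i (∨-intro₁ d)     = ∨-intro₁ (weaken i d)
weaken i (∨-intro₂ d)     = ∨-intro₂ (weaken i d)
weaken i (∨-elim d e f)   = ∨-elim (weaken i d) (weaken (∷⁺ʳ _ i) e) (weaken (∷⁺ʳ _ i) f)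
weaken i (⇒-intro d)      = ⇒-intro (weaken (∷⁺ʳ _ i) d)
weaken i (⇒-elim d e)     = ⇒-elim (weaken i d) (weaken i e)
weaken i (∀ᵇ-intro d)     = ∀ᵇ-intro (weaken (map⁺ wkᵇ i) d)
weaken i (∀ᵇ-elim d a)    = ∀ᵇ-elim (weaken i d) a
weaken i (∃ᵇ-intro a d)   = ∃ᵇ-intro a (weaken i d)
weaken i (∃ᵇ-elim d e)    = ∃ᵇ-elim (weaken i d) (weaken (∷⁺ʳ _ (map⁺ wkᵇ i)) e)
weaken i (∀ᑫ-intro d)     = ∀ᑫ-intro (weaken (map⁺ wkᑫ i) d)
weaken i (∀ᑫ-elim d t)    = ∀ᑫ-elim (weaken i d) t
weaken i (∃ᑫ-intro t d)   = ∃ᑫ-intro t (weaken i d)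
weaken i (∃ᑫ-elim d e)    = ∃ᑫ-elim (weaken i d) (weaken (∷⁺ʳ _ (map⁺ wkᑫ i)) e)
weaken i (≈ᵇ-refl a)      = ≈ᵇ-refl a
weaken i (≈ᵇ-subst φ d e) = ≈ᵇ-subst φ (weaken i d) (weaken i e)
weaken i (≈-refl t)       = ≈-refl t
weaken i (≈-subst φ d e)  = ≈-subst φ (weaken i d) (weaken i e)
weaken i inhabitedᵇ       = inhabitedᵇ
weaken i inhabitedᑫ       = inhabitedᑫ

-- Enumeration of formulas

depthᵗ : Term n → ℕ
depthᵗ (var i) = 1
depthᵗ (s ⊕ t) = suc (depthᵗ s ⊔ depthᵗ t)
depthᵗ (s ⊗ t) = suc (depthᵗ s ⊔ depthᵗ t)

depthᵛ : ∀ {k} → Vec (Term n) k → ℕ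
depthᵛ []      = 0
depthᵛ (t ∷ x) = depthᵗ t ⊔ depthᵛ x

depth : Formula m n → ℕ
depth (a ≈ᵇ b)  = 1
depth (s ≈ t)   = suc (depthᵗ s ⊔ depthᵗ t)
depth (s ≺ t)   = suc (depthᵗ s ⊔ depthᵗ t)
depth (IB a)    = 1
depth (Ph a)    = 1
depth (W a b x) = suc (depthᵛ x)
depth ⊥         = 1
depth (φ ∧ ψ)   = suc (depth φ ⊔ depth ψ)
depth (φ ∨ ψ)   = suc (depth φ ⊔ depth ψ)
depth (φ ⇒ ψ)   = suc (depth φ ⊔ depth ψ)
depth (∀ᵇ φ)    = suc (depth φ)
depth (∃ᵇ φ)    = suc (depth φ)
depth (∀ᑫ φ)    = suc (depth φ)
depth (∃ᑫ φ)    = suc (depth φ)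

terms : ℕ → ∀ n → List (Term n)
terms zero    n = []
terms (suc d) n =
  map var (allFin n)
  ++ cartesianProductWith _⊕_ (terms d n) (terms d n)
  ++ cartesianProductWith _⊗_ (terms d n) (terms d n)

tuples : ℕ → ∀ k n → List (Vec (Term n) k)
tuples d zero    n = [] ∷ []
tuples d (suc k) n = cartesianProductWith _∷_ (terms d n) (tuples d k n)

-- Scoped variables leave finitely many formulas of each depth. The recursion is on the depth
-- because quantifiers enlarge the scope.
formulas : ℕ → ∀ m n → List (Formula m n)
formulas zero    m n = []
formulas (suc d) m n =
  cartesianProductWith _≈ᵇ_ (allFin m) (allFin m)
  ++ cartesianProductWith _≈_ (terms d n) (terms d n)
  ++ cartesianProductWith _≺_ (terms d n) (terms d n)
  ++ map IB (allFin m)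
  ++ map Ph (allFin m)
  ++ cartesianProductWith (λ f x → f x)
       (cartesianProductWith W (allFin m) (allFin m)) (tuples d 4 n)
  ++ (⊥ ∷ [])
  ++ cartesianProductWith _∧_ (formulas d m n) (formulas d m n)
  ++ cartesianProductWith _∨_ (formulas d m n) (formulas d m n)
  ++ cartesianProductWith _⇒_ (formulas d m n) (formulas d m n)
  ++ map ∀ᵇ_ (formulas d (suc m) n)
  ++ map ∃ᵇ_ (formulas d (suc m) n)
  ++ map ∀ᑫ_ (formulas d m (suc n))
  ++ map ∃ᑫ_ (formulas d m (suc n))

∈-terms : ∀ {d} (t : Term n) → depthᵗ t ≤ d → t ∈ terms d n
∈-terms (var i) (s≤s _) = ∈-++⁺ˡ (∈-map⁺ var (∈-allFin i))
∈-terms {n} {suc d} (s ⊕ t) (s≤s p) =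
  ∈-++⁺ʳ (map var (allFin n)) (∈-++⁺ˡ (∈-cartesianProductWith⁺ _⊕_
    (∈-terms s (m⊔n≤o⇒m≤o _ _ p)) (∈-terms t (m⊔n≤o⇒n≤o (depthᵗ s) _ p))))
∈-terms {n} {suc d} (s ⊗ t) (s≤s p) =
  ∈-++⁺ʳ (map var (allFin n)) (∈-++⁺ʳ (cartesianProductWith _⊕_ (terms d n) (terms d n))
    (∈-cartesianProductWith⁺ _⊗_
      (∈-terms s (m⊔n≤o⇒m≤o _ _ p)) (∈-terms t (m⊔n≤o⇒n≤o (depthᵗ s) _ p))))

∈-tuples : ∀ {d k} (x : Vec (Term n) k) → depthᵛ x ≤ d → x ∈ tuples d k n
∈-tuples []      p = here refl
∈-tuples (t ∷ x) p = ∈-cartesianProductWith⁺ _∷_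
  (∈-terms t (m⊔n≤o⇒m≤o _ _ p)) (∈-tuples x (m⊔n≤o⇒n≤o (depthᵗ t) _ p))

∈-formulas : ∀ {d} (φ : Formula m n) → depth φ ≤ d → φ ∈ formulas d m n
∈-formulas {m} {n} {suc d} = go
  where
  L₀ = cartesianProductWith (_≈ᵇ_ {m} {n}) (allFin m) (allFin m)
  L₁ = cartesianProductWith (_≈_ {n} {m}) (terms d n) (terms d n)
  L₂ = cartesianProductWith (_≺_ {n} {m}) (terms d n) (terms d n)
  L₃ = map (IB {m} {n}) (allFin m)
  L₄ = map (Ph {m} {n}) (allFin m)
  L₅ = cartesianProductWith (λ f (x : Point n) → f x)
         (cartesianProductWith W (allFin m) (allFin m)) (tuples d 4 n)
  L₇ = cartesianProductWith (_∧_ {m} {n}) (formulas d m n) (formulas d m n)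
  L₈ = cartesianProductWith (_∨_ {m} {n}) (formulas d m n) (formulas d m n)
  L₉ = cartesianProductWith (_⇒_ {m} {n}) (formulas d m n) (formulas d m n)
  M₀ = map (∀ᵇ_ {m} {n}) (formulas d (suc m) n)
  M₁ = map (∃ᵇ_ {m} {n}) (formulas d (suc m) n)
  M₂ = map (∀ᑫ_ {m} {n}) (formulas d m (suc n))

  skip₅ : ∀ {φ L} → φ ∈ L → φ ∈ L₀ ++ L₁ ++ L₂ ++ L₃ ++ L₄ ++ L₅ ++ L
  skip₅ = ∈-++⁺ʳ L₀ ∘ ∈-++⁺ʳ L₁ ∘ ∈-++⁺ʳ L₂ ∘ ∈-++⁺ʳ L₃ ∘ ∈-++⁺ʳ L₄ ∘ ∈-++⁺ʳ L₅

  skip₉ : ∀ {φ L} → φ ∈ L → φ ∈ (⊥ ∷ []) ++ L₇ ++ L₈ ++ L₉ ++ L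
  skip₉ = there ∘ ∈-++⁺ʳ L₇ ∘ ∈-++⁺ʳ L₈ ∘ ∈-++⁺ʳ L₉

  go : (φ : Formula m n) → depth φ ≤ suc d → φ ∈ formulas (suc d) m n
  go (a ≈ᵇ b) _ = ∈-++⁺ˡ (∈-cartesianProductWith⁺ _≈ᵇ_ (∈-allFin a) (∈-allFin b))
  go (s ≈ t) (s≤s p) = ∈-++⁺ʳ L₀ (∈-++⁺ˡ (∈-cartesianProductWith⁺ _≈_
    (∈-terms s (m⊔n≤o⇒m≤o _ _ p)) (∈-terms t (m⊔n≤o⇒n≤o (depthᵗ s) _ p))))
  go (s ≺ t) (s≤s p) = ∈-++⁺ʳ L₀ (∈-++⁺ʳ L₁ (∈-++⁺ˡ (∈-cartesianProductWith⁺ _≺_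
    (∈-terms s (m⊔n≤o⇒m≤o _ _ p)) (∈-terms t (m⊔n≤o⇒n≤o (depthᵗ s) _ p)))))
  go (IB a) _ = ∈-++⁺ʳ L₀ (∈-++⁺ʳ L₁ (∈-++⁺ʳ L₂ (∈-++⁺ˡ (∈-map⁺ IB (∈-allFin a)))))
  go (Ph a) _ = ∈-++⁺ʳ L₀ (∈-++⁺ʳ L₁ (∈-++⁺ʳ L₂ (∈-++⁺ʳ L₃ (∈-++⁺ˡ (∈-map⁺ Ph (∈-allFin a))))))
  go (W a b x) (s≤s p) =
    ∈-++⁺ʳ L₀ (∈-++⁺ʳ L₁ (∈-++⁺ʳ L₂ (∈-++⁺ʳ L₃ (∈-++⁺ʳ L₄ (∈-++⁺ˡ
      (∈-cartesianProductWith⁺ (λ f x → f x)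
        (∈-cartesianProductWith⁺ W (∈-allFin a) (∈-allFin b)) (∈-tuples x p)))))))
  go ⊥ _ = skip₅ (here refl)
  go (φ ∧ ψ) (s≤s p) = skip₅ (there (∈-++⁺ˡ (∈-cartesianProductWith⁺ _∧_
    (∈-formulas φ (m⊔n≤o⇒m≤o _ _ p)) (∈-formulas ψ (m⊔n≤o⇒n≤o (depth φ) _ p)))))
  go (φ ∨ ψ) (s≤s p) = skip₅ (there (∈-++⁺ʳ L₇ (∈-++⁺ˡ (∈-cartesianProductWith⁺ _∨_
    (∈-formulas φ (m⊔n≤o⇒m≤o _ _ p)) (∈-formulas ψ (m⊔n≤o⇒n≤o (depth φ) _ p))))))
  go (φ ⇒ ψ) (s≤s p) = skip₅ (there (∈-++⁺ʳ L₇ (∈-++⁺ʳ L₈ (∈-++⁺ˡ (∈-cartesianProductWith⁺ _⇒_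
    (∈-formulas φ (m⊔n≤o⇒m≤o _ _ p)) (∈-formulas ψ (m⊔n≤o⇒n≤o (depth φ) _ p)))))))
  go (∀ᵇ φ) (s≤s p) = skip₅ (skip₉ (∈-++⁺ˡ (∈-map⁺ ∀ᵇ_ (∈-formulas φ p))))
  go (∃ᵇ φ) (s≤s p) = skip₅ (skip₉ (∈-++⁺ʳ M₀ (∈-++⁺ˡ (∈-map⁺ ∃ᵇ_ (∈-formulas φ p)))))
  go (∀ᑫ φ) (s≤s p) = skip₅ (skip₉ (∈-++⁺ʳ M₀ (∈-++⁺ʳ M₁ (∈-++⁺ˡ (∈-map⁺ ∀ᑫ_ (∈-formulas φ p))))))
  go (∃ᑫ φ) (s≤s p) =
    skip₅ (skip₉ (∈-++⁺ʳ M₀ (∈-++⁺ʳ M₁ (∈-++⁺ʳ M₂ (∈-map⁺ ∃ᑫ_ (∈-formulas φ p))))))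
∈-formulas {d = zero} (a ≈ᵇ b) ()

module Stream {A : Set} (junk : A) (block : ℕ → List A) where

  -- A `junk` item precedes each block, so every call consumes one unit of the position even if
  -- blocks are empty.
  drain : List A → ℕ → ℕ → A
  drain []       d zero    = junk
  drain []       d (suc n) = drain (block d) (suc d) n
  drain (x ∷ xs) d zero    = x
  drain (x ∷ xs) d (suc n) = drain xs d n

  item : ℕ → A
  item = drain [] 0

  skip : ∀ xs d → ∃[ j ] ∀ i → drain xs d (j ℕ.+ i) ≡ drain [] d i
  skip []       d = 0 , λ _ → refl
  skip (x ∷ xs) d = let j , p = skip xs d in suc j , p

  find : ∀ {x xs} d → x ∈ xs → ∃[ j ] drain xs d j ≡ x
  find d (here refl) = 0 , refl
  find d (there x∈)  = let j , p = find d x∈ in suc j , p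

  reach : ∀ d → ∃[ n ] d ≤ n × (∀ i → item (n ℕ.+ i) ≡ drain [] d i)
  reach zero    = 0 , z≤n , λ _ → refl
  reach (suc d) = let n , d≤n , p = reach d ; j , q = skip (block d) (suc d) in
    n ℕ.+ suc j , subst (suc d ≤_) (sym (+-suc n j)) (s≤s (≤-trans d≤n (m≤m+n n j))) ,
    λ i → trans (cong item (+-assoc n (suc j) i)) (trans (p (suc j ℕ.+ i)) (q i))

  -- The bound `d ≤ n` matters: a formula must be listed later than all names in it, so that its
  -- witness is fresh.
  item-onto : ∀ {d x} → x ∈ block d → ∃[ n ] d ≤ n × item n ≡ x
  item-onto {d} x∈ = let n , d≤n , p = reach d ; j , q = find (suc d) x∈ in
    n ℕ.+ suc j , ≤-trans d≤n (m≤m+n n _) , trans (p (suc j)) q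

-- Absolute names and their de Bruijn indices at each stage

data NameTerm : Set where
  name    : ℕ → NameTerm
  _⊞_ _⊠_ : NameTerm → NameTerm → NameTerm

-- At stage K the names 0, …, K are free variables, the latest name K being
-- de Bruijn index 0.  Larger names are junk.
index : ∀ K → ℕ → Fin (suc K)
index zero    i = zero
index (suc K) i with i ≤? K
... | yes _ = suc (index K i)
... | no  _ = zero

index-old : ∀ {K i} → i ≤ K → index (suc K) i ≡ suc (index K i)
index-old {K} {i} i≤K with i ≤? K
... | yes _ = refl
... | no ≰  = ⊥-elim (≰ i≤K)

index-new : ∀ K → index (suc K) (suc K) ≡ zero
index-new K with suc K ≤? K
... | yes p = ⊥-elim (<-irrefl refl p)
... | no  _ = refl

unindex : ∀ K → Fin (suc K) → ℕ
unindex K i = K ∸ toℕ i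

unindex-index : ∀ {K i} → i ≤ K → unindex K (index K i) ≡ i
unindex-index {zero}  z≤n = refl
unindex-index {suc K} i≤ with m≤n⇒m<n∨m≡n i≤
... | inj₁ (s≤s i≤K) rewrite index-old i≤K = unindex-index i≤K
... | inj₂ refl      rewrite index-new K   = refl

stageᵗ : ∀ K → NameTerm → Term (suc K)
stageᵗ K (name i) = var (index K i)
stageᵗ K (s ⊞ t)  = stageᵗ K s ⊕ stageᵗ K t
stageᵗ K (s ⊠ t)  = stageᵗ K s ⊗ stageᵗ K t

bound : NameTerm → ℕ
bound (name i) = i
bound (s ⊞ t)  = bound s ⊔ bound t
bound (s ⊠ t)  = bound s ⊔ bound t

stageᵗ-old : ∀ {K} t → bound t ≤ K → stageᵗ (suc K) t ≡ ↑ 1 (stageᵗ K t)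
stageᵗ-old (name i) p = cong var (index-old p)
stageᵗ-old (s ⊞ t)  p =
  cong₂ _⊕_ (stageᵗ-old s (m⊔n≤o⇒m≤o _ _ p)) (stageᵗ-old t (m⊔n≤o⇒n≤o (bound s) _ p))
stageᵗ-old (s ⊠ t)  p =
  cong₂ _⊗_ (stageᵗ-old s (m⊔n≤o⇒m≤o _ _ p)) (stageᵗ-old t (m⊔n≤o⇒n≤o (bound s) _ p))

stageᵗ-rename : ∀ {k} K t → bound t ≤ k →
                subᵗ (var ∘ index K ∘ unindex k) (stageᵗ k t) ≡ stageᵗ K t
stageᵗ-rename K (name i) p = cong (var ∘ index K) (unindex-index p)
stageᵗ-rename K (s ⊞ t)  p =
  cong₂ _⊕_ (stageᵗ-rename K s (m⊔n≤o⇒m≤o _ _ p)) (stageᵗ-rename K t (m⊔n≤o⇒n≤o (bound s) _ p))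
stageᵗ-rename K (s ⊠ t)  p =
  cong₂ _⊗_ (stageᵗ-rename K s (m⊔n≤o⇒m≤o _ _ p)) (stageᵗ-rename K t (m⊔n≤o⇒n≤o (bound s) _ p))

stage : Formula m n → (Fin m → ℕ) → (Fin n → NameTerm) → ∀ K → Formula (suc K) (suc K)
stage φ ρ σ K = sub (index K ∘ ρ) (stageᵗ K ∘ σ) φ

common-bound : (f : Fin n → ℕ) → ∃[ b ] ∀ i → f i ≤ b
common-bound {zero}  f = 0 , λ ()
common-bound {suc n} f = let b , p = common-bound (f ∘ suc) in
  f zero ⊔ b , λ { zero → m≤m⊔n _ _ ; (suc i) → ≤-trans (p i) (m≤n⊔m (f zero) b) }

wk : Formula m n → Formula (suc m) (suc n)
wk φ = wkᑫ (wkᵇ φ)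

wk-sub : {ρ : Fin m → Fin m′} {σ : Fin n → Term n′}
         {ρ′ : Fin m → Fin (suc m′)} {σ′ : Fin n → Term (suc n′)} →
         suc ∘ ρ ≗ ρ′ → ↑ 1 ∘ σ ≗ σ′ → wk ∘ sub ρ σ ≗ sub ρ′ σ′
wk-sub {σ = σ} p q φ =
  trans (cong wkᑫ (sub-∘ _ _ _ _ φ))
        (sub-fuse p (λ i → trans (cong (↑ 1) (subᵗ-id (σ i))) (q i)) φ)

stage-old : ∀ {K} (φ : Formula m n) ρ σ → (∀ i → ρ i ≤ K) → (∀ i → bound (σ i) ≤ K) →
            stage φ ρ σ (suc K) ≡ wk (stage φ ρ σ K)
stage-old φ ρ σ p q =
  sym (wk-sub (λ i → sym (index-old (p i))) (λ i → sym (stageᵗ-old (σ i) (q i))) φ)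

Coded : Set
Coded = ∃[ k ] Formula (suc k) (suc k)

codes : ℕ → List Coded
codes d = concatMap (λ k → map (k ,_) (formulas d (suc k) (suc k))) (upTo d)

open Stream (0 , ⊥) codes

-- A formula with names, given by its instances at all stages; instances before the largest name has
-- appeared are junk.
Nominal : Set
Nominal = ∀ K → Formula (suc K) (suc K)

infix 4 _≋_

_≋_ : Nominal → Nominal → Set
f ≋ g = ∀ K → f K ≡ g K

decode : Coded → Nominal
decode (k , φ) K = sub (index K ∘ unindex k) (var ∘ index K ∘ unindex k) φ

enum : ℕ → Nominal
enum = decode ∘ item

enum-onto : (φ : Formula m n) (ρ : Fin m → ℕ) (σ : Fin n → NameTerm) →
            ∃[ e ] (∀ i → ρ i ≤ e) × (∀ i → bound (σ i) ≤ e) × enum e ≋ stage φ ρ σ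
enum-onto φ ρ σ =
  let b , p = common-bound ρ
      c , q = common-bound (bound ∘ σ)
      k  = b ⊔ c
      φ′ = stage φ ρ σ k
      -- Block `d` lists scope parameters below `d` and depths up to `d`.
      d  = suc k ⊔ depth φ′
      ρ≤ = λ i → ≤-trans (p i) (m≤m⊔n b c)
      σ≤ = λ i → ≤-trans (q i) (m≤n⊔m b c)
      e , d≤e , eq = item-onto {d} {k , φ′}
        (∈-concatMap⁺ (λ k → map (k ,_) (formulas d (suc k) (suc k)))
          (lose (∈-upTo⁺ {d} (m≤m⊔n (suc k) (depth φ′)))
            (∈-map⁺ (k ,_) (∈-formulas φ′ (m≤n⊔m (suc k) (depth φ′))))))
      k≤e = ≤-trans (n≤1+n k) (≤-trans (m≤m⊔n (suc k) (depth φ′)) d≤e)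
  in e , (λ i → ≤-trans (ρ≤ i) k≤e) , (λ i → ≤-trans (σ≤ i) k≤e) ,
     λ K → trans (cong (λ c → decode c K) eq)
       (sub-fuse (λ i → cong (index K) (unindex-index (ρ≤ i)))
                 (λ i → stageᵗ-rename K (σ i) (σ≤ i)) φ)

private
  variable
    Γ : List (Formula m n)
    φ ψ : Formula m n

-- Derived rules

coerce : φ ≡ ψ → Γ ⊢ φ → Γ ⊢ ψ
coerce refl d = d

absurd : Γ ⊢ ⊥ → Γ ⊢ φ
absurd d = raa (weaken there d)

~⇒-elim₁ : Γ ⊢ ~ (φ ⇒ ψ) → Γ ⊢ φ
~⇒-elim₁ d = raa (⇒-elim (weaken there d)
  (⇒-intro (absurd (⇒-elim (hyp (there (here refl))) (hyp (here refl))))))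

~⇒-elim₂ : Γ ⊢ ~ (φ ⇒ ψ) → Γ ⊢ ~ ψ
~⇒-elim₂ d = ⇒-intro (⇒-elim (weaken there d) (⇒-intro (hyp (there (here refl)))))

-- The drinker formula with a fresh variable is conservative: refuting it yields φ of the fresh
-- variable, hence ∀φ, and also ¬∀φ. The latter is derived under the fresh variable, and `a` is what
-- that variable is instantiated with.
drinkᵇ : (a : Fin m) (φ : Formula (suc m) n) →
         (φ ⇒ wkᵇ (∀ᵇ φ)) ∷ map wkᵇ Γ ⊢ ⊥ → Γ ⊢ ⊥
drinkᵇ a φ d = ⇒-elim
  (coerce (cong ~_ (wkᵇ-[]ᵇ a (∀ᵇ φ))) (∀ᵇ-elim (∀ᵇ-intro (~⇒-elim₂ (⇒-intro d))) a))
  (∀ᵇ-intro (~⇒-elim₁ (⇒-intro d)))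

drinkᑫ : (t : Term n) (φ : Formula m (suc n)) →
         (φ ⇒ wkᑫ (∀ᑫ φ)) ∷ map wkᑫ Γ ⊢ ⊥ → Γ ⊢ ⊥
drinkᑫ t φ d = ⇒-elim
  (coerce (cong ~_ (wkᑫ-[]ᑫ t (∀ᑫ φ))) (∀ᑫ-elim (∀ᑫ-intro (~⇒-elim₂ (⇒-intro d))) t))
  (∀ᑫ-intro (~⇒-elim₁ (⇒-intro d)))

∃∀~ᵇ : {φ : Formula (suc m) n} → Γ ⊢ ∃ᵇ φ → Γ ⊢ ∀ᵇ ~ φ → Γ ⊢ ⊥
∃∀~ᵇ {φ = φ} d e = ⇒-elim (⇒-intro (∃ᵇ-elim (weaken there d)
  (⇒-elim (coerce (cong ~_ eq) (∀ᵇ-elim (hyp (there (here refl))) zero)) (hyp (here refl))))) e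
  where
  eq : sub (liftᵇ suc) var φ [ zero ]ᵇ ≡ φ
  eq = trans (sub-fuse (λ { zero → refl ; (suc i) → refl }) (λ _ → refl) φ) (sub-id φ)

∃∀~ᑫ : {φ : Formula m (suc n)} → Γ ⊢ ∃ᑫ φ → Γ ⊢ ∀ᑫ ~ φ → Γ ⊢ ⊥
∃∀~ᑫ {φ = φ} d e = ⇒-elim (⇒-intro (∃ᑫ-elim (weaken there d)
  (⇒-elim (coerce (cong ~_ eq) (∀ᑫ-elim (hyp (there (here refl))) (var zero))) (hyp (here refl))))) e
  where
  eq : sub id (liftᑫ (var ∘ suc)) φ [ var zero ]ᑫ ≡ φ
  eq = trans (sub-fuse (λ _ → refl) (λ { zero → refl ; (suc i) → refl }) φ) (sub-id φ)

-- For formulas not of this form the default ⊥ turns the witness axiom into an instance of ex falso.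
bodyᵇ : Formula m n → Formula (suc m) n
bodyᵇ (∀ᵇ φ) = φ
bodyᵇ _      = ⊥

bodyᑫ : Formula m n → Formula m (suc n)
bodyᑫ (∀ᑫ φ) = φ
bodyᑫ _      = ⊥

-- The Henkin theory and its term model

module Henkin (Γ₀ : List Sentence) (R : Set) (collapse : Γ₀ ⊢ ⊥ → R) where

  witnessᵇ : ∀ K → Formula (suc (suc K)) (suc K)
  witnessᵇ K = bodyᵇ (enum K K)

  witnessᑫ : ∀ K → Formula (suc (suc K)) (suc (suc K))
  witnessᑫ K = bodyᑫ (wkᵇ (enum K K))

  -- Step K adds one variable of each sort, named `suc K`, and for each a Henkin axiom φ ⇒ ∀φ with φ
  -- the body of `enum K`.
  theory : ∀ K → List (Formula (suc K) (suc K))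
  theory zero    = map wk Γ₀
  theory (suc K) = (witnessᑫ K ⇒ wkᑫ (∀ᑫ witnessᑫ K))
                   ∷ map wkᑫ ((witnessᵇ K ⇒ wkᵇ (∀ᵇ witnessᵇ K)) ∷ map wkᵇ (theory K))

  ∈-theory-suc : ∀ {K φ} → φ ∈ theory K → wk φ ∈ theory (suc K)
  ∈-theory-suc p = there (∈-map⁺ wkᑫ (there (∈-map⁺ wkᵇ p)))

  theory-consistent : ∀ K → theory K ⊢ ⊥ → R
  theory-consistent zero    d =
    -- Stage 0 already has one free variable of each sort; nonemptiness of the sorts discharges
    -- both.
    collapse (∃ᵇ-elim inhabitedᵇ (∃ᑫ-elim inhabitedᑫ (weaken i d)))
    where
    i : map wk Γ₀ ⊆ _ ∷ map wkᑫ (_ ∷ map wkᵇ Γ₀)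
    i = there ∘ there ∘ subst (_ ∈_) (map-∘ Γ₀)
  theory-consistent (suc K) d =
    theory-consistent K (drinkᵇ zero (witnessᵇ K) (drinkᑫ (var zero) (witnessᑫ K) d))

  sentence∈theory : ∀ {φ} → φ ∈ Γ₀ → ∀ K → stage φ (λ ()) (λ ()) K ∈ theory K
  sentence∈theory {φ} p zero    =
    subst (_∈ theory 0) (sub-fuse (λ ()) (λ ()) φ) (∈-map⁺ wk p)
  sentence∈theory {φ} p (suc K) =
    subst (_∈ theory (suc K)) (sym (stage-old φ (λ ()) (λ ()) (λ ()) (λ ())))
      (∈-theory-suc (sentence∈theory p K))

  module _ (φ : Formula (suc m) n) (ρ : Fin m → ℕ) (σ : Fin n → NameTerm) {e}
           (ρ≤ : ∀ i → ρ i ≤ e) (σ≤ : ∀ i → bound (σ i) ≤ e)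
           (eq : enum e ≋ stage (∀ᵇ φ) ρ σ) where

    -- The axiom enters at stage `suc e`, where the new variable has index 0, and is weakened
    -- afterwards. The bounds by `e` keep the new name out of the formula.
    witnessᵇ∈theory : ∀ {K} → suc e ≤ K →
                      (stage φ (suc e ◂ ρ) σ K ⇒ stage (∀ᵇ φ) ρ σ K) ∈ theory K
    witnessᵇ∈theory {suc K} (s≤s e≤K) with m≤n⇒m<n∨m≡n e≤K
    ... | inj₁ e<K = subst (_∈ theory (suc K))
            (sym (cong₂ _⇒_
              (stage-old φ (suc e ◂ ρ) σ
                (λ { zero → e<K ; (suc i) → ≤-trans (ρ≤ i) e≤K }) (λ i → ≤-trans (σ≤ i) e≤K))
              (stage-old (∀ᵇ φ) ρ σ (λ i → ≤-trans (ρ≤ i) e≤K) (λ i → ≤-trans (σ≤ i) e≤K))))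
            (∈-theory-suc (witnessᵇ∈theory e<K))
    ... | inj₂ refl = there (here (cong₂ _⇒_ (trans (sym new) (cong (wkᑫ ∘ bodyᵇ) (sym (eq K))))
            (trans (stage-old (∀ᵇ φ) ρ σ ρ≤ σ≤)
                   (cong (λ χ → wk (∀ᵇ bodyᵇ χ)) (sym (eq K))))))
      where
      new : wkᑫ (sub (liftᵇ (index e ∘ ρ)) (stageᵗ e ∘ σ) φ) ≡ stage φ (suc e ◂ ρ) σ (suc e)
      new = sub-fuse (λ { zero → sym (index-new e) ; (suc i) → sym (index-old (ρ≤ i)) })
                     (λ i → sym (stageᵗ-old (σ i) (σ≤ i))) φ

  module _ (φ : Formula m (suc n)) (ρ : Fin m → ℕ) (σ : Fin n → NameTerm) {e}
           (ρ≤ : ∀ i → ρ i ≤ e) (σ≤ : ∀ i → bound (σ i) ≤ e)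
           (eq : enum e ≋ stage (∀ᑫ φ) ρ σ) where

    witnessᑫ∈theory : ∀ {K} → suc e ≤ K →
                      (stage φ ρ (name (suc e) ◂ σ) K ⇒ stage (∀ᑫ φ) ρ σ K) ∈ theory K
    witnessᑫ∈theory {suc K} (s≤s e≤K) with m≤n⇒m<n∨m≡n e≤K
    ... | inj₁ e<K = subst (_∈ theory (suc K))
            (sym (cong₂ _⇒_
              (stage-old φ ρ (name (suc e) ◂ σ) (λ i → ≤-trans (ρ≤ i) e≤K)
                (λ { zero → e<K ; (suc i) → ≤-trans (σ≤ i) e≤K }))
              (stage-old (∀ᑫ φ) ρ σ (λ i → ≤-trans (ρ≤ i) e≤K) (λ i → ≤-trans (σ≤ i) e≤K))))
            (∈-theory-suc (witnessᑫ∈theory e<K))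
    ... | inj₂ refl = here (cong₂ _⇒_ (trans (sym new) (cong (bodyᑫ ∘ wkᵇ) (sym (eq K))))
            (trans (stage-old (∀ᑫ φ) ρ σ ρ≤ σ≤)
                   (cong (λ χ → wkᑫ (∀ᑫ bodyᑫ (wkᵇ χ))) (sym (eq K)))))
      where
      new : sub suc (liftᑫ var) (sub (index e ∘ ρ) (liftᑫ (stageᵗ e ∘ σ)) φ)
            ≡ stage φ ρ (name (suc e) ◂ σ) (suc e)
      new = sub-fuse (λ i → sym (index-old (ρ≤ i)))
              (λ { zero    → cong var (sym (index-new e))
                 ; (suc i) → trans (trans (subᵗ-∘ _ _ (stageᵗ e (σ i))) refl)
                                   (sym (stageᵗ-old (σ i) (σ≤ i))) }) φ

  infix 0 _⊩_

  -- Derivability at all late stages: early ones misread names not yet introduced, and two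
  -- derivations combine beyond both thresholds.
  _⊩_ : List Nominal → Nominal → Set
  Δ ⊩ f = ∃[ K₀ ] ∀ K → K₀ ≤ K → map (_$ K) Δ ++ theory K ⊢ f K

  -- drawn e Δ: Δ is a finite part of the first e steps of a maximal extension of
  -- the theory.  Whether enum e may be added is not decidable, so Δ carries the
  -- evidence that adding it keeps derivations of ⊥ harmless.
  drawn : ℕ → List Nominal → Set
  harmless : ℕ → Set

  drawn zero    Δ = Δ ≡ []
  drawn (suc e) Δ = drawn e Δ ⊎ (∃[ Δ′ ] Δ ≡ enum e ∷ Δ′ × drawn e Δ′ × harmless e)

  harmless e = ∀ Δ → drawn e Δ → (enum e ∷ Δ ⊩ λ _ → ⊥) → R

  drawn-consistent : ∀ e {Δ} → drawn e Δ → (Δ ⊩ λ _ → ⊥) → R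
  drawn-consistent zero    refl (K , d) = theory-consistent K (d K ≤-refl)
  drawn-consistent (suc e) (inj₁ p) d = drawn-consistent e p d
  drawn-consistent (suc e) (inj₂ (Δ′ , refl , p , ok)) d = ok Δ′ p d

  drawn-[] : ∀ e → drawn e []
  drawn-[] zero    = refl
  drawn-[] (suc e) = inj₁ (drawn-[] e)

  drawn-mono : ∀ {e e′ Δ} → e ≤ e′ → drawn e Δ → drawn e′ Δ
  drawn-mono {zero}  {e′}     z≤n     refl = drawn-[] e′
  drawn-mono {suc e} {suc e′} (s≤s p) (inj₁ q) = inj₁ (drawn-mono p q)
  drawn-mono {suc e} {suc e′} (s≤s p) q@(inj₂ _) with m≤n⇒m<n∨m≡n p
  ... | inj₁ e<e′ = inj₁ (drawn-mono e<e′ q)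
  ... | inj₂ refl = q

  -- Rules with two premises need a common finite part; evidence of harmlessness refers to the
  -- formula alone, so it passes to the union.
  drawn-union : ∀ e {Δ Δ′} → drawn e Δ → drawn e Δ′ → ∃[ Δ″ ] drawn e Δ″ × Δ ⊆ Δ″ × Δ′ ⊆ Δ″
  drawn-union zero    refl refl = [] , refl , ⊆-refl , ⊆-refl
  drawn-union (suc e) (inj₁ p) (inj₁ q) =
    let Δ , r , i , j = drawn-union e p q in Δ , inj₁ r , i , j
  drawn-union (suc e) (inj₁ p) (inj₂ (_ , refl , q , ok)) =
    let Δ , r , i , j = drawn-union e p q in
    enum e ∷ Δ , inj₂ (Δ , refl , r , ok) , there ∘ i , ∷⁺ʳ _ j
  drawn-union (suc e) (inj₂ (_ , refl , p , ok)) (inj₁ q) =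
    let Δ , r , i , j = drawn-union e p q in
    enum e ∷ Δ , inj₂ (Δ , refl , r , ok) , ∷⁺ʳ _ i , there ∘ j
  drawn-union (suc e) (inj₂ (_ , refl , p , ok)) (inj₂ (_ , refl , q , _)) =
    let Δ , r , i , j = drawn-union e p q in
    enum e ∷ Δ , inj₂ (Δ , refl , r , ok) , ∷⁺ʳ _ i , ∷⁺ʳ _ j

  True : Nominal → Set
  True f = ∃[ e ] ∃[ Δ ] drawn e Δ × (Δ ⊩ f)

  Rule₀ : Nominal → Set
  Rule₀ f = ∀ K {Γ : List (Formula (suc K) (suc K))} → Γ ⊢ f K

  Rule₁ : Nominal → Nominal → Set
  Rule₁ f g = ∀ K {Γ : List (Formula (suc K) (suc K))} → Γ ⊢ f K → Γ ⊢ g K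

  Rule₂ : Nominal → Nominal → Nominal → Set
  Rule₂ f g h = ∀ K {Γ : List (Formula (suc K) (suc K))} → Γ ⊢ f K → Γ ⊢ g K → Γ ⊢ h K

  rule₀ : ∀ {f} → Rule₀ f → True f
  rule₀ r = 0 , [] , refl , 0 , λ K _ → r K

  rule₁ : ∀ {f g} → Rule₁ f g → True f → True g
  rule₁ r (e , Δ , p , K₀ , d) = e , Δ , p , K₀ , λ K le → r K (d K le)

  rule₂ : ∀ {f g h} → Rule₂ f g h → True f → True g → True h
  rule₂ r (e , Δ , p , K₀ , d) (e′ , Δ′ , p′ , K₀′ , d′) =
    let Δ″ , p″ , i , i′ = drawn-union (e ⊔ e′) (drawn-mono (m≤m⊔n e e′) p)
                                                (drawn-mono (m≤n⊔m e e′) p′) in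
    e ⊔ e′ , Δ″ , p″ , K₀ ⊔ K₀′ , λ K le →
    r K (weaken (++⁺ (map⁺ (_$ K) i) ⊆-refl) (d K (≤-trans (m≤m⊔n K₀ K₀′) le)))
        (weaken (++⁺ (map⁺ (_$ K) i′) ⊆-refl) (d′ K (≤-trans (m≤n⊔m K₀ K₀′) le)))

  theory-true : ∀ {f} K₀ → (∀ K → K₀ ≤ K → f K ∈ theory K) → True f
  theory-true K₀ p = 0 , [] , refl , K₀ , λ K le → hyp (p K le)

  ⊥-true : True (λ _ → ⊥) → R
  ⊥-true (e , Δ , p , d) = drawn-consistent e p d

  Listed : Nominal → Set
  Listed f = ∃[ e ] enum e ≋ f

  true-if-harmless : ∀ {f e} → enum e ≋ f →
                     (∀ Δ → drawn e Δ → (f ∷ Δ ⊩ λ _ → ⊥) → R) → True f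
  true-if-harmless {f} {e} eq ok =
    suc e , enum e ∷ [] , inj₂ ([] , refl , drawn-[] e , ok′) , 0 ,
    λ K _ → coerce (eq K) (hyp (here refl))
    where
    ok′ : harmless e
    ok′ Δ p (K₀ , d) = ok Δ p (K₀ , λ K le → subst (λ χ → χ ∷ _ ⊢ ⊥) (eq K) (d K le))

  -- If adding `f` gave ⊥, its negation would be true, so truth of `f` would yield `R`, and then the
  -- hypothesis yields `R`. So `f` is harmless.
  true-stable : ∀ {f} → Listed f → ((True f → R) → R) → True f
  true-stable (e , eq) k = true-if-harmless eq λ Δ p (K₀ , d) →
    k λ t → ⊥-true (rule₂ (λ K → ⇒-elim) (e , Δ , p , K₀ , λ K le → ⇒-intro (d K le)) t)

  -- A refutation of the implication proves `f` and refutes `g` from the same part of the extension,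
  -- contradicting the hypothesis.
  true-⇒ : ∀ {f g} → Listed (λ K → f K ⇒ g K) → (True f → True g) → True (λ K → f K ⇒ g K)
  true-⇒ (e , eq) k = true-if-harmless eq λ Δ p (K₀ , d) →
    ⊥-true (rule₂ (λ K → ⇒-elim)
      (e , Δ , p , K₀ , λ K le → ~⇒-elim₂ (⇒-intro (d K le)))
      (k (e , Δ , p , K₀ , λ K le → ~⇒-elim₁ (⇒-intro (d K le)))))

  model : Structure
  model = record
    { Absurd   = R
    ; Body     = ℕ
    ; Quantity = NameTerm
    ; plus     = _⊞_
    ; times    = _⊠_
    ; SameBody = λ a b → True λ K → index K a ≈ᵇ index K b
    ; Equal    = λ s t → True λ K → stageᵗ K s ≈ stageᵗ K t
    ; Less     = λ s t → True λ K → stageᵗ K s ≺ stageᵗ K t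
    ; Inertial = λ a → True λ K → IB (index K a)
    ; Photon   = λ a → True λ K → Ph (index K a)
    ; Sees     = λ a b x → True λ K → W (index K a) (index K b) (Vec.map (stageᵗ K) x)
    }

  open Structure model

  listed : (φ : Formula m n) (ρ : Fin m → ℕ) (σ : Fin n → NameTerm) → Listed (stage φ ρ σ)
  listed φ ρ σ = let e , _ , _ , eq = enum-onto φ ρ σ in e , eq

  stage-[]ᵇ : (φ : Formula (suc m) n) (ρ : Fin m → ℕ) (σ : Fin n → NameTerm) (b : ℕ) →
              ∀ K → sub (liftᵇ (index K ∘ ρ)) (stageᵗ K ∘ σ) φ [ index K b ]ᵇ
                    ≡ stage φ (b ◂ ρ) σ K
  stage-[]ᵇ φ ρ σ b K = sub-fuse (λ { zero → refl ; (suc i) → refl }) (λ i → subᵗ-id _) φ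

  stage-[]ᑫ : (φ : Formula m (suc n)) (ρ : Fin m → ℕ) (σ : Fin n → NameTerm) (q : NameTerm) →
              ∀ K → sub (index K ∘ ρ) (liftᑫ (stageᵗ K ∘ σ)) φ [ stageᵗ K q ]ᑫ
                    ≡ stage φ ρ (q ◂ σ) K
  stage-[]ᑫ φ ρ σ q K =
    sub-fuse (λ i → refl) (λ { zero → refl ; (suc i) → ↑1-instᑫ _ _ }) φ

  stage-eval : ∀ (t : Term n) σ K → stageᵗ K (⟦ t ⟧ᵗ σ) ≡ subᵗ (stageᵗ K ∘ σ) t
  stage-eval (var i) σ K = refl
  stage-eval (s ⊕ t) σ K = cong₂ _⊕_ (stage-eval s σ K) (stage-eval t σ K)
  stage-eval (s ⊗ t) σ K = cong₂ _⊗_ (stage-eval s σ K) (stage-eval t σ K)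

  stage-evals : ∀ {k} (x : Vec (Term n) k) σ K →
                Vec.map (stageᵗ K) (Vec.map (λ t → ⟦ t ⟧ᵗ σ) x) ≡ Vec.map (subᵗ (stageᵗ K ∘ σ)) x
  stage-evals x σ K =
    trans (sym (Vecₚ.map-∘ (stageᵗ K) (λ t → ⟦ t ⟧ᵗ σ) x)) (Vecₚ.map-cong (λ t → stage-eval t σ K) x)

  true-≋ : ∀ {f g} → f ≋ g → True f → True g
  true-≋ p = rule₁ λ K → coerce (p K)

  henkinᵇ : (φ : Formula (suc m) n) (ρ : Fin m → ℕ) (σ : Fin n → NameTerm) →
            ∃[ b ] (True (stage φ (b ◂ ρ) σ) → True (stage (∀ᵇ φ) ρ σ))
  henkinᵇ φ ρ σ = let e , ρ≤ , σ≤ , eq = enum-onto (∀ᵇ φ) ρ σ in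
    suc e , rule₂ (λ K → ⇒-elim) (theory-true (suc e) λ K → witnessᵇ∈theory φ ρ σ ρ≤ σ≤ eq)

  henkinᑫ : (φ : Formula m (suc n)) (ρ : Fin m → ℕ) (σ : Fin n → NameTerm) →
            ∃[ q ] (True (stage φ ρ (q ◂ σ)) → True (stage (∀ᑫ φ) ρ σ))
  henkinᑫ φ ρ σ = let e , ρ≤ , σ≤ , eq = enum-onto (∀ᑫ φ) ρ σ in
    name (suc e) ,
    rule₂ (λ K → ⇒-elim) (theory-true (suc e) λ K → witnessᑫ∈theory φ ρ σ ρ≤ σ≤ eq)

  true-~ : ∀ {f} → Listed (λ K → ~ f K) → (True f → R) → True (λ K → ~ f K)
  true-~ (e , eq) k = true-if-harmless eq λ Δ p (K₀ , d) →
    k (e , Δ , p , K₀ , λ K le → raa (d K le))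

  -- The witness is the Henkin name for ∀¬φ: if φ failed there, ∀¬φ would be true.
  true-∃ᵇ : (φ : Formula (suc m) n) (ρ : Fin m → ℕ) (σ : Fin n → NameTerm) →
            True (stage (∃ᵇ φ) ρ σ) → ∃[ b ] True (stage φ (b ◂ ρ) σ)
  true-∃ᵇ φ ρ σ t = let b , h = henkinᵇ (~ φ) ρ σ in
    b , true-stable (listed φ (b ◂ ρ) σ) λ k →
      ⊥-true (rule₂ (λ K → ∃∀~ᵇ) t (h (true-~ (listed (~ φ) (b ◂ ρ) σ) k)))

  true-∃ᑫ : (φ : Formula m (suc n)) (ρ : Fin m → ℕ) (σ : Fin n → NameTerm) →
            True (stage (∃ᑫ φ) ρ σ) → ∃[ q ] True (stage φ ρ (q ◂ σ))
  true-∃ᑫ φ ρ σ t = let q , h = henkinᑫ (~ φ) ρ σ in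
    q , true-stable (listed φ ρ (q ◂ σ)) λ k →
      ⊥-true (rule₂ (λ K → ∃∀~ᑫ) t (h (true-~ (listed (~ φ) ρ (q ◂ σ)) k)))

  -- The truth lemma. Both directions are proved together because implication exchanges them on its
  -- premise.
  reify   : (φ : Formula m n) (ρ : Fin m → ℕ) (σ : Fin n → NameTerm) →
            ⟦ φ ⟧ ρ σ → True (stage φ ρ σ)
  reflect : (φ : Formula m n) (ρ : Fin m → ℕ) (σ : Fin n → NameTerm) →
            True (stage φ ρ σ) → ⟦ φ ⟧ ρ σ

  reify (a ≈ᵇ b) ρ σ t  = t
  reify (r ≈ s) ρ σ t   = true-≋ (λ K → cong₂ _≈_ (stage-eval r σ K) (stage-eval s σ K)) t
  reify (r ≺ s) ρ σ t   = true-≋ (λ K → cong₂ _≺_ (stage-eval r σ K) (stage-eval s σ K)) t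
  reify (IB a) ρ σ t    = t
  reify (Ph a) ρ σ t    = t
  reify (W a b x) ρ σ t = true-≋ (λ K → cong (W _ _) (stage-evals x σ K)) t
  reify ⊥ ρ σ r         = true-stable (listed ⊥ ρ σ) λ _ → r
  reify (φ ∧ ψ) ρ σ (t , u) = rule₂ (λ K → ∧-intro) (reify φ ρ σ t) (reify ψ ρ σ u)
  reify (φ ∨ ψ) ρ σ k   = true-stable (listed (φ ∨ ψ) ρ σ) λ j →
    k (λ t → j (rule₁ (λ K → ∨-intro₁) (reify φ ρ σ t)))
      (λ t → j (rule₁ (λ K → ∨-intro₂) (reify ψ ρ σ t)))
  reify (φ ⇒ ψ) ρ σ k   =
    true-⇒ (listed (φ ⇒ ψ) ρ σ) λ t → reify ψ ρ σ (k (reflect φ ρ σ t))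
  reify (∀ᵇ φ) ρ σ k    = let b , h = henkinᵇ φ ρ σ in h (reify φ (b ◂ ρ) σ (k b))
  reify (∃ᵇ φ) ρ σ (b , t) =
    rule₁ (λ K d → ∃ᵇ-intro (index K b) (coerce (sym (stage-[]ᵇ φ ρ σ b K)) d))
          (reify φ (b ◂ ρ) σ t)
  reify (∀ᑫ φ) ρ σ k    = let q , h = henkinᑫ φ ρ σ in h (reify φ ρ (q ◂ σ) (k q))
  reify (∃ᑫ φ) ρ σ (q , t) =
    rule₁ (λ K d → ∃ᑫ-intro (stageᵗ K q) (coerce (sym (stage-[]ᑫ φ ρ σ q K)) d))
          (reify φ ρ (q ◂ σ) t)

  reflect (a ≈ᵇ b) ρ σ t  = t
  reflect (r ≈ s) ρ σ t   =
    true-≋ (λ K → sym (cong₂ _≈_ (stage-eval r σ K) (stage-eval s σ K))) t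
  reflect (r ≺ s) ρ σ t   =
    true-≋ (λ K → sym (cong₂ _≺_ (stage-eval r σ K) (stage-eval s σ K))) t
  reflect (IB a) ρ σ t    = t
  reflect (Ph a) ρ σ t    = t
  reflect (W a b x) ρ σ t = true-≋ (λ K → cong (W _ _) (sym (stage-evals x σ K))) t
  reflect ⊥ ρ σ t         = ⊥-true t
  reflect (φ ∧ ψ) ρ σ t   =
    reflect φ ρ σ (rule₁ (λ K → ∧-elim₁) t) , reflect ψ ρ σ (rule₁ (λ K → ∧-elim₂) t)
  reflect (φ ∨ ψ) ρ σ t k j = ⊥-true
    (rule₂ (λ K d e → ∨-elim d (⇒-elim (weaken there (∧-elim₁ e)) (hyp (here refl)))
                               (⇒-elim (weaken there (∧-elim₂ e)) (hyp (here refl))))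
      t
      (rule₂ (λ K → ∧-intro)
        (true-~ (listed (~ φ) ρ σ) λ u → k (reflect φ ρ σ u))
        (true-~ (listed (~ ψ) ρ σ) λ u → j (reflect ψ ρ σ u))))
  reflect (φ ⇒ ψ) ρ σ t u = reflect ψ ρ σ (rule₂ (λ K → ⇒-elim) t (reify φ ρ σ u))
  reflect (∀ᵇ φ) ρ σ t b  = reflect φ (b ◂ ρ) σ
    (rule₁ (λ K d → coerce (stage-[]ᵇ φ ρ σ b K) (∀ᵇ-elim d (index K b))) t)
  reflect (∃ᵇ φ) ρ σ t    = let b , u = true-∃ᵇ φ ρ σ t in b , reflect φ (b ◂ ρ) σ u
  reflect (∀ᑫ φ) ρ σ t q  = reflect φ ρ (q ◂ σ)
    (rule₁ (λ K d → coerce (stage-[]ᑫ φ ρ σ q K) (∀ᑫ-elim d (stageᵗ K q))) t)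
  reflect (∃ᑫ φ) ρ σ t    = let q , u = true-∃ᑫ φ ρ σ t in q , reflect φ ρ (q ◂ σ) u

  classical : IsClassical model
  classical = record
    { stable    = λ φ ρ σ k → reflect φ ρ σ
                    (true-stable (listed φ ρ σ) λ j → k λ t → j (reify φ ρ σ t))
    ; reflexive = λ q → rule₀ λ K → ≈-refl _
    ; leibniz   = λ φ ρ σ {q} {r} e t → reflect φ ρ (r ◂ σ)
                    (rule₂ (λ K d d′ → coerce (stage-[]ᑫ φ ρ σ r K)
                             (≈-subst _ d (coerce (sym (stage-[]ᑫ φ ρ σ q K)) d′)))
                      e (reify φ ρ (q ◂ σ) t))
    }

  satisfies : All ⟦_⟧ˢ Γ₀
  satisfies = tabulate λ {φ} p →
    reflect φ (λ ()) (λ ()) (theory-true 0 λ K _ → sentence∈theory p K)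

completeness : (Γ : List Sentence) (φ : Sentence) →
               ((M : Structure) → IsClassical M → let open Structure M in
                 All ⟦_⟧ˢ Γ → ⟦ φ ⟧ˢ) →
               Γ ⊢ φ
-- With `R` chosen as this very derivability of ⊥, the model needs no consistency assumption, and
-- truth of ~ φ in it is a map from truth of φ to the derivation sought.
completeness Γ φ valid = raa (sat₁ (valid model classical sats))
  where
  open Henkin (~ φ ∷ Γ) (~ φ ∷ Γ ⊢ ⊥) id
  open Structure model
  sat₁ : ⟦ φ ⟧ˢ → ~ φ ∷ Γ ⊢ ⊥
  sat₁ with satisfies
  ... | n ∷ _ = n
  sats : All ⟦_⟧ˢ Γ
  sats with satisfies
  ... | _ ∷ s = s

theorem2 : SpecRel ⊢ IntervalInvariance
theorem2 = completeness SpecRel IntervalInvariance Models.intervalInvariance
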